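{- The decision problem $\langle I,T,\mathrm{cnf},k,s\rangle$, where the inputs $I,T,k,s$ range over finite attribute sets $I$, databases $T$ on $I$ without nulls, naturals $1\le k\le |I|$, and rationals $0<s\le 1$, is in P.
   Context: An attribute is an identifier $A$ with a domain $\mathrm{dom}(A)$. The domain of a categorical attribute is an unordered set of values; that of a numeric attribute is a set of integers or rationals; both kinds of domain also include a special null value $\epsilon$. A database $T$ on a finite attribute set $I$ is a relation with duplicates (a finite multiset of tuples) having attribute set $I$; $t[A]$ is the value of $A$ in tuple $t$, and $|t|=|\{A\in I: t[A]\neq\epsilon\}|$. $T$ is without nulls if $|t|=|I|$ for every $t\in T$; otherwise it is with nulls. An atomic condition on a categorical attribute $A$ is $A=u$ or $A\neq u$ with $u\in \mathrm{dom}(A)\setminus\{\epsilon\}$; on a numeric attribute $A$ it is $A\in[l,u]$ or $A\notin[l,u]$ with numeric values $l\le u$ not necessarily distinct ($A=u$, $A\ne u$ abbreviate the case $[u,u]$). A tuple $t$ satisfies an atomic condition on $A$ iff $t[A]\neq\epsilon$ and $t[A]$ fulfils the stated relation (so a null value satisfies no condition). A condition is a conjunction $C=C_1\wedge\dots\wedge C_n$ of atomic conditions on distinct attributes $A_1,\dots,A_n$; its size is $|C|=n$; $t$ satisfies $C$ iff it satisfies every $C_i$; $T_C$ is the (multi)set of tuples of $T$ satisfying $C$, with $|T_C|$ counted with duplicates. An association rule on $I$ is $B\Rightarrow H$ with $B,H$ conditions on attribute sets $I_B,I_H$ with $\emptyset\subset I_B,I_H\subset I$ and $I_B\cap I_H=\emptyset$;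 its size is $|B\Rightarrow H|=|B|+|H|$. It is trivial (w.r.t. $T$) if $B\wedge H$ contains at least one atomic condition $C_a$ with $T_{C_a}=T$. The confidence is $\mathrm{cnf}(B\Rightarrow H,T)=|T_{B\wedge H}|/|T_B|$, taken to be $0$ when $|T_B|=0$. The problem $\langle I,T,\rho,k,s\rangle$ for an index $\rho$ asks: is there a non-trivial association rule $R$ on $I$ with $|R|\ge k$ and $\rho(R,T)\ge s$? -}

module Defs where

open import Data.Bool.Base using (Bool)
open import Data.Digit using (Bit; toDigits)
open import Data.Fin.Base using (Fin)
open import Data.Fin.Patterns using (0F; 1F; 2F; 3F; 4F; 5F; 6F)
import Data.Fin.Properties as Fin
open import Data.Integer.Base using (ℤ; +_; -[1+_])
open import Data.List.Base using (List; []; _∷_; [_]; _++_; map; filter; length; concatMap)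
import Data.List.Properties as List
open import Data.List.Membership.Propositional using (_∈_)
open import Data.List.Relation.Binary.Disjoint.Propositional using (Disjoint)
open import Data.List.Relation.Binary.Permutation.Propositional using (_↭_)
open import Data.List.Relation.Binary.Subset.Propositional using (_⊆_)
open import Data.List.Relation.Unary.All using (All; []; _∷_; all?; lookup)
open import Data.List.Relation.Unary.Any using (Any)
open import Data.List.Relation.Unary.Unique.Propositional using (Unique)
open import Data.Maybe.Base using (Maybe; just; nothing)
import Data.Maybe.Relation.Unary.Any as Maybe
open import Data.Nat.Base using (ℕ; zero; suc; _+_; _*_; _^_; _≤_)
open import Data.Product.Base using (Σ; Σ-syntax; ∃; ∃-syntax; _×_; _,_; proj₁)
open import Data.Rational.Base as ℚ using (ℚ; 0ℚ; 1ℚ; ↥_; ↧ₙ_)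
import Data.Rational.Properties as ℚ
open import Data.Sum.Base using (_⊎_; inj₁; inj₂)
open import Data.Vec.Base as Vec using (Vec; _∷_)
open import Function.Base using (_∘_)
open import Function.Bundles using (_↔_; mk↔ₛ′)
open import Relation.Binary.PropositionalEquality using (_≡_; refl)
open import Relation.Nullary.Decidable using (Dec; ¬?; _×-dec_)
open import Relation.Nullary.Negation using (¬_)
open import Relation.Nullary.Reflects using (Reflects)

------------------------------------------------------------------------
-- Deterministic multitape Turing machines

Finite : Set → Set
Finite A = ∃[ n ] A ↔ Fin n

data Move : Set where
  left stay right : Move

-- A two-way infinite tape over A, `nothing` being the blank.  The cells to
-- the left and to the right of the head are listed nearest first, and all
-- cells beyond the lists are blank.

record Tape (A : Set) : Set where
  constructor tape
  field
    before  : List (Maybe A)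
    scanned : Maybe A
    after   : List (Maybe A)

open Tape public using (scanned)

module _ {A : Set} where

  blankTape : Tape A
  blankTape = tape [] nothing []

  wordTape : List A → Tape A
  wordTape []       = blankTape
  wordTape (a ∷ as) = tape [] (just a) (map just as)

  write : Maybe A → Tape A → Tape A
  write a (tape ls _ rs) = tape ls a rs

  move : Move → Tape A → Tape A
  move left  (tape []       a rs) = tape [] nothing (a ∷ rs)
  move left  (tape (l ∷ ls) a rs) = tape ls l (a ∷ rs)
  move stay  t                    = t
  move right (tape ls a [])       = tape (a ∷ ls) nothing []
  move right (tape ls a (r ∷ rs)) = tape (a ∷ ls) r rs

  act : Maybe A × Move → Tape A → Tape A
  act (a , m) t = move m (write a t)

-- The tape symbols are the input symbols, further work symbols and the
-- blank.  A transition either enters another state or halts with a verdict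
-- (`true` = accept, `false` = reject).

record TuringMachine (Input : Set) : Set₁ where
  field
    State       : Set
    stateFinite : Finite State
    Work        : Set
    workFinite  : Finite Work
    workTapes   : ℕ
    start       : State

  Letter : Set
  Letter = Input ⊎ Work

  tapes : ℕ
  tapes = suc workTapes

  field
    δ : State → Vec (Maybe Letter) tapes →
        (Bool ⊎ State) × Vec (Maybe Letter × Move) tapes

module _ {Input : Set} (M : TuringMachine Input) where
  open TuringMachine M

  Configuration : Set
  Configuration = (Bool ⊎ State) × Vec (Tape Letter) tapes

  initial : List Input → Configuration
  initial w = inj₂ start , wordTape (map inj₁ w) ∷ Vec.replicate workTapes blankTape

  step : Configuration → Configuration
  step (inj₁ b , ts) = inj₁ b , ts
  step (inj₂ q , ts) with δ q (Vec.map scanned ts)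
  ... | c , as = c , Vec.zipWith act as ts

  run : ℕ → Configuration → Configuration
  run zero    c = c
  run (suc n) c = run n (step c)

  -- Halted configurations are fixed by `step`, so this says that M halts
  -- with verdict b on input w after at most n steps.

  HaltsWithin : ℕ → List Input → Bool → Set
  HaltsWithin n w b = proj₁ (run n (initial w)) ≡ inj₁ b

------------------------------------------------------------------------
-- Decision problems and the class P

record DecisionProblem : Set₁ where
  field
    Symbol       : Set
    symbolFinite : Finite Symbol
    Instance     : Set
    encode       : Instance → List Symbol
    Yes          : Instance → Set

-- Words that encode no instance are not inputs of the problem.

InP : DecisionProblem → Set₁
InP Π = Σ[ M ∈ TuringMachine Symbol ] ∃[ c ] ∃[ d ] ∀ (x : Instance) →
        ∃[ b ] HaltsWithin M (c * length (encode x) ^ d + c) (encode x) b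
             × Reflects (Yes x) b
  where open DecisionProblem Π

------------------------------------------------------------------------
-- Attributes

-- Attribute identifiers and categorical values are words over {0, 1}.

Word : Set
Word = List Bit

Identifier : Set
Identifier = Word

data Kind : Set where
  categorical numeric : Kind

Value : Kind → Set
Value categorical = Word
Value numeric     = ℚ

-- The assignment of domains to attributes.  The domains are arbitrary,
-- possibly infinite, sets; `dom A` is the domain of A without its null.

record Universe : Set₁ where
  field
    kind : Identifier → Kind
    dom  : (A : Identifier) → Value (kind A) → Set

-- Atomic conditions on an attribute whose domain, without the null, is D.

data CategoricalAtom (D : Word → Set) : Set where
  equal notEqual : (u : Word) → D u → CategoricalAtom D

data NumericAtom : Set where
  inside outside : (l u : ℚ) → l ℚ.≤ u → NumericAtom

Atomic : (κ : Kind) → (Value κ → Set) → Set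
Atomic categorical D = CategoricalAtom D
Atomic numeric     D = NumericAtom

Fulfils : ∀ κ {D} → Atomic κ D → Value κ → Set
Fulfils categorical (equal u _)     v = v ≡ u
Fulfils categorical (notEqual u _)  v = ¬ (v ≡ u)
Fulfils numeric     (inside l u _)  v = l ℚ.≤ v × v ℚ.≤ u
Fulfils numeric     (outside l u _) v = ¬ (l ℚ.≤ v × v ℚ.≤ u)

fulfils? : ∀ κ {D} (a : Atomic κ D) (v : Value κ) → Dec (Fulfils κ {D} a v)
fulfils? categorical (equal u _)     v = List.≡-dec Fin._≟_ v u
fulfils? categorical (notEqual u _)  v = ¬? (List.≡-dec Fin._≟_ v u)
fulfils? numeric     (inside l u _)  v = (l ℚ.≤? v) ×-dec (v ℚ.≤? u)
fulfils? numeric     (outside l u _) v = ¬? ((l ℚ.≤? v) ×-dec (v ℚ.≤? u))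

-- Attribute sets are duplicate-free lists of identifiers.

infix 4 _⊂_

_⊂_ : List Identifier → List Identifier → Set
J ⊂ I = J ⊆ I × ¬ (I ⊆ J)

------------------------------------------------------------------------
-- Databases and association rules

module Mining (U : Universe) where
  open Universe U

  -- An element of the domain of A, `nothing` being the null.

  Cell : Identifier → Set
  Cell A = Maybe (∃ (dom A))

  Tuple : List Identifier → Set
  Tuple I = All Cell I

  ∣_∣ₜ : ∀ {I} → Tuple I → ℕ
  ∣ [] ∣ₜ          = 0
  ∣ nothing ∷ t ∣ₜ = ∣ t ∣ₜ
  ∣ just _ ∷ t ∣ₜ  = suc ∣ t ∣ₜ

  -- A multiset of tuples; the multiset equality is _↭_.

  Database : List Identifier → Set
  Database I = List (Tuple I)

  WithoutNulls : ∀ {I} → Database I → Set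
  WithoutNulls {I} T = All (λ t → ∣ t ∣ₜ ≡ length I) T

  record AtomicOn (I : List Identifier) : Set where
    field
      attribute : Identifier
      member    : attribute ∈ I
      atomic    : Atomic (kind attribute) (dom attribute)

  open AtomicOn public

  infix 4 _⊨_ _⊨?_

  _⊨_ : ∀ {I} → Tuple I → AtomicOn I → Set
  t ⊨ a = Maybe.Any (Fulfils (kind (attribute a)) (atomic a) ∘ proj₁) (lookup t (member a))

  _⊨?_ : ∀ {I} (t : Tuple I) (a : AtomicOn I) → Dec (t ⊨ a)
  t ⊨? a = Maybe.dec (fulfils? (kind (attribute a)) (atomic a) ∘ proj₁) (lookup t (member a))

  -- select as T is T_C for the conjunction C of the atomic conditions as.

  select : ∀ {I} → List (AtomicOn I) → Database I → Database I
  select as = filter (λ t → all? (t ⊨?_) as)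

  record Condition (I : List Identifier) : Set where
    field
      atoms    : List (AtomicOn I)
      distinct : Unique (map attribute atoms)

    attributes : List Identifier
    attributes = map attribute atoms

    size : ℕ
    size = length atoms

  open Condition public

  record Rule (I : List Identifier) : Set where
    field
      body head     : Condition I
      body-nonempty : [] ⊂ attributes body
      body-proper   : attributes body ⊂ I
      head-nonempty : [] ⊂ attributes head
      head-proper   : attributes head ⊂ I
      disjoint      : Disjoint (attributes body) (attributes head)

    conjunction : List (AtomicOn I)
    conjunction = atoms body ++ atoms head

    ruleSize : ℕ
    ruleSize = size body + size head

  open Rule public

  Trivial : ∀ {I} → Rule I → Database I → Set
  Trivial R T = Any (λ a → select [ a ] T ↭ T) (conjunction R)

  ratio : ℕ → ℕ → ℚ
  ratio m zero    = 0ℚ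
  ratio m (suc n) = + m ℚ./ suc n

  cnf : ∀ {I} → Rule I → Database I → ℚ
  cnf R T = ratio (length (select (conjunction R) T)) (length (select (atoms (body R)) T))

  record Input : Set where
    field
      I            : List Identifier
      I-unique     : Unique I
      T            : Database I
      withoutNulls : WithoutNulls T
      k            : ℕ
      1≤k          : 1 ≤ k
      k≤∣I∣        : k ≤ length I
      s            : ℚ
      0<s          : 0ℚ ℚ.< s
      s≤1          : s ℚ.≤ 1ℚ

  HasRule : (∀ {I} → Rule I → Database I → ℚ) → Input → Set
  HasRule ρ x = Σ[ R ∈ Rule I ] ¬ Trivial R T × k ≤ ruleSize R × s ℚ.≤ ρ R T
    where open Input x

  ----------------------------------------------------------------------
  -- Encoding of inputs

  -- A word for k, one for s, one for each attribute identifier and one for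
  -- each cell of each tuple.  A number is written in binary, least
  -- significant digit first; the domains belong to the fixed universe and
  -- are not part of the input.

  data InputSymbol : Set where
    bit                              : Bit → InputSymbol
    minus slash null comma semicolon : InputSymbol

  encodeWord : Word → List InputSymbol
  encodeWord = map bit

  encodeℕ : ℕ → List InputSymbol
  encodeℕ n = encodeWord (proj₁ (toDigits 2 n))

  encodeℤ : ℤ → List InputSymbol
  encodeℤ (+ n)    = encodeℕ n
  encodeℤ -[1+ n ] = minus ∷ encodeℕ (suc n)

  encodeℚ : ℚ → List InputSymbol
  encodeℚ q = encodeℤ (↥ q) ++ slash ∷ encodeℕ (↧ₙ q)

  encodeValue : ∀ κ → Value κ → List InputSymbol
  encodeValue categorical = encodeWord
  encodeValue numeric     = encodeℚ

  encodeCell : ∀ {A} → Cell A → List InputSymbol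
  encodeCell nothing            = [ null ]
  encodeCell {A} (just (v , _)) = encodeValue (kind A) v

  encodeTuple : ∀ {I} → Tuple I → List InputSymbol
  encodeTuple []      = [ semicolon ]
  encodeTuple (c ∷ t) = encodeCell c ++ comma ∷ encodeTuple t

  encodeAttributes : List Identifier → List InputSymbol
  encodeAttributes []      = [ semicolon ]
  encodeAttributes (A ∷ I) = encodeWord A ++ comma ∷ encodeAttributes I

  encodeInput : Input → List InputSymbol
  encodeInput x = encodeℕ k ++ semicolon ∷ encodeℚ s ++ semicolon ∷
                  encodeAttributes I ++ concatMap encodeTuple T
    where open Input x

  inputSymbolFinite : Finite InputSymbol
  inputSymbolFinite = 7 , mk↔ₛ′ to from to∘from from∘to
    where
    to : InputSymbol → Fin 7
    to (bit 0F)  = 0F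
    to (bit 1F)  = 1F
    to minus     = 2F
    to slash     = 3F
    to null      = 4F
    to comma     = 5F
    to semicolon = 6F

    from : Fin 7 → InputSymbol
    from 0F = bit 0F
    from 1F = bit 1F
    from 2F = minus
    from 3F = slash
    from 4F = null
    from 5F = comma
    from 6F = semicolon

    to∘from : ∀ i → to (from i) ≡ i
    to∘from 0F = refl
    to∘from 1F = refl
    to∘from 2F = refl
    to∘from 3F = refl
    to∘from 4F = refl
    to∘from 5F = refl
    to∘from 6F = refl

    from∘to : ∀ a → from (to a) ≡ a
    from∘to (bit 0F)  = refl
    from∘to (bit 1F)  = refl
    from∘to minus     = refl
    from∘to slash     = refl
    from∘to null      = refl
    from∘to comma     = refl
    from∘to semicolon = refl

  -- The problem ⟨ I , T , ρ , k , s ⟩ for a fixed index ρ, restricted to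
  -- databases without nulls.

  problem : (∀ {I} → Rule I → Database I → ℚ) → DecisionProblem
  problem ρ = record
    { Symbol       = InputSymbol
    ; symbolFinite = inputSymbolFinite
    ; Instance     = Input
    ; encode       = encodeInput
    ; Yes          = HasRule ρ
    }

{-# OPTIONS --safe #-}
module Submission where

-- A rule of confidence at least s can be given a single head condition A ≠ v,
-- with v a value of A in T, and a body that fixes every other non-constant
-- attribute to its value in some tuple t: moving head conditions to the body
-- does not lower the confidence, some class of tuples agreeing off A does at
-- least as well as the whole body, and A ≠ v is the weakest condition that
-- the tuple with value v refutes.  So there is a rule iff at least max(2, k)
-- attributes are not constant and, for some A, t and v, at least the
-- proportion s of the tuples that agree with t off A differ from v at A.
-- This criterion is a first-order sentence with counting quantifiers about
-- the cells of T.  Such sentences are evaluated by nested loops in a small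
-- language of stack registers, every register being a tape of the machine.

open import Defs

open import Data.Bool.Base using (Bool; true; false; if_then_else_; _∧_; _∨_; not; T)
import Data.Bool.Properties as Bool
open import Data.Digit using (toDigits; fromDigits)
open import Data.Empty using (⊥-elim)
open import Data.Fin.Base using (Fin; zero; suc; opposite; inject₁; fromℕ; toℕ)
open import Data.Fin.Patterns using (0F; 1F; 2F; 3F; 4F; 5F; 6F; 7F; 8F; 9F)
import Data.Fin.Properties as Fin
open import Data.Integer.Base as ℤ using (ℤ; -[1+_])
import Data.Integer.Properties as ℤ
open import Data.List.Base as List using (List; []; _∷_; [_]; _++_; _ʳ++_; length; drop; head; concatMap; filter; allFin)
open import Data.List.Membership.Propositional using (_∈_; find; lose)
open import Data.List.Membership.Propositional.Properties using (∈-filter⁺; ∈-filter⁻; ∈-map⁺; ∈-map⁻; ∈-allFin; ∈-lookup)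
import Data.List.Properties as List
open import Data.List.Relation.Binary.Permutation.Propositional using (↭-reflexive)
open import Data.List.Relation.Binary.Permutation.Propositional.Properties using (↭-length)
open import Data.List.Relation.Unary.All as All using (All; []; _∷_)
import Data.List.Relation.Unary.All.Properties as All
open import Data.List.Relation.Unary.AllPairs as AllPairs using (AllPairs; []; _∷_)
import Data.List.Relation.Unary.AllPairs.Properties as AllPairs
open import Data.List.Relation.Unary.Any as Any using (Any; here; there)
import Data.List.Relation.Unary.Any.Properties as Any
open import Data.List.Relation.Unary.Unique.Propositional using (Unique)
import Data.List.Relation.Unary.Unique.Propositional.Properties as Unique
open import Data.Maybe.Base as Maybe using (Maybe; just; nothing; is-just; maybe′)
import Data.Maybe.Relation.Unary.Any as MaybeAny
open import Data.Nat.Base using (ℕ; zero; suc; _+_; _*_; _^_; _∸_; _≤_; _<_; _≤ᵇ_; z≤n; s≤s; ⌊_/2⌋; ⌈_/2⌉; NonZero)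
open import Data.Nat.Induction using (<-wellFounded)
open import Data.Nat.ListAction using (sum)
open import Data.Nat.Properties
open import Data.Nat.Tactic.RingSolver using (solve-∀)
open import Data.Product.Base using (Σ-syntax; ∃-syntax; ∃₂; _×_; _,_; proj₁; proj₂; map₁)
open import Data.Rational.Base as ℚ using (ℚ; mkℚ; 0ℚ; ↥_; ↧ₙ_)
import Data.Rational.Properties as ℚ
open import Data.Rational.Unnormalised.Base as ℚᵘ using (mkℚᵘ; *≤*)
import Data.Rational.Unnormalised.Properties as ℚᵘ
open import Data.Sum.Base using (_⊎_; inj₁; inj₂)
open import Data.Sum.Function.Propositional using (_⊎-↔_)
open import Data.Unit.Base using (⊤; tt)
open import Data.Vec.Base as Vec using (Vec; []; _∷_; lookup; _[_]≔_)
import Data.Vec.Properties as Vec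
open import Function.Base using (_∘_; id; case_of_)
open import Function.Bundles using (_⇔_; mk⇔; module Equivalence)
open import Function.Construct.Composition using (_⇔-∘_)
open import Function.Construct.Identity using (↔-id)
open import Function.Properties.Inverse using (↔-sym; ↔-trans; ↔⇒↣)
open import Induction.WellFounded using (Acc; acc)
open import Relation.Binary.Definitions using (DecidableEquality)
open import Relation.Binary.PropositionalEquality hiding ([_])
open import Relation.Nullary.Decidable using (Dec; yes; no; does; does-⇔; ¬?; _×-dec_; _→-dec_; decidable-stable)
open import Relation.Nullary.Negation using (¬_; contradiction)
open import Relation.Nullary.Reflects using (Reflects; ofʸ; ofⁿ)

-- The domains may be infinite, so rules cannot be enumerated; the criterion speaks only of values
-- that occur in T, and these supply all conditions of the rule that it promises. Only non-constant
-- attributes count because each condition of a non-trivial rule with positive confidence is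
-- satisfied by one tuple and refuted by another; the 2 in max(2, k) stands for one condition on
-- either side. The class that does as well as the body comes from averaging. Absence of nulls is
-- used twice: a tuple whose value is not v then satisfies A ≠ v, and the symbol for null is free to
-- serve as a marker. On the side of computation, the numerator and denominator of s are binary and
-- may be exponential in the length of the input, while all counts are at most the number of cells;
-- so p * D ≤ q * N has to be decided without forming the products. Each quantifier multiplies the
-- time by the length of the table, which is harmless for a fixed sentence. Agreement off A becomes
-- a single equality of words, since each cell is stored with the rest of its row.

private variable
  d n : ℕ

-- A stack language and its translation to Turing machines

-- A register holds a stack of symbols of Γ.  In `Prog d n` there are n
-- registers in scope, and d more can be introduced, empty, by `local`.

module Stack (Γ : Set) where

  Store : ℕ → Set
  Store = Vec (List Γ)

  Test : ℕ → Set
  Test n = Fin n × Fin n × (Maybe Γ → Maybe Γ → Bool)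

  holds : Test n → Store n → Bool
  holds (i , j , f) σ = f (head (lookup σ i)) (head (lookup σ j))

  infixr 4 _⨾_

  data Prog : ℕ → ℕ → Set where
    skip  : Prog d n
    push  : Fin n → Γ → Prog d n
    cp    : Fin n → Fin n → Prog d n
    pop   : Fin n → Prog d n
    _⨾_   : Prog d n → Prog d n → Prog d n
    ifte  : Test n → Prog d n → Prog d n → Prog d n
    while : Test n → Prog d n → Prog d n
    local : Prog d (suc n) → Prog (suc d) n

  private variable
    t : Test n
    p q : Prog d n
    σ σ′ σ″ : Store n
    i j : Fin n
    a : Γ
    k l : ℕ

  -- The last index is the number of machine steps after translation: a push moves to the left and
  -- then writes, a test takes one step, and sequencing and `local` are free because they only
  -- affect the set of states. `cp` reads its source in the second step, when the target head has
  -- already moved; hence `i ≢ j`. Its source must be nonempty, as otherwise a blank would be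
  -- written and cut off the target's content.
  data Run : Prog d n → Store n → Store n → ℕ → Set where
    skip  : Run {d} skip σ σ 1
    push  : Run {d} (push i a) σ (σ [ i ]≔ (a ∷ lookup σ i)) 2
    cp    : ∀ {xs} → i ≢ j → lookup σ i ≡ a ∷ xs →
            Run {d} (cp i j) σ (σ [ j ]≔ (a ∷ lookup σ j)) 2
    pop   : Run {d} (pop i) σ (σ [ i ]≔ drop 1 (lookup σ i)) 1
    _⨾_   : Run p σ σ′ k → Run q σ′ σ″ l → Run (p ⨾ q) σ σ″ (k + l)
    then′ : holds t σ ≡ true → Run p σ σ′ k → Run (ifte t p q) σ σ′ (suc k)
    else′ : holds t σ ≡ false → Run q σ σ′ k → Run (ifte t p q) σ σ′ (suc k)
    done  : holds t σ ≡ false → Run {d} (while t p) σ σ 1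
    again : holds t σ ≡ true → Run p σ σ′ k → Run (while t p) σ′ σ″ l →
            Run (while t p) σ σ″ (suc (k + l))
    local : Run p ([] ∷ σ) ([] ∷ σ′) k → Run (local p) σ σ′ k

  -- Translation to Turing machines

  tot : ℕ → ℕ → ℕ
  tot zero    n = n
  tot (suc d) n = tot d (suc n)

  emb : ∀ d → Fin n → Fin (tot d n)
  emb zero    i = i
  emb (suc d) i = emb d (suc i)

  pad : ∀ d → Store n → Store (tot d n)
  pad zero    σ = σ
  pad (suc d) σ = pad d ([] ∷ σ)

  lookup-pad : ∀ d (σ : Store n) i → lookup (pad d σ) (emb d i) ≡ lookup σ i
  lookup-pad zero    σ i = refl
  lookup-pad (suc d) σ i = lookup-pad d ([] ∷ σ) (suc i)

  pad-update : ∀ d (σ : Store n) i xs → pad d (σ [ i ]≔ xs) ≡ pad d σ [ emb d i ]≔ xs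
  pad-update zero    σ i xs = refl
  pad-update (suc d) σ i xs = pad-update d ([] ∷ σ) (suc i) xs

  emb-injective : ∀ d {i j : Fin n} → emb d i ≡ emb d j → i ≡ j
  emb-injective zero    eq = eq
  emb-injective (suc d) eq = Fin.suc-injective (emb-injective d eq)

  -- New registers come first in a store, whereas the input has to be on the
  -- first tape: the tapes are numbered backwards.

  tapeOf : ∀ d → Fin n → Fin (tot d n)
  tapeOf d i = opposite (emb d i)

  opposite-injective : {i j : Fin n} → opposite i ≡ opposite j → i ≡ j
  opposite-injective {i = i} {j} eq =
    trans (sym (Fin.opposite-involutive i)) (trans (cong opposite eq) (Fin.opposite-involutive j))

  Letter : Set
  Letter = Γ ⊎ Fin 0

  Scan : ℕ → Set
  Scan = Vec (Maybe Letter)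

  Acts : ℕ → Set
  Acts = Vec (Maybe Letter × Move)

  symbol : Letter → Γ
  symbol (inj₁ a) = a

  -- What lies beyond the first blank is garbage.

  content : List (Maybe Letter) → List Γ
  content []             = []
  content (nothing ∷ cs) = []
  content (just a ∷ cs)  = symbol a ∷ content cs

  stack : Tape Letter → List Γ
  stack (tape _ c cs) = content (c ∷ cs)

  top : Maybe Letter → Maybe Γ
  top = Maybe.map symbol

  top-scanned : ∀ t → top (scanned t) ≡ head (stack t)
  top-scanned (tape _ nothing  _) = refl
  top-scanned (tape _ (just _) _) = refl

  stack-push : ∀ t a → stack (write (just (inj₁ a)) (move left (write (scanned t) t))) ≡ a ∷ stack t
  stack-push (tape []      _ _) a = refl
  stack-push (tape (_ ∷ _) _ _) a = refl

  -- On a blank the head must stay: a move to the right could expose cells about which the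
  -- representation says nothing, whereas popping an empty stack has to leave it empty.
  popMove : Maybe Letter → Move
  popMove nothing  = stay
  popMove (just _) = right

  stack-pop : ∀ t → stack (act (scanned t , popMove (scanned t)) t) ≡ drop 1 (stack t)
  stack-pop (tape _ nothing  _)       = refl
  stack-pop (tape _ (just _) [])      = refl
  stack-pop (tape _ (just _) (_ ∷ _)) = refl

  Pos : Prog d n → Set
  Pos skip         = ⊤
  Pos (push _ _)   = Fin 2
  Pos (cp _ _)     = Fin 2
  Pos (pop _)      = ⊤
  Pos (p ⨾ q)      = Pos p ⊎ Pos q
  Pos (ifte _ p q) = ⊤ ⊎ (Pos p ⊎ Pos q)
  Pos (while _ p)  = ⊤ ⊎ Pos p
  Pos (local p)    = Pos p

  entry : (p : Prog d n) → Pos p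
  entry skip         = tt
  entry (push _ _)   = 0F
  entry (cp _ _)     = 0F
  entry (pop _)      = tt
  entry (p ⨾ _)      = inj₁ (entry p)
  entry (ifte _ _ _) = inj₁ tt
  entry (while _ _)  = inj₁ tt
  entry (local p)    = entry p

  keep : Scan n → Acts n
  keep = Vec.map (_, stay)

  test : ∀ d → Test n → Scan (tot d n) → Bool
  test d (i , j , f) v = f (top (lookup v (tapeOf d i))) (top (lookup v (tapeOf d j)))

  -- `nothing` leaves the program.

  next : (p : Prog d n) → Pos p → Scan (tot d n) → Maybe (Pos p) × Acts (tot d n)
  next skip _ v = nothing , keep v
  next {d} (push i a) 0F v = just 1F , keep v [ tapeOf d i ]≔ (lookup v (tapeOf d i) , left)
  next {d} (push i a) 1F v = nothing , keep v [ tapeOf d i ]≔ (just (inj₁ a) , stay)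
  next {d} (cp i j) 0F v = just 1F , keep v [ tapeOf d j ]≔ (lookup v (tapeOf d j) , left)
  next {d} (cp i j) 1F v = nothing , keep v [ tapeOf d j ]≔ (lookup v (tapeOf d i) , stay)
  next {d} (pop i) _ v = nothing , keep v [ tapeOf d i ]≔ (lookup v (tapeOf d i) , popMove (lookup v (tapeOf d i)))
  next (p ⨾ q) (inj₁ s) v = map₁ (just ∘ maybe′ inj₁ (inj₂ (entry q))) (next p s v)
  next (p ⨾ q) (inj₂ s) v = map₁ (Maybe.map inj₂) (next q s v)
  next {d} (ifte t p q) (inj₁ _) v = just (inj₂ (if test d t v then inj₁ (entry p) else inj₂ (entry q))) , keep v
  next (ifte t p q) (inj₂ (inj₁ s)) v = map₁ (Maybe.map (inj₂ ∘ inj₁)) (next p s v)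
  next (ifte t p q) (inj₂ (inj₂ s)) v = map₁ (Maybe.map (inj₂ ∘ inj₂)) (next q s v)
  next {d} (while t p) (inj₁ _) v = (if test d t v then just (inj₂ (entry p)) else nothing) , keep v
  next (while t p) (inj₂ s) v = map₁ (just ∘ maybe′ inj₂ (inj₁ tt)) (next p s v)
  next (local p) s v = next p s v

  ⊎-finite : ∀ {A B : Set} → Finite A → Finite B → Finite (A ⊎ B)
  ⊎-finite (m , f) (n , g) = m + n , ↔-trans (f ⊎-↔ g) (↔-sym (Fin.+↔⊎ {m} {n}))

  ⊤-finite : Finite ⊤
  ⊤-finite = 1 , ↔-sym Fin.1↔⊤

  Pos-finite : (p : Prog d n) → Finite (Pos p)
  Pos-finite skip         = ⊤-finite
  Pos-finite (push _ _)   = 2 , ↔-id (Fin 2)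
  Pos-finite (cp _ _)     = 2 , ↔-id (Fin 2)
  Pos-finite (pop _)      = ⊤-finite
  Pos-finite (p ⨾ q)      = ⊎-finite (Pos-finite p) (Pos-finite q)
  Pos-finite (ifte _ p q) = ⊎-finite ⊤-finite (⊎-finite (Pos-finite p) (Pos-finite q))
  Pos-finite (while _ p)  = ⊎-finite ⊤-finite (Pos-finite p)
  Pos-finite (local p)    = Pos-finite p

  Tapes : ℕ → Set
  Tapes = Vec (Tape Letter)

  scan : Tapes n → Scan n
  scan = Vec.map scanned

  perform : Acts n → Tapes n → Tapes n
  perform = Vec.zipWith act

  perform-keep : (ts : Tapes n) → perform (keep (scan ts)) ts ≡ ts
  perform-keep []       = refl
  perform-keep (t ∷ ts) = cong (t ∷_) (perform-keep ts)

  perform-at : (ts : Tapes n) (i : Fin n) (x : Maybe Letter × Move) →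
               perform (keep (scan ts) [ i ]≔ x) ts ≡ ts [ i ]≔ act x (lookup ts i)
  perform-at (t ∷ ts) zero    x = cong (act x t ∷_) (perform-keep ts)
  perform-at (t ∷ ts) (suc i) x = cong (t ∷_) (perform-at ts i x)

  infix 4 _represents_

  record _represents_ (ts : Tapes n) (τ : Store n) : Set where
    constructor represent
    field
      read : ∀ i → stack (lookup ts (opposite i)) ≡ lookup τ i

  open _represents_

  represents-update : ∀ {ts : Tapes n} {τ} → ts represents τ → ∀ i t xs → stack t ≡ xs →
                      ts [ opposite i ]≔ t represents τ [ i ]≔ xs
  represents-update {ts = ts} {τ} r i t xs eq .read k with k Fin.≟ i
  ... | yes refl = trans (cong stack (Vec.lookup∘update (opposite k) ts t))
                         (trans eq (sym (Vec.lookup∘update k τ xs)))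
  ... | no k≢i   = trans (cong stack (Vec.lookup∘update′ (k≢i ∘ opposite-injective) ts t))
                         (trans (read r k) (sym (Vec.lookup∘update′ k≢i τ xs)))

  module _ d {ts : Tapes (tot d n)} {σ : Store n} (r : ts represents pad d σ) where

    private
      tapeAt : Fin n → Tape Letter
      tapeAt i = lookup ts (tapeOf d i)

    stack-tape : ∀ i → stack (tapeAt i) ≡ lookup σ i
    stack-tape i = trans (read r (emb d i)) (lookup-pad d σ i)

    top-lookup : ∀ i → top (lookup (scan ts) (tapeOf d i)) ≡ head (lookup σ i)
    top-lookup i = trans (cong top (Vec.lookup-map (tapeOf d i) scanned ts))
      (trans (top-scanned (tapeAt i)) (cong head (stack-tape i)))

    test-holds : ∀ t → test d t (scan ts) ≡ holds t σ
    test-holds (i , j , f) = cong₂ f (top-lookup i) (top-lookup j)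

    update-represents : ∀ i t {xs} → stack t ≡ xs →
      ts [ tapeOf d i ]≔ t represents pad d (σ [ i ]≔ xs)
    update-represents i t eq = subst (_ represents_) (sym (pad-update d σ i _))
      (represents-update r (emb d i) t _ eq)

    keep-represents : perform (keep (scan ts)) ts represents pad d σ
    keep-represents = subst (_represents _) (sym (perform-keep ts)) r

    pop-represents : ∀ i → let v = scan ts in
      perform (keep v [ tapeOf d i ]≔ (lookup v (tapeOf d i) , popMove (lookup v (tapeOf d i)))) ts
      represents pad d (σ [ i ]≔ drop 1 (lookup σ i))
    pop-represents i
      rewrite perform-at ts (tapeOf d i) (lookup (scan ts) (tapeOf d i) , popMove (lookup (scan ts) (tapeOf d i)))
            | Vec.lookup-map (tapeOf d i) scanned ts
      = update-represents i _ (trans (stack-pop (tapeAt i)) (cong (drop 1) (stack-tape i)))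

    afterLeft : Fin n → Tapes (tot d n)
    afterLeft i = perform (keep (scan ts) [ tapeOf d i ]≔ (lookup (scan ts) (tapeOf d i) , left)) ts

    afterLeft≡ : ∀ i → afterLeft i ≡ ts [ tapeOf d i ]≔ act (scanned (tapeAt i) , left) (tapeAt i)
    afterLeft≡ i = trans (perform-at ts (tapeOf d i) _)
      (cong (λ c → ts [ tapeOf d i ]≔ act (c , left) (tapeAt i)) (Vec.lookup-map (tapeOf d i) scanned ts))

    -- The written letter is given up to an equation so as to serve both `push`, where it is a
    -- literal, and `cp`, where it is whatever the source tape shows after the target head has
    -- moved.
    push-represents : ∀ i a {c} → c ≡ just (inj₁ a) →
      perform (keep (scan (afterLeft i)) [ tapeOf d i ]≔ (c , stay)) (afterLeft i)
      represents pad d (σ [ i ]≔ (a ∷ lookup σ i))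
    push-represents i a refl
      rewrite perform-at (afterLeft i) (tapeOf d i) (just (inj₁ a) , stay)
            | afterLeft≡ i
            | Vec.lookup∘update (tapeOf d i) ts (act (scanned (tapeAt i) , left) (tapeAt i))
            | Vec.[]≔-idempotent {x = act (scanned (tapeAt i) , left) (tapeAt i)}
                {write (just (inj₁ a)) (act (scanned (tapeAt i) , left) (tapeAt i))} ts (tapeOf d i)
      = update-represents i _ (trans (stack-push (tapeAt i) a) (cong (a ∷_) (stack-tape i)))

    scanned-other : ∀ {i j a xs} → i ≢ j → lookup σ i ≡ a ∷ xs →
      lookup (scan (afterLeft j)) (tapeOf d i) ≡ just (inj₁ a)
    scanned-other {i} {j} i≢j eq
      rewrite afterLeft≡ j
            | Vec.lookup-map (tapeOf d i) scanned (ts [ tapeOf d j ]≔ act (scanned (tapeAt j) , left) (tapeAt j))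
            | Vec.lookup∘update′ (i≢j ∘ emb-injective d ∘ opposite-injective) ts
                (act (scanned (tapeAt j) , left) (tapeAt j))
      = scanned≡ (tapeAt i) (trans (stack-tape i) eq)
      where
      scanned≡ : ∀ {a xs} t → stack t ≡ a ∷ xs → scanned t ≡ just (inj₁ a)
      scanned≡ (tape _ (just (inj₁ _)) _) refl = refl

  module _ {State : Set} where

    Verdict : Set
    Verdict = Bool ⊎ State

    Delta : ℕ → Set
    Delta w = State → Scan w → Verdict × Acts w

    stepOf : ∀ {w} → Delta w → Verdict × Tapes w → Verdict × Tapes w
    stepOf δ (inj₁ b , ts) = inj₁ b , ts
    stepOf δ (inj₂ s , ts) = proj₁ (δ s (scan ts)) , perform (proj₂ (δ s (scan ts))) ts

    steps : ∀ {w} → Delta w → ℕ → Verdict × Tapes w → Verdict × Tapes w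
    steps δ zero    c = c
    steps δ (suc k) c = steps δ k (stepOf δ c)

    steps-+ : ∀ {w} (δ : Delta w) k l c → steps δ (k + l) c ≡ steps δ l (steps δ k c)
    steps-+ δ zero    l c = refl
    steps-+ δ (suc k) l c = steps-+ δ k l (stepOf δ c)

    steps-halted : ∀ {w} (δ : Delta w) k b ts → steps δ k (inj₁ b , ts) ≡ (inj₁ b , ts)
    steps-halted δ zero    b ts = refl
    steps-halted δ (suc k) b ts = steps-halted δ k b ts

    record Reaches {w} (δ : Delta w) (k : ℕ) (c : Verdict × Tapes w) (x : Verdict) (τ : Store w) : Set where
      constructor reach
      field
        tapes       : Tapes w
        reached     : steps δ k c ≡ (x , tapes)
        represented : tapes represents τ

    one : ∀ {w} {δ : Delta w} {s ts y as x k τ} → δ s (scan ts) ≡ (y , as) →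
          Reaches δ k (y , perform as ts) x τ → Reaches δ (suc k) (inj₂ s , ts) x τ
    one {δ = δ} {ts = ts} {k = k} eq (reach ts′ run r) =
      reach ts′ (trans (cong (λ u → steps δ k (proj₁ u , perform (proj₂ u) ts)) eq) run) r

    sequel : ∀ {w} {δ : Delta w} {c x y τ τ′ k l} → Reaches δ k c x τ →
             (∀ ts → ts represents τ → Reaches δ l (x , ts) y τ′) → Reaches δ (k + l) c y τ′
    sequel {δ = δ} {c} {k = k} {l} (reach ts run r) f with f ts r
    ... | reach ts′ run′ r′ = reach ts′ (trans (steps-+ δ k l c) (trans (cong (steps δ l) run) run′)) r′

    -- What a subprogram must know of the machine around it: on the states that `e` assigns to its
    -- positions the machine follows `next`, and leaving the subprogram leads to `x`. This makes the
    -- simulation compositional although there is one transition function for all.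
    Embeds : Delta (tot d n) → (p : Prog d n) → (Pos p → State) → Verdict → Set
    Embeds δ p e x = ∀ s v → δ (e s) v ≡ map₁ (maybe′ (inj₂ ∘ e) x) (next p s v)

    -- Induction is on the run, not on the program, since every further round of a loop is a run of
    -- the same program.
    simulate : (δ : Delta (tot d n)) {p : Prog d n} {σ σ′ : Store n} {k : ℕ} → Run p σ σ′ k →
               ∀ {e x} → Embeds δ p e x → ∀ ts → ts represents pad d σ →
               Reaches δ k (inj₂ (e (entry p)) , ts) x (pad d σ′)
    simulate {d = d} δ {σ = σ} skip E ts r = one (E tt (scan ts)) (reach _ refl (keep-represents d {σ = σ} r))
    simulate {d = d} δ {σ = σ} (push {i = i} {a = a}) E ts r =
      one (E 0F (scan ts)) (one (E 1F _) (reach _ refl (push-represents d {σ = σ} r i a refl)))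
    simulate {d = d} δ {σ = σ} (cp {j = j} {a = a} i≢j eq) E ts r =
      one (E 0F (scan ts)) (one (E 1F _) (reach _ refl (push-represents d {σ = σ} r j a (scanned-other d {σ = σ} r i≢j eq))))
    simulate {d = d} δ {σ = σ} (pop {i = i}) E ts r = one (E tt (scan ts)) (reach _ refl (pop-represents d {σ = σ} r i))
    simulate {d = d} δ {p = p ⨾ q} (R ⨾ R′) {e} {x} E ts r =
      sequel (simulate {d = d} δ R E₁ ts r) (simulate {d = d} δ R′ E₂)
      where
      E₁ : Embeds δ p (e ∘ inj₁) (inj₂ (e (inj₂ (entry q))))
      E₁ s v with next p s v | E (inj₁ s) v
      ... | nothing , _ | eq = eq
      ... | just _  , _ | eq = eq
      E₂ : Embeds δ q (e ∘ inj₂) x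
      E₂ s v with next q s v | E (inj₂ s) v
      ... | nothing , _ | eq = eq
      ... | just _  , _ | eq = eq
    simulate {d = d} δ {p = ifte t p q} {σ = σ} (then′ h R) {e} {x} E ts r =
      one (subst (λ b → δ _ _ ≡ (inj₂ (e (inj₂ (if b then inj₁ (entry p) else inj₂ (entry q)))) , _))
                 (trans (test-holds d r t) h) (E (inj₁ tt) (scan ts)))
          (simulate {d = d} δ R E′ _ (keep-represents d {σ = σ} r))
      where
      E′ : Embeds δ p (e ∘ inj₂ ∘ inj₁) x
      E′ s v with next p s v | E (inj₂ (inj₁ s)) v
      ... | nothing , _ | eq = eq
      ... | just _  , _ | eq = eq
    simulate {d = d} δ {p = ifte t p q} {σ = σ} (else′ h R) {e} {x} E ts r =
      one (subst (λ b → δ _ _ ≡ (inj₂ (e (inj₂ (if b then inj₁ (entry p) else inj₂ (entry q)))) , _))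
                 (trans (test-holds d r t) h) (E (inj₁ tt) (scan ts)))
          (simulate {d = d} δ R E′ _ (keep-represents d {σ = σ} r))
      where
      E′ : Embeds δ q (e ∘ inj₂ ∘ inj₂) x
      E′ s v with next q s v | E (inj₂ (inj₂ s)) v
      ... | nothing , _ | eq = eq
      ... | just _  , _ | eq = eq
    simulate {d = d} δ {p = while t p} {σ = σ} (done h) {e} {x} E ts r =
      one (subst (λ b → δ _ _ ≡ (maybe′ (inj₂ ∘ e) x (if b then just (inj₂ (entry p)) else nothing) , _))
                 (trans (test-holds d r t) h) (E (inj₁ tt) (scan ts)))
          (reach _ refl (keep-represents d {σ = σ} r))
    simulate {d = d} δ {p = while t p} {σ = σ} (again h R R′) {e} {x} E ts r =
      one (subst (λ b → δ _ _ ≡ (maybe′ (inj₂ ∘ e) x (if b then just (inj₂ (entry p)) else nothing) , _))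
                 (trans (test-holds d r t) h) (E (inj₁ tt) (scan ts)))
          (sequel (simulate {d = d} δ R E′ _ (keep-represents d {σ = σ} r)) (simulate {d = d} δ R′ E))
      where
      -- Leaving the body leads back to the test, which is the entry of the loop itself.
      E′ : Embeds δ p (e ∘ inj₂) (inj₂ (e (inj₁ tt)))
      E′ s v with next p s v | E (inj₂ s) v
      ... | nothing , _ | eq = eq
      ... | just _  , _ | eq = eq
    simulate {d = suc d} δ (local R) E ts r = simulate {d = d} δ R E ts r

-- Machines that accept or reject

module Machine (Γ : Set) where
  open Stack Γ

  record Core (w : ℕ) : Set₁ where
    field
      State   : Set
      finite  : Finite State
      start   : State
      δ       : State → Scan w → (Bool ⊎ State) × Acts w

  machine : ∀ {w} → Core (suc w) → TuringMachine Γ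
  machine {w} C = record
    { State       = Core.State C
    ; stateFinite = Core.finite C
    ; Work        = Fin 0
    ; workFinite  = 0 , ↔-id (Fin 0)
    ; workTapes   = w
    ; start       = Core.start C
    ; δ           = Core.δ C
    }

  inputTapes : ∀ w → List Γ → Tapes (suc w)
  inputTapes w x = wordTape (List.map inj₁ x) ∷ Vec.replicate w blankTape

  stack-word : ∀ x → stack (wordTape (List.map inj₁ x)) ≡ x
  stack-word []      = refl
  stack-word (a ∷ x) = cong (a ∷_) (content-word x)
    where
    content-word : ∀ x → content (List.map just (List.map inj₁ x)) ≡ x
    content-word []      = refl
    content-word (b ∷ x) = cong (b ∷_) (content-word x)

  stack-blank : ∀ w (i : Fin w) → stack (lookup (Vec.replicate w blankTape) i) ≡ []
  stack-blank w i = cong stack (Vec.lookup-replicate i blankTape)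

  input-represents : ∀ w x → inputTapes w x represents Vec.replicate w [] Vec.∷ʳ x
  input-represents w x = represent (go w)
    where
    go : ∀ w i → stack (lookup (inputTapes w x) (opposite i)) ≡ lookup (Vec.replicate w [] Vec.∷ʳ x) i
    go zero    zero    = stack-word x
    go (suc w) zero    = stack-blank (suc w) (fromℕ w)
    go (suc w) (suc i) = trans (lemma w (opposite i)) (go w i)
      where
      lemma : ∀ w j → stack (lookup (inputTapes (suc w) x) (inject₁ j)) ≡
                      stack (lookup (inputTapes w x) j)
      lemma w zero    = refl
      lemma w (suc j) = trans (stack-blank (suc w) (inject₁ j)) (sym (stack-blank w j))

  module _ {w} (C : Core (suc w)) where
    open Core C

    step≡ : ∀ c → step (machine C) c ≡ stepOf δ c
    step≡ (inj₁ b , ts) = refl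
    step≡ (inj₂ s , ts) with δ s (scan ts)
    ... | _ , _ = refl

    run≡ : ∀ k c → run (machine C) k c ≡ steps δ k c
    run≡ zero    c = refl
    run≡ (suc k) c = trans (cong (run (machine C) k) (step≡ c)) (run≡ k (stepOf δ c))

    halts-within : ∀ {k m x b ts} → k ≤ m → steps δ k (inj₂ start , inputTapes w x) ≡ (inj₁ b , ts) →
                   HaltsWithin (machine C) m x b
    halts-within {k} {m} {x} {b} {ts} k≤m eq = cong proj₁ (begin
      run (machine C) m c          ≡⟨ run≡ m c ⟩
      steps δ m c                  ≡⟨ cong (λ l → steps δ l c) (m+[n∸m]≡n k≤m) ⟨
      steps δ (k + (m ∸ k)) c      ≡⟨ steps-+ δ k (m ∸ k) c ⟩
      steps δ (m ∸ k) (steps δ k c) ≡⟨ cong (steps δ (m ∸ k)) eq ⟩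
      steps δ (m ∸ k) (inj₁ b , ts) ≡⟨ steps-halted δ (m ∸ k) b ts ⟩
      (inj₁ b , ts)                ∎)
      where
      open ≡-Reasoning
      c = inj₂ start , inputTapes w x

  -- The verdict is whether the register, at first the input, is nonempty in
  -- the end.

  coreδ : (p : Prog d 1) → Pos p ⊎ ⊤ → Scan (tot d 1) → (Bool ⊎ (Pos p ⊎ ⊤)) × Acts (tot d 1)
  coreδ p (inj₁ s) v = map₁ (maybe′ (inj₂ ∘ inj₁) (inj₂ (inj₂ tt))) (next p s v)
  coreδ {d} p (inj₂ _) v = inj₁ (is-just (top (lookup v (tapeOf d 0F)))) , keep v

  core : Prog d 1 → Core (tot d 1)
  core {d} p = record
    { State  = Pos p ⊎ ⊤
    ; finite = ⊎-finite (Pos-finite p) ⊤-finite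
    ; start  = inj₁ (entry p)
    ; δ      = coreδ p
    }

  core-decides : (p : Prog d 1) → ∀ {x ys k} → Run p (x ∷ []) (ys ∷ []) k →
                 ∀ ts → ts represents pad d (x ∷ []) →
                 ∃[ ts′ ] steps (coreδ p) (k + 1) (inj₂ (inj₁ (entry p)) , ts) ≡
                          (inj₁ (is-just (head ys)) , ts′)
  core-decides {d} p {k = k} R ts r with simulate {d = d} (coreδ p) R {inj₁} (λ s v → refl) ts r
  ... | reach ts′ eq r′ = perform (keep (scan ts′)) ts′ , trans (steps-+ (coreδ p) k 1 _)
        (trans (cong (steps (coreδ p) 1) eq)
               (cong (λ c → inj₁ (is-just c) , perform (keep (scan ts′)) ts′) (top-lookup d r′ 0F)))

-- Elementary routines with time bounds

module Routines (Γ : Set) where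
  open Stack Γ

  record Runs (p : Prog d n) (σ σ′ : Store n) (b : ℕ) : Set where
    constructor runs
    field
      {time} : ℕ
      bound  : time ≤ b
      trace  : Run p σ σ′ time

  open Runs public

  private variable
    t : Test n
    p q : Prog d n
    σ σ′ σ″ : Store n
    i j : Fin n
    a : Γ
    b c m L : ℕ
    xs ys : List Γ

  exactly : Run p σ σ′ b → Runs p σ σ′ b
  exactly = runs ≤-refl

  weaken : b ≤ c → Runs p σ σ′ b → Runs p σ σ′ c
  weaken b≤c (runs k≤b R) = runs (≤-trans k≤b b≤c) R

  runs-≡ : σ′ ≡ σ″ → Runs p σ σ′ b → Runs p σ σ″ b
  runs-≡ refl R = R

  ≡-runs : σ ≡ σ″ → Runs p σ″ σ′ b → Runs p σ σ′ b
  ≡-runs refl R = R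

  infixr 4 _»_

  _»_ : Runs p σ σ′ b → Runs q σ′ σ″ c → Runs (p ⨾ q) σ σ″ (b + c)
  runs k≤b R » runs l≤c R′ = runs (+-mono-≤ k≤b l≤c) (R ⨾ R′)

  if-true : holds t σ ≡ true → Runs p σ σ′ b → Runs (ifte t p q) σ σ′ (suc b)
  if-true h (runs k≤b R) = runs (s≤s k≤b) (then′ h R)

  if-false : holds t σ ≡ false → Runs q σ σ′ b → Runs (ifte t p q) σ σ′ (suc b)
  if-false h (runs k≤b R) = runs (s≤s k≤b) (else′ h R)

  loop-done : holds t σ ≡ false → Runs {d} (while t p) σ σ 1
  loop-done h = runs ≤-refl (done h)

  -- All loop bounds have the form `m * suc b + 1`: each of the m rounds pays for its test and its
  -- body, and the last 1 is the failing test.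
  loop-again : holds t σ ≡ true → Runs p σ σ′ b → Runs (while t p) σ′ σ″ (m * suc b + 1) →
               Runs (while t p) σ σ″ (suc m * suc b + 1)
  loop-again {b = b} {m = m} h (runs k≤b R) (runs l≤ R′) =
    runs (≤-trans (s≤s (+-mono-≤ k≤b l≤)) (≤-reflexive (sym (+-assoc (suc b) (m * suc b) 1)))) (again h R R′)

  loop-weaken : m ≤ L → Runs p σ σ′ (m * suc b + 1) → Runs p σ σ′ (L * suc b + 1)
  loop-weaken {b = b} m≤L = weaken (+-monoˡ-≤ 1 (*-monoˡ-≤ (suc b) m≤L))

  in-local : Runs p ([] ∷ σ) ([] ∷ σ′) b → Runs (local p) σ σ′ b
  in-local (runs k≤b R) = runs k≤b (local R)

  modify₁ : (σ : Store n) (f : List Γ → List Γ) →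
            σ [ j ]≔ ys [ j ]≔ f (lookup (σ [ j ]≔ ys) j) ≡ σ [ j ]≔ f ys
  modify₁ {j = j} {ys = ys} σ f = trans (Vec.[]≔-idempotent σ j)
    (cong (λ zs → σ [ j ]≔ f zs) (Vec.lookup∘update j σ ys))

  -- Loops over two registers are described on stores in the normal form `σ [ i ]≔ xs [ j ]≔ ys`; a
  -- change of register i has to be commuted past the update at j to restore this form.
  modify₂ : i ≢ j → (σ : Store n) (f : List Γ → List Γ) →
            σ [ i ]≔ xs [ j ]≔ ys [ i ]≔ f (lookup (σ [ i ]≔ xs [ j ]≔ ys) i) ≡ σ [ i ]≔ f xs [ j ]≔ ys
  modify₂ {i = i} {j = j} {xs = xs} {ys} i≢j σ f = begin
    τ [ i ]≔ f (lookup τ i)                ≡⟨ cong (λ zs → τ [ i ]≔ f zs) (trans (Vec.lookup∘update′ i≢j (σ [ i ]≔ xs) ys) (Vec.lookup∘update i σ xs)) ⟩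
    σ [ i ]≔ xs [ j ]≔ ys [ i ]≔ f xs      ≡⟨ cong (_[ i ]≔ f xs) (Vec.[]≔-commutes σ i j i≢j) ⟩
    σ [ j ]≔ ys [ i ]≔ xs [ i ]≔ f xs      ≡⟨ Vec.[]≔-idempotent (σ [ j ]≔ ys) i ⟩
    σ [ j ]≔ ys [ i ]≔ f xs                ≡⟨ Vec.[]≔-commutes σ j i (i≢j ∘ sym) ⟩
    σ [ i ]≔ f xs [ j ]≔ ys                ∎
    where
    open ≡-Reasoning
    τ = σ [ i ]≔ xs [ j ]≔ ys

  lookup₂ : i ≢ j → (σ : Store n) → lookup (σ [ i ]≔ xs [ j ]≔ ys) i ≡ xs
  lookup₂ {i = i} {j} {xs} {ys} i≢j σ =
    trans (Vec.lookup∘update′ i≢j (σ [ i ]≔ xs) ys) (Vec.lookup∘update i σ xs)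

  reset₂ : (σ : Store n) → σ [ i ]≔ lookup σ i [ j ]≔ lookup σ j ≡ σ
  reset₂ {i = i} {j} σ = trans (cong (_[ j ]≔ lookup σ j) (Vec.[]≔-lookup σ i)) (Vec.[]≔-lookup σ j)

  nonempty : Fin n → Test n
  nonempty i = i , i , λ a _ → is-just a

  nonempty-holds : (σ : Store n) → lookup σ i ≡ a ∷ xs → holds (nonempty i) σ ≡ true
  nonempty-holds σ eq = cong (is-just ∘ head) eq

  nonempty-fails : (σ : Store n) → lookup σ i ≡ [] → holds (nonempty i) σ ≡ false
  nonempty-fails σ eq = cong (is-just ∘ head) eq

  mv : Fin n → Fin n → Prog d n
  mv i j = cp i j ⨾ pop i

  mv-runs : i ≢ j → ∀ σ → Runs {d} {n} (mv i j) (σ [ i ]≔ (a ∷ xs) [ j ]≔ ys) (σ [ i ]≔ xs [ j ]≔ (a ∷ ys)) 3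
  mv-runs {i = i} {a = a} {xs} i≢j σ =
    runs-≡ (modify₁ (σ [ i ]≔ (a ∷ xs)) (a ∷_)) (exactly (cp i≢j (lookup₂ i≢j σ))) »
    runs-≡ (modify₂ i≢j σ (drop 1)) (exactly pop)

  transfer : Fin n → Fin n → Prog d n
  transfer i j = while (nonempty i) (mv i j)

  transfer-runs′ : i ≢ j → (σ : Store n) → ∀ xs ys →
    Runs {d} (transfer i j) (σ [ i ]≔ xs [ j ]≔ ys) (σ [ i ]≔ [] [ j ]≔ (xs ʳ++ ys)) (length xs * 4 + 1)
  transfer-runs′ i≢j σ []       ys = loop-done (nonempty-fails (σ [ _ ]≔ [] [ _ ]≔ ys) (lookup₂ i≢j σ))
  transfer-runs′ i≢j σ (x ∷ xs) ys = loop-again {m = length xs}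
    (nonempty-holds (σ [ _ ]≔ (x ∷ xs) [ _ ]≔ ys) (lookup₂ i≢j σ)) (mv-runs i≢j σ) (transfer-runs′ i≢j σ xs (x ∷ ys))

  transfer-runs : i ≢ j → (σ : Store n) → length (lookup σ i) ≤ L →
    Runs {d} (transfer i j) σ (σ [ i ]≔ [] [ j ]≔ (lookup σ i ʳ++ lookup σ j)) (L * 4 + 1)
  transfer-runs i≢j σ len = ≡-runs (sym (reset₂ σ)) (loop-weaken len (transfer-runs′ i≢j σ _ _))

  distribute : Fin n → Fin n → Prog d (suc n)
  distribute i j = while (nonempty 0F) (cp 0F (suc j) ⨾ cp 0F (suc i) ⨾ pop 0F)

  -- A stack is read only by being taken apart. The source is therefore reversed into a local
  -- register, and the second reversal rebuilds it while it also feeds the target.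
  copy : Fin n → Fin n → Prog (suc d) n
  copy i j = local (transfer (suc i) 0F ⨾ distribute i j)

  copyCost : ℕ → ℕ
  copyCost L = (L * 4 + 1) + (L * 6 + 1)

  copy-runs : i ≢ j → (σ : Store n) → length (lookup σ i) ≤ L →
    Runs {suc d} (copy i j) σ (σ [ j ]≔ (lookup σ i ++ lookup σ j)) (copyCost L)
  copy-runs {i = i} {j = j} {L = L} i≢j σ len = in-local
    (transfer-runs (λ ()) ([] ∷ σ) len »
     ≡-runs (cong (reversed ∷_) (trans (sym (Vec.[]≔-lookup (σ [ i ]≔ []) j))
                                       (cong (λ ys → σ [ i ]≔ [] [ j ]≔ ys) (Vec.lookup∘update′ (i≢j ∘ sym) σ []))))
     (runs-≡ (cong ([] ∷_) final)
     (loop-weaken (≤-trans (≤-reflexive (trans (List.length-ʳ++ (lookup σ i)) (+-identityʳ _))) len)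
        (restore reversed [] (lookup σ j)))))
    where
    reversed = lookup σ i ʳ++ []

    restore : ∀ zs xs ys → Runs {d} (distribute i j) (zs ∷ (σ [ i ]≔ xs [ j ]≔ ys))
      ([] ∷ (σ [ i ]≔ (zs ʳ++ xs) [ j ]≔ (zs ʳ++ ys))) (length zs * 6 + 1)
    restore []       xs ys = loop-done refl
    restore (z ∷ zs) xs ys = loop-again {m = length zs} refl
      (runs-≡ (cong ((z ∷ zs) ∷_) (modify₁ (σ [ i ]≔ xs) (z ∷_))) (exactly (cp (λ ()) refl)) »
       runs-≡ (cong ((z ∷ zs) ∷_) (modify₂ i≢j σ (z ∷_))) (exactly (cp (λ ()) refl)) »
       exactly pop)
      (restore zs (z ∷ xs) (z ∷ ys))

    final : σ [ i ]≔ (reversed ʳ++ []) [ j ]≔ (reversed ʳ++ lookup σ j) ≡ σ [ j ]≔ (lookup σ i ++ lookup σ j)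
    final = cong₂ (λ xs ys → xs [ j ]≔ ys)
      (trans (cong (σ [ i ]≔_) (trans (List.ʳ++-ʳ++ (lookup σ i)) (List.++-identityʳ _))) (Vec.[]≔-lookup σ i))
      (List.ʳ++-ʳ++ (lookup σ i))

  clear : Fin n → Prog d n
  clear i = while (nonempty i) (pop i)

  clear-runs : (σ : Store n) → length (lookup σ i) ≤ L →
    Runs {d} (clear i) σ (σ [ i ]≔ []) (L * 2 + 1)
  clear-runs {i = i} σ len = ≡-runs (sym (Vec.[]≔-lookup σ i)) (loop-weaken len (go (lookup σ i)))
    where
    go : ∀ xs → Runs {d} (clear i) (σ [ i ]≔ xs) (σ [ i ]≔ []) (length xs * 2 + 1)
    go []       = loop-done (nonempty-fails (σ [ i ]≔ []) (Vec.lookup∘update i σ []))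
    go (x ∷ xs) = loop-again {m = length xs} (nonempty-holds (σ [ i ]≔ (x ∷ xs)) (Vec.lookup∘update i σ (x ∷ xs)))
      (runs-≡ (modify₁ σ (drop 1)) (exactly pop)) (go xs)

  module _ (_≟_ : DecidableEquality Γ) where

    differs : Γ → Maybe Γ → Bool
    differs a = maybe′ (λ b → not (does (b ≟ a))) false

    readUntil : Γ → Fin n → Prog d (suc n)
    readUntil a i = while (suc i , suc i , λ b _ → differs a b) (mv (suc i) 0F)

    load : Γ → Fin n → Fin n → Prog (suc d) n
    load a i j = local (readUntil a i ⨾ pop (suc i) ⨾ transfer 0F (suc j))

    loadCost : ℕ → ℕ
    loadCost L = (L * 4 + 1) + (1 + (L * 4 + 1))

    load-runs : i ≢ j → (σ : Store n) → ∀ xs ys → All (_≢ a) xs → lookup σ i ≡ xs ++ a ∷ ys → length xs ≤ L →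
      Runs {suc d} (load a i j) σ (σ [ i ]≔ ys [ j ]≔ (xs ++ lookup σ j)) (loadCost L)
    load-runs {i = i} {j} {a} i≢j σ xs ys xs≢a eq len = in-local
      (≡-runs (cong ([] ∷_) (trans (sym (Vec.[]≔-lookup σ i)) (cong (σ [ i ]≔_) eq)))
        (loop-weaken len (go xs [] xs≢a)) »
       runs-≡ (cong ((xs ʳ++ []) ∷_) (modify₁ σ (drop 1))) (exactly pop) »
       runs-≡ (cong (λ zs → [] ∷ (σ [ i ]≔ ys [ j ]≔ zs))
                (trans (List.ʳ++-ʳ++ xs) (cong (xs ++_) (Vec.lookup∘update′ (i≢j ∘ sym) σ ys))))
         (transfer-runs (λ ()) ((xs ʳ++ []) ∷ (σ [ i ]≔ ys))
           (≤-trans (≤-reflexive (trans (List.length-ʳ++ xs) (+-identityʳ _))) len)))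
      where
      go : ∀ xs zs → All (_≢ a) xs → Runs {d} (readUntil a i) (zs ∷ (σ [ i ]≔ (xs ++ a ∷ ys)))
        ((xs ʳ++ zs) ∷ (σ [ i ]≔ (a ∷ ys))) (length xs * 4 + 1)
      go [] zs [] = loop-done (trans (cong (differs a ∘ head) (Vec.lookup∘update i σ (a ∷ ys))) at-end)
        where
        at-end : differs a (just a) ≡ false
        at-end with a ≟ a
        ... | yes _ = refl
        ... | no a≢a = contradiction refl a≢a
      go (x ∷ xs) zs (x≢a ∷ xs≢a) = loop-again {m = length xs}
        (trans (cong (differs a ∘ head) (Vec.lookup∘update i σ (x ∷ xs ++ a ∷ ys))) before-end)
        (exactly (cp (λ ()) (Vec.lookup∘update i σ (x ∷ xs ++ a ∷ ys))) »
         runs-≡ (cong ((x ∷ zs) ∷_) (modify₁ σ (drop 1))) (exactly pop))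
        (go xs (x ∷ zs) xs≢a)
        where
        before-end : differs a (just x) ≡ true
        before-end with x ≟ a
        ... | yes eq = contradiction eq x≢a
        ... | no _ = refl

-- Comparing p * D with q * N by small counters

-- For numbers p and q given in binary, least significant bit first, p * D and
-- q * N are compared with counters of size at most D + N: starting from c = D,
-- `shifted` adds q_i N - p_i D to the number c - D and then halves it, rounding
-- down, so that in the end D ≤ c iff p * D ≤ q * N.

module Digits {Γ : Set} (isOne : Γ → Bool) where

  bitOf : Maybe Γ → Bool
  bitOf = maybe′ isOne false

  value : List Γ → ℕ
  value []       = 0
  value (a ∷ as) = (if isOne a then 1 else 0) + 2 * value as

  module Carry (N D : ℕ) where

    -- If c′ - D is half of (c - D) + b N - a D, then 2 c′ = c + b N + (1 - a) D: thanks to the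
    -- offset D, the subtraction for a digit 1 of p turns into an addition for a digit 0, and the
    -- counter stays natural.
    raise : Bool → Bool → ℕ → ℕ
    raise a b c = (if b then N else 0) + ((if a then 0 else D) + c)

    shifted : Maybe Γ → Maybe Γ → ℕ → ℕ
    shifted a b c = ⌊ raise (bitOf a) (bitOf b) c /2⌋

    carry : ℕ → List Γ → List Γ → ℕ
    carry c []       []       = c
    carry c []       (b ∷ qs) = carry (shifted nothing (just b) c) [] qs
    carry c (a ∷ ps) []       = carry (shifted (just a) nothing c) ps []
    carry c (a ∷ ps) (b ∷ qs) = carry (shifted (just a) (just b) c) ps qs

    raise-≤ : ∀ a b {c} → c ≤ D + N → raise a b c ≤ (D + N) + (D + N)
    raise-≤ a b {c} c≤ = begin
      raise a b c         ≤⟨ +-mono-≤ (at-most b N) (+-mono-≤ (at-least a) c≤) ⟩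
      N + (D + (D + N))   ≡⟨ regroup N D ⟩
      (D + N) + (D + N)   ∎
      where
      open ≤-Reasoning
      at-most : ∀ b n → (if b then n else 0) ≤ n
      at-most true  n = ≤-refl
      at-most false n = z≤n
      at-least : ∀ a → (if a then 0 else D) ≤ D
      at-least true  = z≤n
      at-least false = ≤-refl
      regroup : ∀ N D → N + (D + (D + N)) ≡ (D + N) + (D + N)
      regroup = solve-∀

    -- A digit adds at most N + D to a counter that is at most D + N, and halving restores the
    -- bound. So the counters stay linear however large p and q are.
    shifted-≤ : ∀ a b {c} → c ≤ D + N → shifted a b c ≤ D + N
    shifted-≤ a b c≤ = ≤-trans (⌊n/2⌋-mono (raise-≤ (bitOf a) (bitOf b) c≤)) (≤-reflexive (sym (n≡⌊n+n/2⌋ (D + N))))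

    carry-≤ : ∀ ps qs {c} → c ≤ D + N → carry c ps qs ≤ D + N
    carry-≤ []       []       c≤ = c≤
    carry-≤ []       (b ∷ qs) c≤ = carry-≤ [] qs (shifted-≤ nothing (just b) c≤)
    carry-≤ (a ∷ ps) []       c≤ = carry-≤ ps [] (shifted-≤ (just a) nothing c≤)
    carry-≤ (a ∷ ps) (b ∷ qs) c≤ = carry-≤ ps qs (shifted-≤ (just a) (just b) c≤)

    private
      bit : Bool → ℕ
      bit b = if b then 1 else 0

      halve-+ : ∀ y z → ⌊ y + (z + z) /2⌋ ≡ ⌊ y /2⌋ + z
      halve-+ y zero    = trans (cong ⌊_/2⌋ (+-identityʳ y)) (sym (+-identityʳ ⌊ y /2⌋))
      halve-+ y (suc z) = begin
        ⌊ y + (suc z + suc z) /2⌋     ≡⟨ cong ⌊_/2⌋ (regroup y z) ⟩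
        suc ⌊ y + (z + z) /2⌋         ≡⟨ cong suc (halve-+ y z) ⟩
        suc (⌊ y /2⌋ + z)             ≡⟨ +-suc ⌊ y /2⌋ z ⟨
        ⌊ y /2⌋ + suc z               ∎
        where
        open ≡-Reasoning
        regroup : ∀ y z → y + (suc z + suc z) ≡ suc (suc (y + (z + z)))
        regroup = solve-∀

      -- Rounding down loses nothing: `x + x` and `z + z` are even, so an odd `y` may be replaced by
      -- its predecessor. Together with `≤-double` this is an equivalence.
      ≤-halve : ∀ {x y z} → x + x ≤ y + (z + z) → x ≤ ⌊ y /2⌋ + z
      ≤-halve {x} {y} {z} h = begin
        x                        ≡⟨ n≡⌊n+n/2⌋ x ⟩
        ⌊ x + x /2⌋              ≤⟨ ⌊n/2⌋-mono h ⟩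
        ⌊ y + (z + z) /2⌋        ≡⟨ halve-+ y z ⟩
        ⌊ y /2⌋ + z              ∎
        where open ≤-Reasoning

      ≤-double : ∀ {x y z} → x ≤ ⌊ y /2⌋ + z → x + x ≤ y + (z + z)
      ≤-double {x} {y} {z} h = begin
        x + x                                ≤⟨ +-mono-≤ h h ⟩
        (⌊ y /2⌋ + z) + (⌊ y /2⌋ + z)        ≡⟨ regroup ⌊ y /2⌋ z ⟩
        (⌊ y /2⌋ + ⌊ y /2⌋) + (z + z)        ≤⟨ +-monoˡ-≤ (z + z) (+-monoʳ-≤ ⌊ y /2⌋ (⌊n/2⌋≤⌈n/2⌉ y)) ⟩
        (⌊ y /2⌋ + ⌈ y /2⌉) + (z + z)  ≡⟨ cong (_+ (z + z)) (⌊n/2⌋+⌈n/2⌉≡n y) ⟩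
        y + (z + z)                          ∎
        where
        open ≤-Reasoning
        regroup : ∀ h z → (h + z) + (h + z) ≡ (h + h) + (z + z)
        regroup = solve-∀

      raise-split : ∀ a b c → raise a b c + bit a * D ≡ bit b * N + (D + c)
      raise-split true  true  c = lemma N D c where
        lemma : ∀ N D c → N + (0 + c) + 1 * D ≡ 1 * N + (D + c)
        lemma = solve-∀
      raise-split true  false c = lemma N D c where
        lemma : ∀ N D c → c + 1 * D ≡ 0 * N + (D + c)
        lemma = solve-∀
      raise-split false true  c = lemma N D c where
        lemma : ∀ N D c → N + (D + c) + 0 * D ≡ 1 * N + (D + c)
        lemma = solve-∀
      raise-split false false c = lemma N D c where
        lemma : ∀ N D c → D + c + 0 * D ≡ 0 * N + (D + c)
        lemma = solve-∀

      -- Both sides are those of x + x ≤ y + (z + z) with bit a * D + D added.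
      digit : ∀ a b c p q → p * D + D ≤ ⌊ raise a b c /2⌋ + q * N ⇔
                            (bit a + 2 * p) * D + D ≤ c + (bit b + 2 * q) * N
      digit a b c p q = mk⇔ to from
        where
        open ≤-Reasoning
        double-lhs : ∀ a p D → (a + 2 * p) * D + D + D ≡ (p * D + D) + (p * D + D) + a * D
        double-lhs = solve-∀
        double-rhs : ∀ r b q N D c a → r + a * D ≡ b * N + (D + c) → r + (q * N + q * N) + a * D ≡ c + (b + 2 * q) * N + D
        double-rhs r b q N D c a eq = trans (regroup₁ r (q * N) (a * D)) (trans (cong (_+ (q * N + q * N)) eq) (regroup₂ b q N D c))
          where
          regroup₁ : ∀ r z y → r + (z + z) + y ≡ r + y + (z + z)
          regroup₁ = solve-∀
          regroup₂ : ∀ b q N D c → b * N + (D + c) + (q * N + q * N) ≡ c + (b + 2 * q) * N + D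
          regroup₂ = solve-∀
        to : _
        to h = +-cancelʳ-≤ D _ _ (begin
          (bit a + 2 * p) * D + D + D                  ≡⟨ double-lhs (bit a) p D ⟩
          (p * D + D) + (p * D + D) + bit a * D        ≤⟨ +-monoˡ-≤ (bit a * D) (≤-double {z = q * N} h) ⟩
          raise a b c + (q * N + q * N) + bit a * D    ≡⟨ double-rhs (raise a b c) (bit b) q N D c (bit a) (raise-split a b c) ⟩
          c + (bit b + 2 * q) * N + D                  ∎)
        from : _
        from h = ≤-halve {z = q * N} (+-cancelʳ-≤ (bit a * D) _ _ (begin
          (p * D + D) + (p * D + D) + bit a * D        ≡⟨ double-lhs (bit a) p D ⟨
          (bit a + 2 * p) * D + D + D                  ≤⟨ +-monoˡ-≤ D h ⟩
          c + (bit b + 2 * q) * N + D                  ≡⟨ double-rhs (raise a b c) (bit b) q N D c (bit a) (raise-split a b c) ⟨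
          raise a b c + (q * N + q * N) + bit a * D    ∎))

    -- The inequality on the right is the loop invariant: `c` minus D sums up the digits already
    -- read, `ps` and `qs` are still to come. A number that has run out of digits goes on with
    -- zeros.
    carry-⇔ : ∀ c ps qs → D ≤ carry c ps qs ⇔ value ps * D + D ≤ c + value qs * N
    carry-⇔ c [] [] = mk⇔ (λ h → ≤-trans h (m≤m+n c 0)) (λ h → ≤-trans h (≤-reflexive (+-identityʳ c)))
    carry-⇔ c [] (b ∷ qs) = digit false (isOne b) c 0 (value qs) ⇔-∘ carry-⇔ _ [] qs
    carry-⇔ c (a ∷ ps) [] = digit (isOne a) false c (value ps) 0 ⇔-∘ carry-⇔ _ ps []
    carry-⇔ c (a ∷ ps) (b ∷ qs) = digit (isOne a) (isOne b) c (value ps) (value qs) ⇔-∘ carry-⇔ _ ps qs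

    carry-correct : ∀ ps qs → (D ≤ᵇ carry D ps qs) ≡ (value ps * D ≤ᵇ value qs * N)
    carry-correct ps qs = does-⇔ (shift ⇔-∘ carry-⇔ D ps qs)
      (D ≤? carry D ps qs) (value ps * D ≤? value qs * N)
      where
      shift : value ps * D + D ≤ D + value qs * N ⇔ value ps * D ≤ value qs * N
      shift = mk⇔
        (λ h → +-cancelˡ-≤ D _ _ (≤-trans (≤-reflexive (+-comm D _)) h))
        (λ h → ≤-trans (≤-reflexive (+-comm _ D)) (+-monoʳ-≤ D h))

-- Programs that compare words and products

module Comparison (Γ : Set) (_≟_ : DecidableEquality Γ) (tick : Γ) where
  open Stack Γ
  open Routines Γ

  private variable
    σ : Store n
    L : ℕ

  flag : Bool → List Γ
  flag b = if b then [ tick ] else []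

  flag-ʳ++ : ∀ b → flag b ʳ++ [] ≡ flag b
  flag-ʳ++ true  = refl
  flag-ʳ++ false = refl

  flag-length : ∀ b → length (flag b) ≤ 1
  flag-length true  = ≤-refl
  flag-length false = z≤n

  copy-fresh : ∀ {i j : Fin n} → i ≢ j → (σ : Store n) → lookup σ j ≡ [] → length (lookup σ i) ≤ L →
    Runs {suc d} (copy i j) σ (σ [ j ]≔ lookup σ i) (copyCost L)
  copy-fresh {i = i} {j} i≢j σ eq len = runs-≡
    (cong (σ [ j ]≔_) (trans (cong (lookup σ i ++_) eq) (List.++-identityʳ _)))
    (copy-runs i≢j σ len)

  agree : Maybe Γ → Maybe Γ → Bool
  agree (just a) (just b) = does (a ≟ b)
  agree _        _        = false

  bothEmpty : Maybe Γ → Maybe Γ → Bool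
  bothEmpty a b = not (is-just a) ∧ not (is-just b)

  shift₃ : Fin n → Fin (suc (suc (suc n)))
  shift₃ i = suc (suc (suc i))

  stripCommon : Prog d (suc (suc n))
  stripCommon = while (0F , 1F , agree) (pop 0F ⨾ pop 1F)

  compareWords : Fin n → Fin n → Prog (suc (suc (suc d))) (suc n)
  compareWords i j = local (local (copy (shift₃ j) 0F ⨾ copy (shift₃ i) 1F ⨾ stripCommon ⨾
    ifte (0F , 1F , bothEmpty) (push 2F tick) skip ⨾ clear 0F ⨾ clear 1F))

  compareWordsCost : ℕ → ℕ
  compareWordsCost L = copyCost L + (copyCost L + ((L * 3 + 1) + (3 + ((L * 2 + 1) + (L * 2 + 1)))))

  strip : List Γ → List Γ → List Γ × List Γ
  strip (x ∷ xs) (y ∷ ys) = if does (x ≟ y) then strip xs ys else (x ∷ xs , y ∷ ys)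
  strip xs       ys       = xs , ys

  strip-length : ∀ xs ys → length (proj₁ (strip xs ys)) ≤ length xs × length (proj₂ (strip xs ys)) ≤ length ys
  strip-length []       ys       = ≤-refl , ≤-refl
  strip-length (x ∷ xs) []       = ≤-refl , ≤-refl
  strip-length (x ∷ xs) (y ∷ ys) with does (x ≟ y)
  ... | false = ≤-refl , ≤-refl
  ... | true  = m≤n⇒m≤1+n (proj₁ (strip-length xs ys)) , m≤n⇒m≤1+n (proj₂ (strip-length xs ys))

  strip-empty : ∀ xs ys → bothEmpty (head (proj₁ (strip xs ys))) (head (proj₂ (strip xs ys))) ≡
                          does (List.≡-dec _≟_ xs ys)
  strip-empty []       []       = refl
  strip-empty []       (y ∷ ys) = refl
  strip-empty (x ∷ xs) []       = refl
  strip-empty (x ∷ xs) (y ∷ ys) with does (x ≟ y)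
  ... | false = refl
  ... | true  = strip-empty xs ys

  strip-runs : ∀ xs ys → Runs {d} stripCommon (ys ∷ xs ∷ σ)
    (proj₂ (strip xs ys) ∷ proj₁ (strip xs ys) ∷ σ) (length xs * 3 + 1)
  strip-runs []       []       = loop-done refl
  strip-runs []       (y ∷ ys) = loop-done refl
  strip-runs (x ∷ xs) []       = runs (s≤s z≤n) (done refl)
  -- The register of `ys` comes first, so the program tests `y ≟ x` where `strip` tests `x ≟ y`; the
  -- two decisions have to be reconciled.
  strip-runs {σ = σ} (x ∷ xs) (y ∷ ys) with y ≟ x in eq | x ≟ y
  ... | yes _  | yes _  = loop-again {m = length xs} (cong does eq) (exactly pop » exactly pop) (strip-runs xs ys)
  ... | no _   | no _   = runs (s≤s z≤n) (done (cong does eq))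
  ... | yes p  | no ¬p  = contradiction (sym p) ¬p
  ... | no ¬p  | yes p  = contradiction (sym p) ¬p

  compareWords-runs : ∀ {i j : Fin n} → length (lookup σ i) ≤ L → length (lookup σ j) ≤ L →
    Runs {suc (suc (suc d))} (compareWords i j) ([] ∷ σ)
      (flag (does (List.≡-dec _≟_ (lookup σ i) (lookup σ j))) ∷ σ) (compareWordsCost L)
  compareWords-runs {σ = σ} {i = i} {j} leni lenj = in-local (in-local
    (copy-fresh (λ ()) ([] ∷ [] ∷ [] ∷ σ) refl lenj »
     copy-fresh (λ ()) (ys ∷ [] ∷ [] ∷ σ) refl leni »
     loop-weaken leni (strip-runs xs ys) »
     result »
     clear-runs (rest₂ ∷ rest₁ ∷ out ∷ σ) (≤-trans (proj₂ (strip-length xs ys)) lenj) »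
     clear-runs ([] ∷ rest₁ ∷ out ∷ σ) (≤-trans (proj₁ (strip-length xs ys)) leni)))
    where
    xs = lookup σ i
    ys = lookup σ j
    rest₁ = proj₁ (strip xs ys)
    rest₂ = proj₂ (strip xs ys)
    out = flag (does (List.≡-dec _≟_ xs ys))
    swap : bothEmpty (head rest₂) (head rest₁) ≡ does (List.≡-dec _≟_ xs ys)
    swap = trans (Bool.∧-comm (not (is-just (head rest₂))) _) (strip-empty xs ys)
    result : Runs (ifte (0F , 1F , bothEmpty) (push 2F tick) skip)
      (rest₂ ∷ rest₁ ∷ [] ∷ σ) (rest₂ ∷ rest₁ ∷ out ∷ σ) 3
    result with does (List.≡-dec _≟_ xs ys) | swap
    ... | true  | eq = if-true eq (exactly push)
    ... | false | eq = if-false eq (runs (s≤s z≤n) skip)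

  module _ (isOne : Γ → Bool) where

    unary : ℕ → List Γ
    unary m = List.replicate m tick

    unary-ʳ++ : ∀ m n → unary m ʳ++ unary n ≡ unary (m + n)
    unary-ʳ++ zero    n = refl
    unary-ʳ++ (suc m) n = trans (unary-ʳ++ m (suc n)) (cong unary (+-suc m n))

    unary-++ : ∀ m n → unary m ++ unary n ≡ unary (m + n)
    unary-++ zero    n = refl
    unary-++ (suc m) n = cong (tick ∷_) (unary-++ m n)

    length-unary : ∀ m → length (unary m) ≡ m
    length-unary m = List.length-replicate m

    halve : Prog d (suc (suc n))
    halve = while (nonempty 0F) (pop 0F ⨾ ifte (nonempty 0F) (pop 0F ⨾ push 1F tick) skip)

    halve-runs : ∀ m h → Runs {d} halve (unary m ∷ unary h ∷ σ) ([] ∷ unary (⌊ m /2⌋ + h) ∷ σ) (m * 6 + 1)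
    halve-runs zero          h = loop-done refl
    halve-runs (suc zero)    h = loop-again {m = 0} refl
      (exactly pop » if-false {b = 3} refl (runs (s≤s z≤n) skip)) (loop-done refl)
    -- A round uses up two ticks while the bound is charged per tick, so one round is given away.
    halve-runs {σ = σ} (suc (suc m)) h = loop-weaken {b = 5} (n≤1+n (suc m)) (loop-again {m = m} refl
      (exactly pop » if-true refl (exactly pop » exactly push))
      (runs-≡ (cong (λ k → [] ∷ unary k ∷ σ) (+-suc ⌊ m /2⌋ h)) (halve-runs m (suc h))))

    bit? : Maybe Γ → Bool
    bit? = maybe′ isOne false

    shift₅ : Fin n → Fin (suc (suc (suc (suc (suc n)))))
    shift₅ i = suc (suc (suc (suc (suc i))))

    digitStep : Fin n → Fin n → Prog (suc d) (suc (suc (suc (suc (suc n)))))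
    digitStep N D =
      ifte (2F , 2F , λ a _ → bit? a) skip (copy (shift₅ D) 0F) ⨾
      ifte (3F , 3F , λ a _ → bit? a) (copy (shift₅ N) 0F) skip ⨾
      halve ⨾ transfer 1F 0F ⨾ pop 2F ⨾ pop 3F

    digitStepCost : ℕ → ℕ
    digitStepCost L = suc (copyCost L) + (suc (copyCost L) + (((L + L) * 6 + 1) + ((L * 4 + 1) + (1 + 1))))

    digitLoop : Fin n → Fin n → Prog (suc d) (suc (suc (suc (suc (suc n)))))
    digitLoop N D = while (2F , 3F , λ a b → is-just a ∨ is-just b) (digitStep N D)

    popBoth : Prog d (suc (suc n))
    popBoth = while (0F , 1F , λ a b → is-just a ∧ is-just b) (pop 0F ⨾ pop 1F)

    compareProducts : (p q N D : Fin n) → Prog (suc (suc (suc (suc (suc d))))) (suc n)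
    compareProducts p q N D = local (local (local (local (
      copy (shift₅ p) 2F ⨾ copy (shift₅ q) 3F ⨾ copy (shift₅ D) 0F ⨾ digitLoop N D ⨾
      copy (shift₅ D) 1F ⨾ popBoth ⨾
      ifte (nonempty 1F) skip (push 4F tick) ⨾ clear 0F ⨾ clear 1F))))

    compareProductsCost : ℕ → ℕ
    compareProductsCost L = copyCost L + (copyCost L + (copyCost L + (((L + L) * suc (digitStepCost L) + 1) +
      (copyCost L + ((L * 3 + 1) + (3 + ((L * 2 + 1) + (L * 2 + 1))))))))

    popBoth-runs : ∀ c k → Runs {d} popBoth (unary c ∷ unary k ∷ σ) (unary (c ∸ k) ∷ unary (k ∸ c) ∷ σ) (c * 3 + 1)
    popBoth-runs zero    zero    = loop-done refl
    popBoth-runs zero    (suc k) = loop-done refl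
    popBoth-runs (suc c) zero    = runs (s≤s z≤n) (done refl)
    popBoth-runs (suc c) (suc k) = loop-again {m = c} refl (exactly pop » exactly pop) (popBoth-runs c k)

    unary-nonempty : ∀ k c → is-just (head (unary (k ∸ c))) ≡ not (k ≤ᵇ c)
    unary-nonempty zero          zero    = refl
    unary-nonempty zero          (suc c) = refl
    unary-nonempty (suc k)       zero    = refl
    unary-nonempty (suc zero)    (suc c) = unary-nonempty zero c
    unary-nonempty (suc (suc k)) (suc c) = unary-nonempty (suc k) c

    module _ (N D : ℕ) (N+D≤L : D + N ≤ L) {iN iD : Fin n}
      (σ : Store n) (eqN : lookup σ iN ≡ unary N) (eqD : lookup σ iD ≡ unary D) where
      open Digits isOne
      open Carry N D

      private
        D≤L : D ≤ L
        D≤L = ≤-trans (m≤m+n D N) N+D≤L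

        lenN : length (lookup σ iN) ≤ L
        lenN = ≤-trans (≤-reflexive (trans (cong length eqN) (length-unary N))) (≤-trans (m≤n+m N D) N+D≤L)

        lenD : length (lookup σ iD) ≤ L
        lenD = ≤-trans (≤-reflexive (trans (cong length eqD) (length-unary D))) D≤L

        add : ∀ {i} {k m} ρ → lookup σ i ≡ unary k → length (lookup σ i) ≤ L → {v w x out : List Γ} →
          ρ ≡ unary m ∷ v ∷ w ∷ x ∷ out ∷ σ →
          Runs {suc d} (copy (shift₅ i) 0F) ρ (unary (k + m) ∷ v ∷ w ∷ x ∷ out ∷ σ) (copyCost L)
        add {i = i} {k} {m} ρ eq len {v} {w} {x} {out} refl =
          runs-≡ (cong (λ z → z ∷ v ∷ w ∷ x ∷ out ∷ σ) (trans (cong (_++ unary m) eq) (unary-++ k m)))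
                 (copy-runs {i = shift₅ i} {j = 0F} (λ ()) (unary m ∷ v ∷ w ∷ x ∷ out ∷ σ) len)

      digitStep-runs : ∀ c ps qs {out} → c ≤ D + N → Runs {suc d} (digitStep iN iD)
        (unary c ∷ [] ∷ ps ∷ qs ∷ out ∷ σ)
        (unary (shifted (head ps) (head qs) c) ∷ [] ∷ drop 1 ps ∷ drop 1 qs ∷ out ∷ σ)
        (digitStepCost L)
      digitStep-runs c ps qs {out} c≤ = first » second » third » fourth » exactly pop » exactly pop
        where
        a = bit? (head ps)
        b = bit? (head qs)
        c₁ = (if a then 0 else D) + c
        c₂ = raise a b c
        c₃ = ⌊ c₂ /2⌋
        c₃≤L : c₃ ≤ L
        c₃≤L = ≤-trans (shifted-≤ (head ps) (head qs) c≤) N+D≤L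
        first : Runs _ (unary c ∷ [] ∷ ps ∷ qs ∷ out ∷ σ) (unary c₁ ∷ [] ∷ ps ∷ qs ∷ out ∷ σ) (suc (copyCost L))
        first with bit? (head ps) in eq
        ... | true  = if-true eq (runs (≤-trans (m≤n+m 1 (L * 4)) (m≤m+n _ _)) skip)
        ... | false = if-false eq (add _ eqD lenD refl)
        second : Runs _ (unary c₁ ∷ [] ∷ ps ∷ qs ∷ out ∷ σ) (unary c₂ ∷ [] ∷ ps ∷ qs ∷ out ∷ σ) (suc (copyCost L))
        second with bit? (head qs) in eq
        ... | true  = if-true eq (add _ eqN lenN refl)
        ... | false = if-false eq (runs (≤-trans (m≤n+m 1 (L * 4)) (m≤m+n _ _)) skip)
        third : Runs halve (unary c₂ ∷ [] ∷ ps ∷ qs ∷ out ∷ σ) ([] ∷ unary c₃ ∷ ps ∷ qs ∷ out ∷ σ) ((L + L) * 6 + 1)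
        third = loop-weaken (≤-trans (raise-≤ a b c≤) (+-mono-≤ N+D≤L N+D≤L))
          (runs-≡ (cong (λ k → [] ∷ unary k ∷ ps ∷ qs ∷ out ∷ σ) (+-identityʳ c₃)) (halve-runs c₂ 0))
        fourth : Runs (transfer 1F 0F) ([] ∷ unary c₃ ∷ ps ∷ qs ∷ out ∷ σ) (unary c₃ ∷ [] ∷ ps ∷ qs ∷ out ∷ σ) (L * 4 + 1)
        fourth = runs-≡ (cong (λ z → z ∷ [] ∷ ps ∷ qs ∷ out ∷ σ) (trans (unary-ʳ++ c₃ 0) (cong unary (+-identityʳ c₃))))
          (transfer-runs (λ ()) ([] ∷ unary c₃ ∷ ps ∷ qs ∷ out ∷ σ) (≤-trans (≤-reflexive (length-unary c₃)) c₃≤L))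

      digitLoop-runs : ∀ c ps qs {out} → c ≤ D + N → Runs {suc d} (digitLoop iN iD)
        (unary c ∷ [] ∷ ps ∷ qs ∷ out ∷ σ) (unary (carry c ps qs) ∷ [] ∷ [] ∷ [] ∷ out ∷ σ)
        ((length ps + length qs) * suc (digitStepCost L) + 1)
      digitLoop-runs c []       []       c≤ = loop-done refl
      digitLoop-runs c []       (b ∷ qs) c≤ = loop-again {m = length qs} refl (digitStep-runs c [] (b ∷ qs) c≤)
        (digitLoop-runs _ [] qs (shifted-≤ nothing (just b) c≤))
      digitLoop-runs c (a ∷ ps) []       c≤ = loop-again {m = length ps + 0} refl (digitStep-runs c (a ∷ ps) [] c≤)
        (digitLoop-runs _ ps [] (shifted-≤ (just a) nothing c≤))
      digitLoop-runs c (a ∷ ps) (b ∷ qs) c≤ = loop-weaken {b = digitStepCost L} (s≤s (+-monoʳ-≤ (length ps) (n≤1+n (length qs))))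
        (loop-again {m = length ps + length qs} refl (digitStep-runs c (a ∷ ps) (b ∷ qs) c≤)
          (digitLoop-runs _ ps qs (shifted-≤ (just a) (just b) c≤)))

      compareProducts-runs : ∀ {ip iq} → length (lookup σ ip) ≤ L → length (lookup σ iq) ≤ L →
        Runs {suc (suc (suc (suc (suc d))))} (compareProducts ip iq iN iD) ([] ∷ σ)
          (flag (value (lookup σ ip) * D ≤ᵇ value (lookup σ iq) * N) ∷ σ) (compareProductsCost L)
      compareProducts-runs {ip = ip} {iq} lenp lenq = in-local (in-local (in-local (in-local
        (copy-fresh (λ ()) ([] ∷ [] ∷ [] ∷ [] ∷ [] ∷ σ) refl lenp »
         copy-fresh (λ ()) ([] ∷ [] ∷ p ∷ [] ∷ [] ∷ σ) refl lenq »
         runs-≡ (cong (λ z → z ∷ [] ∷ p ∷ q ∷ [] ∷ σ) eqD)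
           (copy-fresh (λ ()) ([] ∷ [] ∷ p ∷ q ∷ [] ∷ σ) refl lenD) »
         loop-weaken (+-mono-≤ lenp lenq) (digitLoop-runs D p q (m≤m+n D N)) »
         runs-≡ (cong (λ z → unary c ∷ z ∷ [] ∷ [] ∷ [] ∷ σ) eqD)
           (copy-fresh (λ ()) (unary c ∷ [] ∷ [] ∷ [] ∷ [] ∷ σ) refl lenD) »
         loop-weaken c≤L (popBoth-runs c D) »
         result »
         clear-runs (unary (c ∸ D) ∷ unary (D ∸ c) ∷ [] ∷ [] ∷ out ∷ σ)
           (≤-trans (≤-reflexive (length-unary (c ∸ D))) (≤-trans (m∸n≤m c D) c≤L)) »
         clear-runs ([] ∷ unary (D ∸ c) ∷ [] ∷ [] ∷ out ∷ σ)
           (≤-trans (≤-reflexive (length-unary (D ∸ c))) (≤-trans (m∸n≤m D c) D≤L))))))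
        where
        p = lookup σ ip
        q = lookup σ iq
        c = carry D p q
        c≤L : c ≤ L
        c≤L = ≤-trans (carry-≤ p q (m≤m+n D N)) N+D≤L
        out = flag (value p * D ≤ᵇ value q * N)
        result : Runs (ifte (nonempty 1F) skip (push 4F tick))
          (unary (c ∸ D) ∷ unary (D ∸ c) ∷ [] ∷ [] ∷ [] ∷ σ) (unary (c ∸ D) ∷ unary (D ∸ c) ∷ [] ∷ [] ∷ out ∷ σ) 3
        result rewrite sym (carry-correct p q) with D ≤ᵇ c | unary-nonempty D c
        ... | true  | eq = if-false eq (exactly push)
        ... | false | eq = if-true eq (runs (s≤s z≤n) skip)

-- Evaluation of counting formulas over a table

module Formulas (Γ : Set) (_≟_ : DecidableEquality Γ) (tick sep : Γ) (isOne : Γ → Bool) where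
  open Stack Γ
  open Routines Γ
  open Comparison Γ _≟_ tick

  -- An entry consists of a key, a column and a value.

  Entry : Set
  Entry = List Γ × List Γ × List Γ

  encodeTable : List Entry → List Γ
  encodeTable []                 = []
  encodeTable ((k , c , v) ∷ es) = k ++ sep ∷ (c ++ sep ∷ (v ++ sep ∷ encodeTable es))

  WellFormed : Entry → Set
  WellFormed (k , c , v) = All (_≢ sep) k × All (_≢ sep) c × All (_≢ sep) v

  -- In `Formula h n`, h bounds the nesting of quantifiers, and the n free
  -- variables stand for words; `most p q φ ψ` says that p times the number
  -- of entries satisfying ψ is at most q times the number satisfying φ.

  infix  7 _≐_
  infixr 6 _&_

  data Formula : ℕ → ℕ → Set where
    _≐_  : Fin n → Fin n → Formula d n
    _&_  : Formula d n → Formula d n → Formula d n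
    ~_   : Formula d n → Formula d n
    most : Fin n → Fin n → Formula d (suc (suc (suc n))) → Formula d (suc (suc (suc n))) → Formula (suc d) n

  increment : Bool → ℕ → ℕ
  increment b k = if b then suc k else k

  tally : (Entry → Bool) → List Entry → ℕ
  tally f []       = 0
  tally f (e ∷ es) = increment (f e) (tally f es)

  bind : Store n → Entry → Store (suc (suc (suc n)))
  bind ρ (k , c , v) = k ∷ c ∷ v ∷ ρ

  number : List Γ → ℕ
  number = Digits.value isOne

  ⟦_⟧ : Formula d n → List Entry → Store n → Bool
  ⟦ i ≐ j ⟧ es ρ        = does (List.≡-dec _≟_ (lookup ρ i) (lookup ρ j))
  ⟦ φ & ψ ⟧ es ρ        = ⟦ φ ⟧ es ρ ∧ ⟦ ψ ⟧ es ρ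
  ⟦ ~ φ ⟧ es ρ          = not (⟦ φ ⟧ es ρ)
  ⟦ most p q φ ψ ⟧ es ρ =
    number (lookup ρ p) * tally (λ e → ⟦ ψ ⟧ es (bind ρ e)) es ≤ᵇ
    number (lookup ρ q) * tally (λ e → ⟦ φ ⟧ es (bind ρ e)) es

  -- A quantifier needs six registers of its own, for the three parts of an entry, the unread table
  -- and the two counters, and a seventh for the flag of the formula being tested. The five further
  -- ones in `need` are those of `compareProducts`: four local registers and the one inside `copy`.
  extra : ℕ → ℕ
  extra zero    = 0
  extra (suc h) = suc (suc (suc (suc (suc (suc (suc (extra h)))))))

  need : ℕ → ℕ
  need h = suc (suc (suc (suc (suc (extra h)))))

  shift₇ : Fin n → Fin (suc (suc (suc (suc (suc (suc (suc n)))))))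
  shift₇ i = suc (suc (suc (suc (suc (suc (suc i))))))

  place : ∀ {m} → (Fin n → Fin m) → Fin (suc (suc (suc n))) → Fin (suc (suc (suc (suc (suc (suc (suc m)))))))
  place r 0F                  = 0F
  place r 1F                  = 1F
  place r 2F                  = 2F
  place r (suc (suc (suc i))) = shift₇ (r i)

  addIf : Prog d (suc n) → Fin n → Prog (suc d) n
  addIf p i = local (p ⨾ ifte (nonempty 0F) (pop 0F ⨾ push (suc i) tick) skip)

  addIf-runs : ∀ {p : Prog d (suc n)} {σ b c} i → Runs p ([] ∷ σ) (flag b ∷ σ) c →
               Runs (addIf p i) σ (σ [ i ]≔ (flag b ++ lookup σ i)) (c + 4)
  addIf-runs {b = true}  i R = in-local (R » if-true refl (exactly pop » exactly push))
  addIf-runs {σ = σ} {b = false} i R = in-local (R » if-false refl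
    (runs-≡ (cong ([] ∷_) (sym (Vec.[]≔-lookup σ i))) (runs (s≤s z≤n) skip)))

  module _ where
    private variable
      m : ℕ

    scanStep : Prog (suc (suc d)) (suc (suc (suc (suc (suc (suc (suc (suc m)))))))) →
               Prog (suc (suc d)) (suc (suc (suc (suc (suc (suc (suc (suc m)))))))) →
               Prog (suc (suc (suc d))) (suc (suc (suc (suc (suc (suc (suc m)))))))
    scanStep p q =
      load _≟_ sep 3F 0F ⨾ load _≟_ sep 3F 1F ⨾ load _≟_ sep 3F 2F ⨾
      addIf p 5F ⨾ addIf q 4F ⨾ clear 0F ⨾ clear 1F ⨾ clear 2F

    code : ∀ {h} → Formula h n → (Fin n → Fin m) → Fin m → Prog (need h) (suc m)
    code (i ≐ j) r t = compareWords (r i) (r j)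
    code (φ & ψ) r t = code φ r t ⨾ ifte (nonempty 0F) (pop 0F ⨾ code ψ r t) skip
    code (~ φ) r t   = code φ r t ⨾ ifte (nonempty 0F) (pop 0F) (push 0F tick)
    -- Registers 0 to 2 hold the current entry, 3 the unread part of a copy of the table, 4 and 5
    -- the numbers of entries found so far to satisfy `ψ` and `φ`; 6 receives the result. Within the
    -- innermost `local` the flag comes first and the result register is 7.
    code (most p q φ ψ) r t = local (local (local (local (local (local (
      copy (shift₇ t) 3F ⨾
      while (nonempty 3F) (scanStep (code φ (place r) (shift₇ t)) (code ψ (place r) (shift₇ t))) ⨾
      local (compareProducts isOne (shift₇ (r p)) (shift₇ (r q)) 5F 4F ⨾ transfer 0F 7F) ⨾
      clear 4F ⨾ clear 5F))))))

  scanCost : ℕ → ℕ → ℕ → ℕ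
  scanCost a b L = loadCost _≟_ L + (loadCost _≟_ L + (loadCost _≟_ L + ((a + 4) + ((b + 4) +
    ((L * 2 + 1) + ((L * 2 + 1) + (L * 2 + 1)))))))

  cost : ∀ {h} → Formula h n → ℕ → ℕ
  cost (i ≐ j) L        = compareWordsCost L
  cost (φ & ψ) L        = cost φ L + suc (1 + cost ψ L)
  cost (~ φ) L          = cost φ L + 3
  -- The table has at most L entries, and `L + L` is there because the bound for `compareProducts`
  -- has to cover the sum of both counts.
  cost (most p q φ ψ) L = copyCost L + ((L * suc (scanCost (cost φ L) (cost ψ L) L) + 1) +
    ((compareProductsCost isOne (L + L) + (1 * 4 + 1)) + ((L * 2 + 1) + (L * 2 + 1))))

  flag-unary : ∀ b k → flag b ++ unary isOne k ≡ unary isOne (increment b k)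
  flag-unary true  k = refl
  flag-unary false k = refl

  tally-+ : ∀ b k l → l + increment b k ≡ increment b l + k
  tally-+ true  k l = +-suc l k
  tally-+ false k l = refl

  tally-≤ : ∀ f es → tally f es ≤ length es
  tally-≤ f []       = z≤n
  tally-≤ f (e ∷ es) with f e
  ... | true  = s≤s (tally-≤ f es)
  ... | false = m≤n⇒m≤1+n (tally-≤ f es)

  length-table : ∀ es → length es ≤ length (encodeTable es)
  length-table []                 = z≤n
  length-table ((k , c , v) ∷ es) = begin
    suc (length es)                                                    ≤⟨ s≤s (length-table es) ⟩
    length (sep ∷ encodeTable es)                                      ≤⟨ suffix v ⟩
    length (v ++ sep ∷ encodeTable es)                                 ≤⟨ n≤1+n _ ⟩
    length (sep ∷ (v ++ sep ∷ encodeTable es))                         ≤⟨ suffix c ⟩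
    length (c ++ sep ∷ (v ++ sep ∷ encodeTable es))                    ≤⟨ n≤1+n _ ⟩
    length (sep ∷ (c ++ sep ∷ (v ++ sep ∷ encodeTable es)))            ≤⟨ suffix k ⟩
    length (k ++ sep ∷ (c ++ sep ∷ (v ++ sep ∷ encodeTable es)))       ∎
    where
    open ≤-Reasoning
    suffix : ∀ xs {ys : List Γ} → length ys ≤ length (xs ++ ys)
    suffix xs {ys} = ≤-trans (m≤n+m (length ys) (length xs)) (≤-reflexive (sym (List.length-++ xs)))

  module _ {L : ℕ} where

    prefix-≤ : ∀ xs {ys : List Γ} → length (xs ++ ys) ≤ L → length xs ≤ L
    prefix-≤ xs {ys} h = ≤-trans (m≤m+n (length xs) (length ys)) (≤-trans (≤-reflexive (sym (List.length-++ xs))) h)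

    suffix-≤ : ∀ xs {a} {ys : List Γ} → length (xs ++ a ∷ ys) ≤ L → length ys ≤ L
    suffix-≤ xs {a} {ys} h = ≤-trans (n≤1+n (length ys)) (≤-trans (m≤n+m (suc (length ys)) (length xs))
      (≤-trans (≤-reflexive (sym (List.length-++ xs))) h))

    -- Only the flag changes, which is what allows a subformula to be evaluated again for every
    -- entry of the table on the same store. The variables reach their registers through `r` because
    -- every quantifier puts new registers in front of those of the outer variables.
    code-runs : ∀ {m h} (φ : Formula h n) {r : Fin n → Fin m} {t : Fin m} {σ : Store m} {ρ : Store n} {es} →
      (∀ i → lookup σ (r i) ≡ lookup ρ i) → (∀ i → length (lookup ρ i) ≤ L) →
      lookup σ t ≡ encodeTable es → length (encodeTable es) ≤ L → All WellFormed es →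
      Runs (code φ r t) ([] ∷ σ) (flag (⟦ φ ⟧ es ρ) ∷ σ) (cost φ L)
    code-runs (i ≐ j) {r} {σ = σ} {ρ} env len tab lenT wf =
      runs-≡ (cong₂ (λ xs ys → flag (does (List.≡-dec _≟_ xs ys)) ∷ σ) (env i) (env j))
        (compareWords-runs {i = r i} {r j} (≤-trans (≤-reflexive (cong length (env i))) (len i))
                                           (≤-trans (≤-reflexive (cong length (env j))) (len j)))
    code-runs (φ & ψ) {r} {t} {σ} {ρ} {es} env len tab lenT wf with ⟦ φ ⟧ es ρ | code-runs φ {ρ = ρ} env len tab lenT wf
    ... | true  | R = R » if-true refl (exactly pop » code-runs ψ env len tab lenT wf)
    ... | false | R = R » if-false refl (runs (s≤s z≤n) skip)
    code-runs (~ φ) {r} {t} {σ} {ρ} {es} env len tab lenT wf with ⟦ φ ⟧ es ρ | code-runs φ {ρ = ρ} env len tab lenT wf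
    ... | true  | R = R » if-true refl (runs (s≤s z≤n) pop)
    ... | false | R = R » if-false refl (exactly push)
    code-runs (most {d = h} p q φ ψ) {r} {t} {σ} {ρ} {es} env len tab lenT wf =
      in-local (in-local (in-local (in-local (in-local (in-local (
        runs-≡ (cong (λ z → [] ∷ [] ∷ [] ∷ z ∷ [] ∷ [] ∷ [] ∷ σ) tab)
          (copy-fresh {i = shift₇ t} {j = 3F} (λ ()) ([] ∷ [] ∷ [] ∷ [] ∷ [] ∷ [] ∷ [] ∷ σ) refl
            (≤-trans (≤-reflexive (cong length tab)) lenT)) »
        loop-weaken (≤-trans (length-table es) lenT) (scan-runs 0 0 es lenT wf) »
        -- The scan is stated for accumulators and starts with both at 0, so the counters come out
        -- as `D + 0` and `N + 0`; the zeros are removed once the comparison is done.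
        runs-≡ (cong₂ (λ a b → [] ∷ [] ∷ [] ∷ [] ∷ unary isOne a ∷ unary isOne b ∷ outOf a b ∷ σ) D≡ N≡)
          (in-local (
          runs-≡ (cong₂ (λ x y → flag (number x * (D + 0) ≤ᵇ number y * (N + 0)) ∷
                         [] ∷ [] ∷ [] ∷ [] ∷ unary isOne (D + 0) ∷ unary isOne (N + 0) ∷ [] ∷ σ) (env p) (env q))
          (compareProducts-runs isOne (N + 0) (D + 0) (+-mono-≤ (≤-trans (≤-reflexive D≡) D≤L) (≤-trans (≤-reflexive N≡) N≤L))
            ([] ∷ [] ∷ [] ∷ [] ∷ unary isOne (D + 0) ∷ unary isOne (N + 0) ∷ [] ∷ σ) refl refl
            {ip = shift₇ (r p)} {iq = shift₇ (r q)}
            (≤-trans (≤-reflexive (cong length (env p))) (≤-trans (len p) (m≤m+n L L)))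
            (≤-trans (≤-reflexive (cong length (env q))) (≤-trans (len q) (m≤m+n L L)))) »
          runs-≡ (cong (λ x → [] ∷ [] ∷ [] ∷ [] ∷ [] ∷ unary isOne (D + 0) ∷ unary isOne (N + 0) ∷ x ∷ σ)
              (flag-ʳ++ (number (lookup ρ p) * (D + 0) ≤ᵇ number (lookup ρ q) * (N + 0))))
            (transfer-runs (λ ()) (flag (number (lookup ρ p) * (D + 0) ≤ᵇ number (lookup ρ q) * (N + 0)) ∷
                         [] ∷ [] ∷ [] ∷ [] ∷ unary isOne (D + 0) ∷ unary isOne (N + 0) ∷ [] ∷ σ) (flag-length (number (lookup ρ p) * (D + 0) ≤ᵇ number (lookup ρ q) * (N + 0)))))) »
        clear-runs ([] ∷ [] ∷ [] ∷ [] ∷ unary isOne D ∷ unary isOne N ∷ out ∷ σ) (≤-trans (≤-reflexive (length-unary isOne D)) D≤L) »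
        clear-runs ([] ∷ [] ∷ [] ∷ [] ∷ [] ∷ unary isOne N ∷ out ∷ σ) (≤-trans (≤-reflexive (length-unary isOne N)) N≤L)))))))
      where
      f g : Entry → Bool
      f e = ⟦ φ ⟧ es (bind ρ e)
      g e = ⟦ ψ ⟧ es (bind ρ e)
      N = tally f es
      D = tally g es
      N≡ = +-identityʳ N
      D≡ = +-identityʳ D
      N≤L : N ≤ L
      N≤L = ≤-trans (tally-≤ f es) (≤-trans (length-table es) lenT)
      D≤L : D ≤ L
      D≤L = ≤-trans (tally-≤ g es) (≤-trans (length-table es) lenT)
      outOf : ℕ → ℕ → List Γ
      outOf a b = flag (number (lookup ρ p) * a ≤ᵇ number (lookup ρ q) * b)
      out = outOf D N

      p₁ = code φ (place r) (shift₇ t)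
      p₂ = code ψ (place r) (shift₇ t)

      scan-runs : ∀ a b es′ → length (encodeTable es′) ≤ L → All WellFormed es′ →
        Runs (while (nonempty 3F) (scanStep p₁ p₂))
          ([] ∷ [] ∷ [] ∷ encodeTable es′ ∷ unary isOne b ∷ unary isOne a ∷ [] ∷ σ)
          ([] ∷ [] ∷ [] ∷ [] ∷ unary isOne (tally g es′ + b) ∷ unary isOne (tally f es′ + a) ∷ [] ∷ σ)
          (length es′ * suc (scanCost (cost φ L) (cost ψ L) L) + 1)
      scan-runs a b []       _ _ = loop-done refl
      scan-runs a b (e@(k , c , v) ∷ es′) lenE ((k≢ , c≢ , v≢) ∷ wf′) =
        loop-again {m = length es′} (nonempty-table k)
          (runs-≡ (cong (λ z → z ∷ [] ∷ [] ∷ rest₁ ∷ B ∷ A ∷ [] ∷ σ) (List.++-identityʳ k))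
             (load-runs _≟_ {i = 3F} {0F} (λ ()) ([] ∷ [] ∷ [] ∷ encodeTable (e ∷ es′) ∷ B ∷ A ∷ [] ∷ σ) k rest₁ k≢ refl lenK) »
           runs-≡ (cong (λ z → k ∷ z ∷ [] ∷ rest₂ ∷ B ∷ A ∷ [] ∷ σ) (List.++-identityʳ c))
             (load-runs _≟_ {i = 3F} {1F} (λ ()) (k ∷ [] ∷ [] ∷ rest₁ ∷ B ∷ A ∷ [] ∷ σ) c rest₂ c≢ refl lenC) »
           runs-≡ (cong (λ z → k ∷ c ∷ z ∷ rest₃ ∷ B ∷ A ∷ [] ∷ σ) (List.++-identityʳ v))
             (load-runs _≟_ {i = 3F} {2F} (λ ()) (k ∷ c ∷ [] ∷ rest₂ ∷ B ∷ A ∷ [] ∷ σ) v rest₃ v≢ refl lenV) »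
           runs-≡ (cong (λ z → k ∷ c ∷ v ∷ rest₃ ∷ B ∷ z ∷ [] ∷ σ) (flag-unary (f e) a))
             (addIf-runs 5F (code-runs φ {place r} {shift₇ t} env′ len′ tab lenT wf)) »
           runs-≡ (cong (λ z → k ∷ c ∷ v ∷ rest₃ ∷ z ∷ A′ ∷ [] ∷ σ) (flag-unary (g e) b))
             (addIf-runs 4F (code-runs ψ {place r} {shift₇ t} env′ len′ tab lenT wf)) »
           clear-runs (k ∷ c ∷ v ∷ rest₃ ∷ B′ ∷ A′ ∷ [] ∷ σ) lenK »
           clear-runs ([] ∷ c ∷ v ∷ rest₃ ∷ B′ ∷ A′ ∷ [] ∷ σ) lenC »
           clear-runs ([] ∷ [] ∷ v ∷ rest₃ ∷ B′ ∷ A′ ∷ [] ∷ σ) lenV)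
          (runs-≡ (cong₂ (λ x y → [] ∷ [] ∷ [] ∷ [] ∷ unary isOne x ∷ unary isOne y ∷ [] ∷ σ)
                     (tally-+ (g e) b (tally g es′)) (tally-+ (f e) a (tally f es′)))
                  (scan-runs (increment (f e) a) (increment (g e) b) es′ (suffix-≤ v len₂) wf′))
        where
        A = unary isOne a
        B = unary isOne b
        A′ = unary isOne (increment (f e) a)
        B′ = unary isOne (increment (g e) b)
        rest₃ = encodeTable es′
        rest₂ = v ++ sep ∷ rest₃
        rest₁ = c ++ sep ∷ rest₂
        lenK = prefix-≤ k lenE
        len₁ = suffix-≤ k lenE
        lenC = prefix-≤ c len₁
        len₂ = suffix-≤ c len₁
        lenV = prefix-≤ v len₂
        nonempty-table : ∀ k → is-just (head (k ++ sep ∷ rest₁)) ≡ true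
        nonempty-table []      = refl
        nonempty-table (_ ∷ _) = refl
        env′ : ∀ {x y} i → lookup (k ∷ c ∷ v ∷ rest₃ ∷ x ∷ y ∷ [] ∷ σ) (place r i) ≡ lookup (bind ρ e) i
        env′ 0F = refl
        env′ 1F = refl
        env′ 2F = refl
        env′ (suc (suc (suc i))) = env i
        len′ : ∀ i → length (lookup (bind ρ e) i) ≤ L
        len′ 0F = lenK
        len′ 1F = lenC
        len′ 2F = lenV
        len′ (suc (suc (suc i))) = len i

-- Polynomial bounds

Polynomial : (ℕ → ℕ) → Set
Polynomial f = ∃₂ λ c d → ∀ m → f m ≤ c * suc m ^ d

poly-≤ : ∀ {f g} → (∀ m → f m ≤ g m) → Polynomial g → Polynomial f
poly-≤ f≤g (c , d , h) = c , d , λ m → ≤-trans (f≤g m) (h m)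

poly-const : ∀ c → Polynomial (λ _ → c)
poly-const c = c , 0 , λ m → ≤-reflexive (sym (*-identityʳ c))

poly-id : Polynomial id
poly-id = 1 , 1 , λ m → ≤-trans (n≤1+n m)
  (≤-reflexive (sym (trans (*-identityˡ (suc m ^ 1)) (^-identityʳ (suc m)))))

poly-* : ∀ {f g} → Polynomial f → Polynomial g → Polynomial (λ m → f m * g m)
poly-* (c , d , h) (c′ , d′ , h′) = c * c′ , d + d′ , λ m →
  ≤-trans (*-mono-≤ (h m) (h′ m)) (≤-reflexive (begin
    c * suc m ^ d * (c′ * suc m ^ d′)     ≡⟨ regroup c (suc m ^ d) c′ (suc m ^ d′) ⟩
    c * c′ * (suc m ^ d * suc m ^ d′)     ≡⟨ cong (c * c′ *_) (^-distribˡ-+-* (suc m) d d′) ⟨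
    c * c′ * suc m ^ (d + d′)             ∎))
  where
  open ≡-Reasoning
  regroup : ∀ a b c d → a * b * (c * d) ≡ a * c * (b * d)
  regroup = solve-∀

-- Both bounds are raised to the common degree `d + d′`. This works at m = 0 too because the base is
-- `suc m`, whose powers never decrease with the exponent.
poly-+ : ∀ {f g} → Polynomial f → Polynomial g → Polynomial (λ m → f m + g m)
poly-+ (c , d , h) (c′ , d′ , h′) = c + c′ , d + d′ , λ m → ≤-trans
  (+-mono-≤ (≤-trans (h m) (*-monoʳ-≤ c (^-monoʳ-≤ (suc m) (m≤m+n d d′))))
            (≤-trans (h′ m) (*-monoʳ-≤ c′ (^-monoʳ-≤ (suc m) (m≤n+m d′ d)))))
  (≤-reflexive (sym (*-distribʳ-+ (suc m ^ (d + d′)) c c′)))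

poly-suc : ∀ {f} → Polynomial f → Polynomial (λ m → suc (f m))
poly-suc = poly-+ (poly-const 1)

poly-^ : ∀ {f} → Polynomial f → ∀ k → Polynomial (λ m → f m ^ k)
poly-^ P zero    = poly-const 1
poly-^ P (suc k) = poly-* P (poly-^ P k)

poly-∘ : ∀ {f g} → Polynomial f → Polynomial g → Polynomial (λ m → f (g m))
poly-∘ (c , d , h) G = poly-≤ (λ m → h _) (poly-* (poly-const c) (poly-^ (poly-suc G) d))

power-* : ∀ d a b → (a * b) ^ d ≡ a ^ d * b ^ d
power-* zero    a b = refl
power-* (suc d) a b = trans (cong (a * b *_) (power-* d a b)) (regroup a b (a ^ d) (b ^ d))
  where
  regroup : ∀ a b x y → a * b * (x * y) ≡ a * x * (b * y)
  regroup = solve-∀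

-- The shape demanded by `InP`. For m ≥ 1 the successor is at most twice m, which costs the factor
-- `2 ^ d`; the added constant takes care of m = 0.
poly-bound : ∀ {f} → Polynomial f → ∃₂ λ c d → ∀ m → f m ≤ c * m ^ d + c
poly-bound {f} (c , d , h) = c * 2 ^ d , d , λ m → ≤-trans (h m) (bound m)
  where
  open ≤-Reasoning
  bound : ∀ m → c * suc m ^ d ≤ c * 2 ^ d * m ^ d + c * 2 ^ d
  bound zero = begin
    c * 1 ^ d                           ≤⟨ *-monoʳ-≤ c (^-monoˡ-≤ d (s≤s z≤n)) ⟩
    c * 2 ^ d                           ≤⟨ m≤n+m _ _ ⟩
    c * 2 ^ d * 0 ^ d + c * 2 ^ d       ∎
  bound (suc m) = begin
    c * suc (suc m) ^ d                 ≤⟨ *-monoʳ-≤ c (^-monoˡ-≤ d (double m)) ⟩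
    c * (2 * suc m) ^ d                 ≡⟨ cong (c *_) (power-* d 2 (suc m)) ⟩
    c * (2 ^ d * suc m ^ d)             ≡⟨ *-assoc c (2 ^ d) (suc m ^ d) ⟨
    c * 2 ^ d * suc m ^ d               ≤⟨ m≤m+n _ _ ⟩
    c * 2 ^ d * suc m ^ d + c * 2 ^ d   ∎
    where
    double : ∀ m → suc (suc m) ≤ 2 * suc m
    double m = s≤s (≤-trans (m≤m+n (suc m) (m + 0)) (≤-reflexive (regroup m)))
      where
      regroup : ∀ m → suc m + (m + 0) ≡ m + suc (m + 0)
      regroup = solve-∀

-- Growth of the registers

module Growth (Γ : Set) where
  open Stack Γ

  Bounded : ℕ → Store n → Set
  Bounded b σ = ∀ i → length (lookup σ i) ≤ b

  bounded-update : ∀ {b c} {σ : Store n} → b ≤ c → Bounded b σ → ∀ i xs → length xs ≤ c → Bounded c (σ [ i ]≔ xs)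
  bounded-update {c = c} {σ} b≤c B i xs len k with k Fin.≟ i
  ... | yes refl = subst (λ ys → length ys ≤ c) (sym (Vec.lookup∘update i σ xs)) len
  ... | no k≢i   = subst (λ ys → length ys ≤ c) (sym (Vec.lookup∘update′ k≢i σ xs)) (≤-trans (B k) b≤c)

  -- No instruction writes more letters than it takes steps. This bounds the table, whose keys
  -- repeat whole rows, by the length of the input plus the time spent on building it.
  run-grows : ∀ {p : Prog d n} {σ σ′ k b} → Run p σ σ′ k → Bounded b σ → Bounded (b + k) σ′
  run-grows {b = b} skip B i = ≤-trans (B i) (m≤m+n b 1)
  run-grows {σ = σ} {b = b} (push {i = i} {a = a}) B = bounded-update {σ = σ} (m≤m+n b 2) B i (a ∷ lookup σ i)
    (≤-trans (s≤s (B i)) (≤-trans (≤-reflexive (+-comm 1 b)) (+-monoʳ-≤ b (n≤1+n 1))))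
  run-grows {σ = σ} {b = b} (cp {j = j} {a = a} _ _) B = bounded-update {σ = σ} (m≤m+n b 2) B j (a ∷ lookup σ j)
    (≤-trans (s≤s (B j)) (≤-trans (≤-reflexive (+-comm 1 b)) (+-monoʳ-≤ b (n≤1+n 1))))
  run-grows {σ = σ} {b = b} (pop {i = i}) B = bounded-update {σ = σ} (m≤m+n b 1) B i (drop 1 (lookup σ i))
    (≤-trans (≤-reflexive (List.length-drop 1 (lookup σ i))) (≤-trans (m∸n≤m _ 1) (≤-trans (B i) (m≤m+n b 1))))
  run-grows {b = b} (_⨾_ {k = k} {l = l} R R′) B i =
    ≤-trans (run-grows R′ (run-grows R B) i) (≤-reflexive (+-assoc b k l))
  run-grows {b = b} (then′ {k = k} _ R) B i = ≤-trans (run-grows R B i) (+-monoʳ-≤ b (n≤1+n k))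
  run-grows {b = b} (else′ {k = k} _ R) B i = ≤-trans (run-grows R B i) (+-monoʳ-≤ b (n≤1+n k))
  run-grows {b = b} (done _) B i = ≤-trans (B i) (m≤m+n b 1)
  run-grows {b = b} (again {k = k} {l = l} _ R R′) B i =
    ≤-trans (run-grows R′ (run-grows R B) i)
      (≤-trans (≤-reflexive (+-assoc b k l)) (+-monoʳ-≤ b (n≤1+n (k + l))))
  run-grows {b = b} (local R) B i = run-grows R (λ { zero → z≤n ; (suc i) → B i }) (suc i)

-- The table of cells

module Decider (U : Universe) where
  open Mining U using (InputSymbol; bit; minus; slash; null; comma; semicolon; inputSymbolFinite)

  infix 4 _≟ₛ_

  _≟ₛ_ : DecidableEquality InputSymbol
  _≟ₛ_ = Fin.inj⇒≟ (↔⇒↣ (proj₂ inputSymbolFinite))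

  isOne : InputSymbol → Bool
  isOne (bit 1F) = true
  isOne _        = false

  open Stack InputSymbol
  open Machine InputSymbol
  open Routines InputSymbol
  open Comparison InputSymbol _≟ₛ_ comma
  open Formulas InputSymbol _≟ₛ_ comma semicolon isOne public
  open Growth InputSymbol

  private variable
    M : ℕ

  Str : Set
  Str = List InputSymbol

  encodeCells : List Str → Str
  encodeCells []       = []
  encodeCells (v ∷ vs) = v ++ comma ∷ encodeCells vs

  encodeRows : List (List Str) → Str
  encodeRows []       = []
  encodeRows (r ∷ rs) = encodeCells r ++ semicolon ∷ encodeRows rs

  -- The key of a cell consists of all other cells of its row, its column is
  -- the number of cells to its left in unary.

  rowEntries : Str → Str → List Str → List Entry → List Entry
  rowEntries l c []       es = es
  rowEntries l c (v ∷ vs) es =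
    rowEntries (v ++ comma ∷ l) (comma ∷ c) vs ((l ++ null ∷ encodeCells vs , c , v) ∷ es)

  table : List (List Str) → List Entry → List Entry
  table []       es = es
  table (r ∷ rs) es = table rs (rowEntries [] [] r es)

  -- Registers 0 to 4 hold the cell, its column, the cells to its left, the cells to its right and
  -- the table. As the table is a stack, the new entry is written from its end: value, column, right
  -- part of the key, marker `null`, left part. The left part itself is a stack, so its cells appear
  -- in reverse order.
  cellStep : Prog (suc d) (suc (suc (suc (suc (suc n)))))
  cellStep =
    load _≟ₛ_ comma 3F 0F ⨾
    push 4F semicolon ⨾ copy 0F 4F ⨾ push 4F semicolon ⨾ copy 1F 4F ⨾ push 4F semicolon ⨾
    copy 3F 4F ⨾ push 4F null ⨾ copy 2F 4F ⨾
    push 2F comma ⨾ copy 0F 2F ⨾ clear 0F ⨾ push 1F comma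

  cellStepCost : ℕ → ℕ
  cellStepCost M = loadCost _≟ₛ_ M + (2 + (copyCost M + (2 + (copyCost M + (2 + (copyCost M + (2 + (copyCost M +
    (2 + (copyCost M + ((M * 2 + 1) + 2)))))))))))

  rowLoop : Prog (suc d) (suc (suc (suc (suc (suc n)))))
  rowLoop = while (nonempty 3F) cellStep

  leftOf : Str → List Str → Str
  leftOf l []       = l
  leftOf l (v ∷ vs) = leftOf (v ++ comma ∷ l) vs

  columnOf : Str → List Str → Str
  columnOf c []       = c
  columnOf c (v ∷ vs) = columnOf (comma ∷ c) vs

  NoComma NoSemicolon : Str → Set
  NoComma     = All (_≢ comma)
  NoSemicolon = All (_≢ semicolon)

  nonempty-++ : ∀ xs {a : InputSymbol} {ys} → is-just (head (xs ++ a ∷ ys)) ≡ true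
  nonempty-++ []      = refl
  nonempty-++ (_ ∷ _) = refl

  length-cells : ∀ vs → length vs ≤ length (encodeCells vs)
  length-cells []       = z≤n
  length-cells (v ∷ vs) = ≤-trans (s≤s (length-cells vs))
    (≤-trans (m≤n+m _ (length v)) (≤-reflexive (sym (List.length-++ v))))

  private
    -- A cell that passes from the right part to the left part leaves the total length unchanged, so
    -- a bound on the whole row persists through the loop.
    left-fits : ∀ l v vs → length l + length (encodeCells (v ∷ vs)) ≤ M →
                length (v ++ comma ∷ l) + length (encodeCells vs) ≤ M
    left-fits l v vs = ≤-trans (≤-reflexive (begin
      length (v ++ comma ∷ l) + length (encodeCells vs)          ≡⟨ cong (_+ length (encodeCells vs)) (List.length-++ v) ⟩
      length v + suc (length l) + length (encodeCells vs)        ≡⟨ regroup (length v) (length l) (length (encodeCells vs)) ⟩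
      length l + (length v + suc (length (encodeCells vs)))      ≡⟨ cong (length l +_) (List.length-++ v) ⟨
      length l + length (encodeCells (v ∷ vs))                   ∎))
      where
      open ≡-Reasoning
      regroup : ∀ v l r → v + suc l + r ≡ l + (v + suc r)
      regroup = solve-∀

    column-fits : ∀ c v vs → length c + length (encodeCells (v ∷ vs)) ≤ M →
                  length (comma ∷ c) + length (encodeCells vs) ≤ M
    column-fits c v vs = ≤-trans (≤-trans (≤-reflexive (sym (+-suc (length c) (length (encodeCells vs)))))
      (+-monoʳ-≤ (length c) (≤-trans (m≤n+m _ (length v)) (≤-reflexive (sym (List.length-++ v))))))

    leftOf-fits : ∀ l vs → length l + length (encodeCells vs) ≤ M → length (leftOf l vs) ≤ M
    leftOf-fits l []       h = ≤-trans (m≤m+n _ 0) h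
    leftOf-fits l (v ∷ vs) h = leftOf-fits (v ++ comma ∷ l) vs (left-fits l v vs h)

    columnOf-fits : ∀ c vs → length c + length (encodeCells vs) ≤ M → length (columnOf c vs) ≤ M
    columnOf-fits c []       h = ≤-trans (m≤m+n _ 0) h
    columnOf-fits c (v ∷ vs) h = columnOf-fits (comma ∷ c) vs (column-fits c v vs h)

    fits : ∀ {a} {b : ℕ} → a + b ≤ M → b ≤ M
    fits {a = a} {b} = ≤-trans (m≤n+m b a)

  cellStep-runs : ∀ {σ : Store n} l c v vs es → NoComma v →
    length l + length (encodeCells (v ∷ vs)) ≤ M → length c + length (encodeCells (v ∷ vs)) ≤ M →
    Runs {suc d} cellStep ([] ∷ c ∷ l ∷ encodeCells (v ∷ vs) ∷ encodeTable es ∷ σ)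
      ([] ∷ (comma ∷ c) ∷ (v ++ comma ∷ l) ∷ encodeCells vs ∷
       encodeTable ((l ++ null ∷ encodeCells vs , c , v) ∷ es) ∷ σ) (cellStepCost M)
  cellStep-runs {M = M} {σ = σ} l c v vs es v≢ hl hc =
    runs-≡ (cong (λ z → z ∷ c ∷ l ∷ encodeCells vs ∷ encodeTable es ∷ σ) (List.++-identityʳ v))
      (load-runs _≟ₛ_ {i = 3F} {0F} (λ ()) ([] ∷ c ∷ l ∷ encodeCells (v ∷ vs) ∷ encodeTable es ∷ σ) v (encodeCells vs) v≢ refl lenv) »
    exactly push »
    copy-runs {i = 0F} {4F} (λ ()) (v ∷ c ∷ l ∷ encodeCells vs ∷ (semicolon ∷ encodeTable es) ∷ σ) lenv »
    exactly push »
    copy-runs {i = 1F} {4F} (λ ()) (v ∷ c ∷ l ∷ encodeCells vs ∷ (semicolon ∷ (v ++ semicolon ∷ encodeTable es)) ∷ σ) lenc »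
    exactly push »
    copy-runs {i = 3F} {4F} (λ ()) (v ∷ c ∷ l ∷ encodeCells vs ∷ (semicolon ∷ (c ++ semicolon ∷ (v ++ semicolon ∷ encodeTable es))) ∷ σ) lenr »
    exactly push »
    runs-≡ (cong (λ z → v ∷ c ∷ l ∷ encodeCells vs ∷ z ∷ σ) (sym (List.++-assoc l _ _)))
      (copy-runs {i = 2F} {4F} (λ ()) (v ∷ c ∷ l ∷ encodeCells vs ∷
        (null ∷ (encodeCells vs ++ semicolon ∷ (c ++ semicolon ∷ (v ++ semicolon ∷ encodeTable es)))) ∷ σ) lenl) »
    exactly push »
    copy-runs {i = 0F} {2F} (λ ()) (v ∷ c ∷ (comma ∷ l) ∷ encodeCells vs ∷ T′ ∷ σ) lenv »
    clear-runs (v ∷ c ∷ (v ++ comma ∷ l) ∷ encodeCells vs ∷ T′ ∷ σ) lenv »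
    exactly push
    where
    T′ = encodeTable ((l ++ null ∷ encodeCells vs , c , v) ∷ es)
    lenl : length l ≤ M
    lenl = ≤-trans (m≤m+n _ _) hl
    lenc : length c ≤ M
    lenc = ≤-trans (m≤m+n _ _) hc
    both : length v + suc (length (encodeCells vs)) ≤ M
    both = ≤-trans (≤-reflexive (sym (List.length-++ v))) (fits hl)
    lenv : length v ≤ M
    lenv = ≤-trans (m≤m+n _ _) both
    lenr : length (encodeCells vs) ≤ M
    lenr = ≤-trans (n≤1+n _) (fits both)

  rowLoop-runs : ∀ {σ : Store n} l c vs es → All NoComma vs →
    length l + length (encodeCells vs) ≤ M → length c + length (encodeCells vs) ≤ M →
    Runs {suc d} rowLoop ([] ∷ c ∷ l ∷ encodeCells vs ∷ encodeTable es ∷ σ)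
      ([] ∷ columnOf c vs ∷ leftOf l vs ∷ [] ∷ encodeTable (rowEntries l c vs es) ∷ σ)
      (length vs * suc (cellStepCost M) + 1)
  rowLoop-runs l c []       es []         hl hc = loop-done refl
  rowLoop-runs l c (v ∷ vs) es (v≢ ∷ vs≢) hl hc = loop-again {m = length vs} (nonempty-++ v)
    (cellStep-runs l c v vs es v≢ hl hc)
    (rowLoop-runs (v ++ comma ∷ l) (comma ∷ c) vs _ vs≢ (left-fits l v vs hl) (column-fits c v vs hc))

  buildStep : Prog (suc (suc (suc (suc (suc d))))) 7
  buildStep = local (local (local (local (
    load _≟ₛ_ semicolon (suc 9F) 3F ⨾ rowLoop ⨾ clear 2F ⨾ clear 1F))))

  buildStepCost : ℕ → ℕ
  buildStepCost M = loadCost _≟ₛ_ M + ((M * suc (cellStepCost M) + 1) + ((M * 2 + 1) + (M * 2 + 1)))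

  build : Prog (suc (suc (suc (suc (suc d))))) 7
  build = while (nonempty 6F) buildStep

  GoodRow : List Str → Set
  GoodRow r = All (λ v → NoComma v × NoSemicolon v) r

  row-NoSemicolon : ∀ {r} → GoodRow r → NoSemicolon (encodeCells r)
  row-NoSemicolon []             = []
  row-NoSemicolon ((_ , h) ∷ hs) = All.++⁺ h ((λ ()) ∷ row-NoSemicolon hs)

  build-runs : ∀ {s₁ s₂ s₃ s₄ s₅} rs es → All GoodRow rs → length (encodeRows rs) ≤ M →
    Runs {suc (suc (suc (suc (suc d))))} build
      (encodeTable es ∷ s₁ ∷ s₂ ∷ s₃ ∷ s₄ ∷ s₅ ∷ encodeRows rs ∷ [])
      (encodeTable (table rs es) ∷ s₁ ∷ s₂ ∷ s₃ ∷ s₄ ∷ s₅ ∷ [] ∷ [])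
      (length rs * suc (buildStepCost M) + 1)
  build-runs []       es []       len = loop-done refl
  build-runs {M = M} {s₁ = s₁} {s₂} {s₃} {s₄} {s₅} (r ∷ rs) es (g ∷ gs) len =
    loop-again {m = length rs} (nonempty-++ (encodeCells r))
      (in-local (in-local (in-local (in-local (
        runs-≡ (cong (λ z → [] ∷ [] ∷ [] ∷ z ∷ encodeTable es ∷ s₁ ∷ s₂ ∷ s₃ ∷ s₄ ∷ s₅ ∷ encodeRows rs ∷ []) (List.++-identityʳ _))
          (load-runs _≟ₛ_ {i = suc 9F} {3F} (λ ())
            ([] ∷ [] ∷ [] ∷ [] ∷ encodeTable es ∷ s₁ ∷ s₂ ∷ s₃ ∷ s₄ ∷ s₅ ∷ encodeRows (r ∷ rs) ∷ [])
            (encodeCells r) (encodeRows rs) (row-NoSemicolon g) refl lenr) »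
        loop-weaken (≤-trans (length-cells r) lenr) (rowLoop-runs [] [] r es (All.map proj₁ g) lenr lenr) »
        clear-runs ([] ∷ columnOf [] r ∷ leftOf [] r ∷ [] ∷ encodeTable (rowEntries [] [] r es) ∷ s₁ ∷ s₂ ∷ s₃ ∷ s₄ ∷ s₅ ∷ encodeRows rs ∷ [])
          (leftOf-fits [] r lenr) »
        clear-runs ([] ∷ columnOf [] r ∷ [] ∷ [] ∷ encodeTable (rowEntries [] [] r es) ∷ s₁ ∷ s₂ ∷ s₃ ∷ s₄ ∷ s₅ ∷ encodeRows rs ∷ [])
          (columnOf-fits [] r lenr))))))
      (build-runs rs (rowEntries [] [] r es) gs lenrs)
    where
    both : length (encodeCells r) + suc (length (encodeRows rs)) ≤ M
    both = ≤-trans (≤-reflexive (sym (List.length-++ (encodeCells r)))) len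
    lenr : length (encodeCells r) ≤ M
    lenr = ≤-trans (m≤m+n _ _) both
    lenrs : length (encodeRows rs) ≤ M
    lenrs = ≤-trans (n≤1+n _) (fits {a = length (encodeCells r)} both)

  rowEntries-wellFormed : ∀ {l c r es} → NoSemicolon l → NoSemicolon c → GoodRow r → All WellFormed es →
                          All WellFormed (rowEntries l c r es)
  rowEntries-wellFormed hl hc []             hes = hes
  rowEntries-wellFormed hl hc ((_ , h) ∷ hs) hes = rowEntries-wellFormed (All.++⁺ h ((λ ()) ∷ hl)) ((λ ()) ∷ hc) hs
    ((All.++⁺ hl ((λ ()) ∷ row-NoSemicolon hs) , hc , h) ∷ hes)

  table-wellFormed : ∀ {rs es} → All GoodRow rs → All WellFormed es → All WellFormed (table rs es)
  table-wellFormed []       hes = hes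
  table-wellFormed (g ∷ gs) hes = table-wellFormed gs (rowEntries-wellFormed [] [] g hes)

-- The sentence and the program that decides it

module Sentence (U : Universe) where
  open Mining U using (InputSymbol; bit; minus; slash; null; comma; semicolon; inputSymbolFinite)
  open Decider U
  open Stack InputSymbol
  open Machine InputSymbol
  open Routines InputSymbol
  open Comparison InputSymbol _≟ₛ_ comma
  open Growth InputSymbol

  -- The free variables of `sentence` are two, one, the denominator and the
  -- numerator of s, k and the empty word.

  exists : Fin n → Formula d (suc (suc (suc n))) → Formula (suc d) n
  -- `~ (0F ≐ 0F)` holds for no entry, so the inner formula says that the number of entries
  -- satisfying `φ` is at most 0.
  exists one φ = ~ most one one (~ (0F ≐ 0F)) φ

  varied : Formula (suc d) 9
  varied = exists 4F (1F ≐ 4F & ~ (2F ≐ 5F))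

  -- One cell of each row lies in the first column, whose unary number is the empty word. Entries
  -- are cells, so a count of columns comes multiplied by the number of tuples; comparing it with
  -- the leftmost cells cancels this factor.
  leftmost : Formula d 9
  leftmost = 1F ≐ 8F

  sameColumn : Formula d 12
  sameColumn = 1F ≐ 4F

  -- The innermost entry has the lowest variables: 0F to 2F are the cell being counted, 3F to 5F the
  -- cell that supplies v, and 6F to 8F the cell of t, which fixes A and the class. A key also
  -- determines the column, so every tuple of the class is counted once.
  sameKey deviant : Formula d 15
  sameKey = 0F ≐ 6F
  deviant = sameKey & ~ (2F ≐ 5F)

  ratio : Formula (suc d) 12
  ratio = most 9F 8F deviant sameKey

  confident : Formula (suc (suc (suc d))) 6
  confident = exists 1F (exists 4F (sameColumn & ratio))

  sentence : Formula 3 6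
  sentence = most 0F 1F varied leftmost & most 4F 1F varied leftmost & confident

  constants : Str → Str → Str → Store 6
  constants den num k = (bit 0F ∷ bit 1F ∷ []) ∷ (bit 1F ∷ []) ∷ den ∷ num ∷ k ∷ [] ∷ []

  prepare : Prog (suc (suc (suc (suc (suc d))))) 7
  prepare =
    load _≟ₛ_ semicolon 6F 5F ⨾ load _≟ₛ_ slash 6F 4F ⨾ load _≟ₛ_ semicolon 6F 3F ⨾
    load _≟ₛ_ semicolon 6F 0F ⨾ clear 0F ⨾
    push 2F (bit 1F) ⨾ push 1F (bit 1F) ⨾ push 1F (bit 0F) ⨾ build

  prepareCost : ℕ → ℕ
  prepareCost M = loadCost _≟ₛ_ M + (loadCost _≟ₛ_ M + (loadCost _≟ₛ_ M + (loadCost _≟ₛ_ M + ((M * 2 + 1) +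
    (2 + (2 + (2 + (M * suc (buildStepCost M) + 1))))))))

  -- `need 3` is 26, and one more register holds the flag; with the six registers of `decide` this
  -- makes 33. The result goes to register 6, which held the input and has been used up by `build`.
  answer : Formula 3 6 → Prog 27 7
  answer φ = local (code φ suc 0F ⨾ transfer 0F 7F) ⨾
    clear 0F ⨾ clear 1F ⨾ clear 2F ⨾ clear 3F ⨾ clear 4F ⨾ clear 5F

  answerCost : Formula 3 6 → ℕ → ℕ
  answerCost φ L = (cost φ L + (1 * 4 + 1)) + ((L * 2 + 1) + ((L * 2 + 1) + ((L * 2 + 1) +
    ((L * 2 + 1) + ((L * 2 + 1) + (L * 2 + 1))))))

  decide : Formula 3 6 → Prog 33 1
  decide φ = local (local (local (local (local (local (prepare ⨾ answer φ))))))

  wordOf : (k num den attributes : Str) → List (List Str) → Str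
  wordOf k num den as rs = k ++ semicolon ∷ (num ++ slash ∷ (den ++ semicolon ∷ (as ++ semicolon ∷ encodeRows rs)))

  decideCost : Formula 3 6 → ℕ → ℕ
  decideCost φ M = prepareCost M + answerCost φ (M + prepareCost M)

  private
    ≤-left : ∀ xs {a : InputSymbol} {ys M} → length (xs ++ a ∷ ys) ≤ M → length xs ≤ M
    ≤-left xs h = ≤-trans (m≤m+n _ _) (≤-trans (≤-reflexive (sym (List.length-++ xs))) h)

    ≤-right : ∀ xs {a : InputSymbol} {ys M} → length (xs ++ a ∷ ys) ≤ M → length ys ≤ M
    ≤-right xs h = ≤-trans (≤-trans (n≤1+n _) (m≤n+m _ (length xs))) (≤-trans (≤-reflexive (sym (List.length-++ xs))) h)

    length-rows : ∀ rs → length rs ≤ length (encodeRows rs)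
    length-rows []       = z≤n
    length-rows (r ∷ rs) = ≤-trans (s≤s (length-rows rs))
      (≤-trans (m≤n+m _ (length (encodeCells r))) (≤-reflexive (sym (List.length-++ (encodeCells r)))))

  module _ {k num den as : Str} {rs : List (List Str)}
    (k≢ : NoSemicolon k) (num≢ : All (_≢ slash) num) (den≢ : NoSemicolon den) (as≢ : NoSemicolon as)
    (good : All GoodRow rs) where

    private
      input = wordOf k num den as rs
      input₁ = num ++ slash ∷ (den ++ semicolon ∷ (as ++ semicolon ∷ encodeRows rs))
      input₂ = den ++ semicolon ∷ (as ++ semicolon ∷ encodeRows rs)
      input₃ = as ++ semicolon ∷ encodeRows rs
      es = table rs []
      ρ = constants den num k
      final : Store 7
      final = encodeTable es ∷ ρ
      M = length input
      len₁ : length input₁ ≤ M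
      len₁ = ≤-right k ≤-refl
      len₂ : length input₂ ≤ M
      len₂ = ≤-right num len₁
      len₃ : length input₃ ≤ M
      len₃ = ≤-right den len₂

    prepare-runs : Runs {suc (suc (suc (suc (suc d))))} prepare
      ([] ∷ [] ∷ [] ∷ [] ∷ [] ∷ [] ∷ input ∷ []) final (prepareCost M)
    prepare-runs =
      runs-≡ (cong (λ z → [] ∷ [] ∷ [] ∷ [] ∷ [] ∷ z ∷ input₁ ∷ []) (List.++-identityʳ k))
        (load-runs _≟ₛ_ {i = 6F} {5F} (λ ()) ([] ∷ [] ∷ [] ∷ [] ∷ [] ∷ [] ∷ input ∷ []) k input₁ k≢ refl (≤-left k ≤-refl)) »
      runs-≡ (cong (λ z → [] ∷ [] ∷ [] ∷ [] ∷ z ∷ k ∷ input₂ ∷ []) (List.++-identityʳ num))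
        (load-runs _≟ₛ_ {i = 6F} {4F} (λ ()) ([] ∷ [] ∷ [] ∷ [] ∷ [] ∷ k ∷ input₁ ∷ []) num input₂ num≢ refl (≤-left num len₁)) »
      runs-≡ (cong (λ z → [] ∷ [] ∷ [] ∷ z ∷ num ∷ k ∷ input₃ ∷ []) (List.++-identityʳ den))
        (load-runs _≟ₛ_ {i = 6F} {3F} (λ ()) ([] ∷ [] ∷ [] ∷ [] ∷ num ∷ k ∷ input₂ ∷ []) den input₃ den≢ refl (≤-left den len₂)) »
      runs-≡ (cong (λ z → z ∷ [] ∷ [] ∷ den ∷ num ∷ k ∷ encodeRows rs ∷ []) (List.++-identityʳ as))
        (load-runs _≟ₛ_ {i = 6F} {0F} (λ ()) ([] ∷ [] ∷ [] ∷ den ∷ num ∷ k ∷ input₃ ∷ []) as (encodeRows rs) as≢ refl (≤-left as len₃)) »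
      clear-runs (as ∷ [] ∷ [] ∷ den ∷ num ∷ k ∷ encodeRows rs ∷ []) (≤-left as len₃) »
      exactly push » exactly push » exactly push »
      loop-weaken (≤-trans (length-rows rs) (≤-right as len₃)) (build-runs rs [] good (≤-right as len₃))

    module _ (φ : Formula 3 6) where

      verdict : Bool
      verdict = ⟦ φ ⟧ es ρ

      answer-runs : ∀ {L} → Bounded L final →
        Runs (answer φ) final ([] ∷ [] ∷ [] ∷ [] ∷ [] ∷ [] ∷ flag verdict ∷ []) (answerCost φ L)
      answer-runs {L} B =
        in-local (code-runs {L = L} φ {suc} {0F} {final} {ρ} {es} (λ i → refl) (λ i → B (suc i)) refl (B 0F)
            (table-wellFormed good []) »
          runs-≡ (cong (λ z → [] ∷ encodeTable es ∷ 𝟚 ∷ 𝟙 ∷ den ∷ num ∷ k ∷ z ∷ []) (flag-ʳ++ verdict))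
            (transfer-runs (λ ()) (flag verdict ∷ final) (flag-length verdict))) »
        clear-runs (encodeTable es ∷ 𝟚 ∷ 𝟙 ∷ den ∷ num ∷ k ∷ flag verdict ∷ []) (B 0F) »
        clear-runs ([] ∷ 𝟚 ∷ 𝟙 ∷ den ∷ num ∷ k ∷ flag verdict ∷ []) (B 1F) »
        clear-runs ([] ∷ [] ∷ 𝟙 ∷ den ∷ num ∷ k ∷ flag verdict ∷ []) (B 2F) »
        clear-runs ([] ∷ [] ∷ [] ∷ den ∷ num ∷ k ∷ flag verdict ∷ []) (B 3F) »
        clear-runs ([] ∷ [] ∷ [] ∷ [] ∷ num ∷ k ∷ flag verdict ∷ []) (B 4F) »
        clear-runs ([] ∷ [] ∷ [] ∷ [] ∷ [] ∷ k ∷ flag verdict ∷ []) (B 5F)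
        where
        𝟚 𝟙 : Str
        𝟚 = bit 0F ∷ bit 1F ∷ []
        𝟙 = [ bit 1F ]

      decide-runs : Runs (decide φ) (input ∷ []) (flag verdict ∷ []) (decideCost φ M)
      decide-runs = in-local (in-local (in-local (in-local (in-local (in-local
        (prepared » answer-runs (λ i → ≤-trans (run-grows (trace prepared) empty i) (+-monoʳ-≤ M (bound prepared)))))))))
        where
        prepared : Runs {d = 27} prepare ([] ∷ [] ∷ [] ∷ [] ∷ [] ∷ [] ∷ input ∷ []) final (prepareCost M)
        prepared = prepare-runs
        empty : Bounded M ([] ∷ [] ∷ [] ∷ [] ∷ [] ∷ [] ∷ input ∷ [])
        empty 0F = z≤n
        empty 1F = z≤n
        empty 2F = z≤n
        empty 3F = z≤n
        empty 4F = z≤n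
        empty 5F = z≤n
        empty 6F = ≤-refl

-- Running time

module Time (U : Universe) where
  open Mining U using (InputSymbol; comma; slash)
  open Decider U
  open Sentence U
  open Stack InputSymbol
  open Machine InputSymbol
  open Routines InputSymbol
  open Comparison InputSymbol _≟ₛ_ comma

  private
    poly-loop : ∀ {f} → Polynomial f → ∀ {g} → Polynomial g → Polynomial (λ m → g m * suc (f m) + 1)
    poly-loop F G = poly-+ (poly-* G (poly-suc F)) (poly-const 1)

    poly-simple : ∀ c → Polynomial (λ m → m * c + 1)
    poly-simple c = poly-+ (poly-* poly-id (poly-const c)) (poly-const 1)

    poly-copy : Polynomial copyCost
    poly-copy = poly-+ (poly-simple 4) (poly-simple 6)

    poly-load : Polynomial (loadCost _≟ₛ_)
    poly-load = poly-+ (poly-simple 4) (poly-+ (poly-const 1) (poly-simple 4))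

    poly-compareWords : Polynomial compareWordsCost
    poly-compareWords = poly-+ poly-copy (poly-+ poly-copy (poly-+ (poly-simple 3)
      (poly-+ (poly-const 3) (poly-+ (poly-simple 2) (poly-simple 2)))))

    poly-digitStep : Polynomial (digitStepCost isOne)
    poly-digitStep = poly-+ (poly-suc poly-copy) (poly-+ (poly-suc poly-copy)
      (poly-+ (poly-+ (poly-* (poly-+ poly-id poly-id) (poly-const 6)) (poly-const 1))
        (poly-+ (poly-simple 4) (poly-const 2))))

    poly-compareProducts : Polynomial (compareProductsCost isOne)
    poly-compareProducts = poly-+ poly-copy (poly-+ poly-copy (poly-+ poly-copy
      (poly-+ (poly-loop poly-digitStep (poly-+ poly-id poly-id)) (poly-+ poly-copy (poly-+ (poly-simple 3)
        (poly-+ (poly-const 3) (poly-+ (poly-simple 2) (poly-simple 2))))))))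

    poly-cost : ∀ {h} (φ : Formula h n) → Polynomial (cost φ)
    poly-cost (i ≐ j) = poly-compareWords
    poly-cost (φ & ψ) = poly-+ (poly-cost φ) (poly-suc (poly-suc (poly-cost ψ)))
    poly-cost (~ φ)   = poly-+ (poly-cost φ) (poly-const 3)
    poly-cost (most p q φ ψ) = poly-+ poly-copy (poly-+ (poly-loop
      (poly-+ poly-load (poly-+ poly-load (poly-+ poly-load (poly-+ (poly-+ (poly-cost φ) (poly-const 4))
        (poly-+ (poly-+ (poly-cost ψ) (poly-const 4)) (poly-+ (poly-simple 2) (poly-+ (poly-simple 2) (poly-simple 2)))))))) poly-id)
      (poly-+ (poly-+ (poly-∘ poly-compareProducts (poly-+ poly-id poly-id)) (poly-const 5))
        (poly-+ (poly-simple 2) (poly-simple 2))))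

    poly-cellStep : Polynomial cellStepCost
    poly-cellStep = poly-+ poly-load (two (poly-+ poly-copy (two (poly-+ poly-copy (two (poly-+ poly-copy
      (two (poly-+ poly-copy (two (poly-+ poly-copy (poly-+ (poly-simple 2) (poly-const 2))))))))))))
      where
      two : ∀ {f} → Polynomial f → Polynomial (λ m → 2 + f m)
      two = poly-+ (poly-const 2)

    poly-build : Polynomial buildStepCost
    poly-build = poly-+ poly-load (poly-+ (poly-loop poly-cellStep poly-id) (poly-+ (poly-simple 2) (poly-simple 2)))

    poly-prepare : Polynomial prepareCost
    poly-prepare = poly-+ poly-load (poly-+ poly-load (poly-+ poly-load (poly-+ poly-load (poly-+ (poly-simple 2)
      (poly-+ (poly-const 2) (poly-+ (poly-const 2) (poly-+ (poly-const 2) (poly-loop poly-build poly-id))))))))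

    poly-answer : ∀ φ → Polynomial (answerCost φ)
    poly-answer φ = poly-+ (poly-+ (poly-cost φ) (poly-const 5))
      (poly-+ (poly-simple 2) (poly-+ (poly-simple 2) (poly-+ (poly-simple 2)
        (poly-+ (poly-simple 2) (poly-+ (poly-simple 2) (poly-simple 2))))))

    poly-decide : ∀ φ → Polynomial (decideCost φ)
    poly-decide φ = poly-+ poly-prepare (poly-∘ (poly-answer φ) (poly-+ poly-id poly-prepare))

  program-halts : (p : Prog 33 1) → ∀ {x ys t m} → Run p (x ∷ []) (ys ∷ []) t → suc t ≤ m →
                  HaltsWithin (machine {33} (core p)) m x (is-just (head ys))
  program-halts p {x} {ys} {t} {m} R t< = halts-within (core p) (≤-trans (≤-reflexive (+-comm t 1)) t<)
    (proj₂ (core-decides p R (inputTapes 33 x) (input-represents 33 x)))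

  head-flag : ∀ b → is-just (head (flag b)) ≡ b
  head-flag true  = refl
  head-flag false = refl

  decider : Formula 3 6 → TuringMachine InputSymbol
  decider φ = machine {33} (core (decide φ))

  decider-halts : ∀ φ {m k num den as rs} →
    NoSemicolon k → All (_≢ slash) num → NoSemicolon den → NoSemicolon as → All GoodRow rs →
    suc (decideCost φ (length (wordOf k num den as rs))) ≤ m →
    HaltsWithin (decider φ) m (wordOf k num den as rs) (⟦ φ ⟧ (table rs []) (constants den num k))
  decider-halts φ {m} {k} {num} {den} {as} {rs} k≢ num≢ den≢ as≢ good cost≤m =
    subst (HaltsWithin (decider φ) m (wordOf k num den as rs)) (head-flag (⟦ φ ⟧ (table rs []) (constants den num k)))
      (program-halts (decide φ) (trace R) (≤-trans (s≤s (Runs.bound R)) cost≤m))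
    where
    R : Runs (decide φ) (wordOf k num den as rs ∷ []) (flag (⟦ φ ⟧ (table rs []) (constants den num k)) ∷ [])
             (decideCost φ (length (wordOf k num den as rs)))
    R = decide-runs {k} {num} {den} {as} {rs} k≢ num≢ den≢ as≢ good φ

  decideCost-bound : ∀ φ → ∃₂ λ c e → ∀ m → suc (decideCost φ m) ≤ c * m ^ e + c
  decideCost-bound φ = poly-bound (poly-suc (poly-decide φ))

-- What the key of a cell determines

module Keys (U : Universe) where
  open Mining U using (InputSymbol; comma; null)
  open Decider U

  NoNull : Str → Set
  NoNull = All (_≢ null)

  split-unique : ∀ {a : InputSymbol} {xs xs′ ys ys′} → All (_≢ a) xs → All (_≢ a) xs′ →
                 xs ++ a ∷ ys ≡ xs′ ++ a ∷ ys′ → xs ≡ xs′ × ys ≡ ys′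
  split-unique []        []         refl = refl , refl
  split-unique []        (x≢ ∷ _)   eq   = contradiction (sym (List.∷-injectiveˡ eq)) x≢
  split-unique (x≢ ∷ _)  []         eq   = contradiction (List.∷-injectiveˡ eq) x≢
  split-unique (_ ∷ xs≢) (_ ∷ xs′≢) eq with List.∷-injectiveˡ eq | split-unique xs≢ xs′≢ (List.∷-injectiveʳ eq)
  ... | refl | refl , eq′ = refl , eq′

  encodeCells-injective : ∀ {vs ws} → All NoComma vs → All NoComma ws → encodeCells vs ≡ encodeCells ws → vs ≡ ws
  encodeCells-injective []              []              eq = refl
  encodeCells-injective []              (_∷_ {w} _ _)   eq = contradiction eq (nil≢ w)
    where
    nil≢ : ∀ xs {ys} → [] ≢ xs ++ comma ∷ ys
    nil≢ []      ()
    nil≢ (_ ∷ _) ()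
  encodeCells-injective (_∷_ {v} _ _)   []              eq = contradiction eq (≢nil v)
    where
    ≢nil : ∀ xs {ys} → xs ++ comma ∷ ys ≢ []
    ≢nil []      ()
    ≢nil (_ ∷ _) ()
  encodeCells-injective (v≢ ∷ vs≢)      (w≢ ∷ ws≢)      eq with split-unique v≢ w≢ eq
  ... | refl , eq′ = cong (_ ∷_) (encodeCells-injective vs≢ ws≢ eq′)

  encodeCells-NoNull : ∀ {vs} → All NoNull vs → NoNull (encodeCells vs)
  encodeCells-NoNull []       = []
  encodeCells-NoNull (h ∷ hs) = All.++⁺ h ((λ ()) ∷ encodeCells-NoNull hs)

  before : ∀ {m} → List Str → Vec Str m → Fin m → List Str
  before vs (v ∷ r) zero    = vs
  before vs (v ∷ r) (suc j) = before (v ∷ vs) r j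

  after : ∀ {m} → Vec Str m → Fin m → List Str
  after (v ∷ r) zero    = Vec.toList r
  after (v ∷ r) (suc j) = after r j

  column : ∀ {m} → Str → Fin m → Str
  column c zero    = c
  column c (suc j) = column (comma ∷ c) j

  key : ∀ {m} → Vec Str m → Fin m → Str
  key r j = encodeCells (before [] r j) ++ null ∷ encodeCells (after r j)

  entry : ∀ {m} → Vec Str m → Fin m → Entry
  entry r j = key r j , column [] j , lookup r j

  Clean : Str → Set
  Clean v = NoComma v × NoNull v

  Agree : ∀ {m} → Fin m → Vec Str m → Vec Str m → Set
  Agree j r s = ∀ l → l ≢ j → lookup r l ≡ lookup s l

  before-all : ∀ {m} {P : Str → Set} {vs} (r : Vec Str m) j → All P vs → (∀ l → P (lookup r l)) → All P (before vs r j)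
  before-all (v ∷ r) zero    h hr = h
  before-all (v ∷ r) (suc j) h hr = before-all r j (hr zero ∷ h) (hr ∘ suc)

  toList-all : ∀ {m} {P : Str → Set} (r : Vec Str m) → (∀ l → P (lookup r l)) → All P (Vec.toList r)
  toList-all []      hr = []
  toList-all (v ∷ r) hr = hr zero ∷ toList-all r (hr ∘ suc)

  after-all : ∀ {m} {P : Str → Set} (r : Vec Str m) j → (∀ l → P (lookup r l)) → All P (after r j)
  after-all (v ∷ r) zero    hr = toList-all r (hr ∘ suc)
  after-all (v ∷ r) (suc j) hr = after-all r j (hr ∘ suc)

  length-before : ∀ {m} vs (r : Vec Str m) j → length vs ≤ length (before vs r j)
  length-before vs (v ∷ r) zero    = ≤-refl
  length-before vs (v ∷ r) (suc j) = ≤-trans (n≤1+n _) (length-before (v ∷ vs) r j)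

  toList-lookup : ∀ {m} (r s : Vec Str m) → Vec.toList r ≡ Vec.toList s → ∀ l → lookup r l ≡ lookup s l
  toList-lookup (v ∷ r) (w ∷ s) eq zero    = List.∷-injectiveˡ eq
  toList-lookup (v ∷ r) (w ∷ s) eq (suc l) = toList-lookup r s (List.∷-injectiveʳ eq) l

  -- Of two different positions the one further left has fewer cells before it, provided that the
  -- accumulators have equal length. Their equality belongs to the conclusion because, one column
  -- further left, it says that the cells just passed are equal.
  context-injective : ∀ {m} vs ws (r s : Vec Str m) i j → length vs ≡ length ws →
    before vs r i ≡ before ws s j → after r i ≡ after s j → i ≡ j × vs ≡ ws × Agree i r s
  context-injective vs ws (v ∷ r) (w ∷ s) zero zero len eq eq′ = refl , eq , agree
    where
    agree : Agree zero (v ∷ r) (w ∷ s)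
    agree zero    0≢0 = contradiction refl 0≢0
    agree (suc l) _   = toList-lookup r s eq′ l
  context-injective vs ws (v ∷ r) (w ∷ s) zero (suc j) len eq _ =
    contradiction (≤-trans (length-before (w ∷ ws) s j) (≤-reflexive (cong length (sym eq))))
                  (<⇒≱ (s≤s (≤-reflexive len)))
  context-injective vs ws (v ∷ r) (w ∷ s) (suc i) zero len eq _ =
    contradiction (≤-trans (length-before (v ∷ vs) r i) (≤-reflexive (cong length eq)))
                  (<⇒≱ (s≤s (≤-reflexive (sym len))))
  context-injective vs ws (v ∷ r) (w ∷ s) (suc i) (suc j) len eq eq′
    with context-injective (v ∷ vs) (w ∷ ws) r s i j (cong suc len) eq eq′
  ... | refl , refl , agree = refl , refl , λ { zero _ → refl ; (suc l) l≢ → agree l (l≢ ∘ cong suc) }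

  -- Clean cells do not contain `null`, so the marker splits the key uniquely, and neither do they
  -- contain commas, so both parts can be cut into cells.
  key-injective : ∀ {m} (r s : Vec Str m) i j → (∀ l → Clean (lookup r l)) → (∀ l → Clean (lookup s l)) →
                  key r i ≡ key s j → i ≡ j × Agree i r s
  key-injective r s i j hr hs eq
    with split-unique (encodeCells-NoNull (before-all r i [] (proj₂ ∘ hr))) (encodeCells-NoNull (before-all s j [] (proj₂ ∘ hs))) eq
  ... | eq₁ , eq₂ with context-injective [] [] r s i j refl
    (encodeCells-injective (before-all r i [] (proj₁ ∘ hr)) (before-all s j [] (proj₁ ∘ hs)) eq₁)
    (encodeCells-injective (after-all r i (proj₁ ∘ hr)) (after-all s j (proj₁ ∘ hs)) eq₂)
  ... | i≡j , _ , agree = i≡j , agree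

  before-cong : ∀ {m} vs (r s : Vec Str m) j → Agree j r s → before vs r j ≡ before vs s j
  before-cong vs (v ∷ r) (w ∷ s) zero    agree = refl
  before-cong vs (v ∷ r) (w ∷ s) (suc j) agree with agree zero (λ ())
  ... | refl = before-cong (v ∷ vs) r s j (λ l l≢ → agree (suc l) (l≢ ∘ Fin.suc-injective))

  lookup-extensional : ∀ {m} (r s : Vec Str m) → (∀ l → lookup r l ≡ lookup s l) → r ≡ s
  lookup-extensional []      []      eq = refl
  lookup-extensional (v ∷ r) (w ∷ s) eq = cong₂ _∷_ (eq zero) (lookup-extensional r s (eq ∘ suc))

  after-cong : ∀ {m} (r s : Vec Str m) j → Agree j r s → after r j ≡ after s j
  after-cong (v ∷ r) (w ∷ s) zero    agree = cong Vec.toList (lookup-extensional r s λ l → agree (suc l) (λ ()))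
  after-cong (v ∷ r) (w ∷ s) (suc j) agree = after-cong r s j (λ l l≢ → agree (suc l) (l≢ ∘ Fin.suc-injective))

  key-cong : ∀ {m} (r s : Vec Str m) j → Agree j r s → key r j ≡ key s j
  key-cong r s j agree = cong₂ (λ vs ws → encodeCells vs ++ null ∷ encodeCells ws)
    (before-cong [] r s j agree) (after-cong r s j agree)

  column-injective : ∀ {m} {i j : Fin m} → column [] i ≡ column [] j → i ≡ j
  column-injective {i = i} {j} eq = Fin.toℕ-injective (trans (sym (length-column [] i)) (trans (cong length eq) (length-column [] j)))
    where
    length-column : ∀ {m} c (j : Fin m) → length (column c j) ≡ length c + toℕ j
    length-column c zero    = sym (+-identityʳ (length c))
    length-column c (suc j) = trans (length-column (comma ∷ c) j) (sym (+-suc (length c) (toℕ j)))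

  tallyFin : ∀ {m} → (Fin m → Bool) → ℕ
  tallyFin {zero}  f = 0
  tallyFin {suc m} f = increment (f zero) (tallyFin (f ∘ suc))

  tallyFin-cong : ∀ {m} {f g : Fin m → Bool} → (∀ j → f j ≡ g j) → tallyFin f ≡ tallyFin g
  tallyFin-cong {zero}  eq = refl
  tallyFin-cong {suc m} eq = cong₂ increment (eq zero) (tallyFin-cong (eq ∘ suc))

  tallyFin-false : ∀ {m} → tallyFin {m} (λ _ → false) ≡ 0
  tallyFin-false {zero}  = refl
  tallyFin-false {suc m} = tallyFin-false {m}

  tallyFin-filter : ∀ {m} {A : Set} {P : A → Set} (P? : ∀ x → Dec (P x)) (g : Fin m → A) →
                    tallyFin (does ∘ P? ∘ g) ≡ length (filter P? (List.tabulate g))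
  tallyFin-filter {zero}  P? g = refl
  tallyFin-filter {suc m} P? g with does (P? (g zero))
  ... | true  = cong suc (tallyFin-filter P? (g ∘ suc))
  ... | false = tallyFin-filter P? (g ∘ suc)

  tallyFin-single : ∀ {m} (i : Fin m) (b : Bool) → tallyFin (λ j → does (j Fin.≟ i) ∧ b) ≡ (if b then 1 else 0)
  tallyFin-single {suc m} zero true  = cong suc (tallyFin-false {m})
  tallyFin-single {suc m} zero false = tallyFin-false {m}
  tallyFin-single (suc i) b = tallyFin-single i b

  tally-rowEntries : ∀ f {m} (r : Vec Str m) c vs es →
    tally f (rowEntries (encodeCells vs) c (Vec.toList r) es) ≡
    tallyFin (λ j → f (encodeCells (before vs r j) ++ null ∷ encodeCells (after r j) , column c j , lookup r j)) + tally f es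
  tally-rowEntries f []      c vs es = refl
  tally-rowEntries f (v ∷ r) c vs es =
    trans (tally-rowEntries f r (comma ∷ c) (v ∷ vs) _)
          (tally-+ (f (encodeCells vs ++ null ∷ encodeCells (Vec.toList r) , c , v)) (tally f es) _)

  tally-table : ∀ f {m} (rs : List (Vec Str m)) es →
    tally f (table (List.map Vec.toList rs) es) ≡ sum (List.map (λ r → tallyFin (λ j → f (entry r j))) rs) + tally f es
  tally-table f []       es = refl
  tally-table f (r ∷ rs) es = begin
    tally f (table (List.map Vec.toList rs) (rowEntries [] [] (Vec.toList r) es)) ≡⟨ tally-table f rs _ ⟩
    S + tally f (rowEntries [] [] (Vec.toList r) es)   ≡⟨ cong (S +_) (tally-rowEntries f r [] [] es) ⟩
    S + (x + tally f es)                               ≡⟨ regroup S x (tally f es) ⟩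
    x + S + tally f es                                 ∎
    where
    open ≡-Reasoning
    S = sum (List.map (λ r → tallyFin (λ j → f (entry r j))) rs)
    x = tallyFin (λ j → f (entry r j))
    regroup : ∀ S x y → S + (x + y) ≡ x + S + y
    regroup = solve-∀

-- Sums over tuples and the meaning of the sentence

sum-cong : ∀ {X : Set} {g h : X → ℕ} xs → (∀ {x} → x ∈ xs → g x ≡ h x) → sum (List.map g xs) ≡ sum (List.map h xs)
sum-cong []       eq = refl
sum-cong (x ∷ xs) eq = cong₂ _+_ (eq (here refl)) (sum-cong xs (eq ∘ there))

sum-const : ∀ {X : Set} c (xs : List X) → sum (List.map (λ _ → c) xs) ≡ length xs * c
sum-const c []       = refl
sum-const c (x ∷ xs) = cong (c +_) (sum-const c xs)

sum-filter : ∀ {X : Set} {P : X → Set} (P? : ∀ x → Dec (P x)) xs →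
             sum (List.map (λ x → if does (P? x) then 1 else 0) xs) ≡ length (filter P? xs)
sum-filter P? []       = refl
sum-filter P? (x ∷ xs) with does (P? x)
... | true  = cong suc (sum-filter P? xs)
... | false = sum-filter P? xs

sum-positive : ∀ {X : Set} {g : X → ℕ} xs → sum (List.map g xs) ≢ 0 → ∃[ x ] x ∈ xs × g x ≢ 0
sum-positive []       ≢0 = contradiction refl ≢0
sum-positive {g = g} (x ∷ xs) ≢0 with g x in eq
... | suc _ = x , here refl , λ eq′ → contradiction (trans (sym eq) eq′) λ ()
... | zero  with sum-positive xs ≢0
...   | y , y∈ , gy≢0 = y , there y∈ , gy≢0

sum-zero : ∀ {X : Set} {g : X → ℕ} {x xs} → x ∈ xs → sum (List.map g xs) ≡ 0 → g x ≡ 0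
sum-zero {g = g} (here refl) eq = m+n≡0⇒m≡0 _ eq
sum-zero {g = g} {xs = y ∷ _} (there x∈) eq = sum-zero x∈ (m+n≡0⇒n≡0 (g y) eq)

does⁻ : ∀ {P : Set} (P? : Dec P) → T (does P?) → P
does⁻ (yes p) _ = p

does⁺ : ∀ {P : Set} (P? : Dec P) → P → T (does P?)
does⁺ (yes _) _ = tt
does⁺ (no ¬p) p = ¬p p

T-ext : ∀ {a b} → T a ⇔ T b → a ≡ b
T-ext {true}  {true}  e = refl
T-ext {false} {false} e = refl
T-ext {true}  {false} e = contradiction (Equivalence.to e tt) id
T-ext {false} {true}  e = contradiction (Equivalence.from e tt) id

module Meaning (U : Universe) {X : Set} {m : ℕ}
  (row : X → Vec (List (Mining.InputSymbol U)) (suc m)) (D : List X)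
  (clean : ∀ {t} → t ∈ D → ∀ l → Keys.Clean U (lookup (row t) l)) where
  open Decider U
  open Sentence U
  open Keys U
  open Mining U using (InputSymbol)
  open Stack InputSymbol using (Store)

  infix 4 _≟ʷ_

  _≟ʷ_ : DecidableEquality Str
  _≟ʷ_ = List.≡-dec _≟ₛ_

  private
    es : List Entry
    es = table (List.map Vec.toList (List.map row D)) []

    E : X → Fin (suc m) → Entry
    E t j = entry (row t) j

  cell : X → Fin (suc m) → Str
  cell t j = lookup (row t) j

  AgreeOff : Fin (suc m) → X → X → Set
  AgreeOff j t u = Agree j (row t) (row u)

  agreeOff? : ∀ j t u → Dec (AgreeOff j t u)
  agreeOff? j t u = Fin.all? λ l → ¬? (l Fin.≟ j) →-dec (cell t l ≟ʷ cell u l)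

  Varied : Fin (suc m) → Set
  Varied j = Any (λ t → Any (λ u → cell t j ≢ cell u j) D) D

  varied? : ∀ j → Dec (Varied j)
  varied? j = Any.any? (λ t → Any.any? (λ u → ¬? (cell t j ≟ʷ cell u j)) D) D

  variedColumns : List (Fin (suc m))
  variedColumns = filter varied? (allFin (suc m))

  Class : Fin (suc m) → X → List X
  Class j t = filter (λ z → agreeOff? j z t) D

  Deviating : Fin (suc m) → X → X → List X
  Deviating j t u = filter (λ z → agreeOff? j z t ×-dec ¬? (cell z j ≟ʷ cell u j)) D

  tally-es : ∀ f → tally f es ≡ sum (List.map (λ t → tallyFin (f ∘ E t)) D)
  tally-es f = trans (tally-table f (List.map row D) [])
    (trans (+-identityʳ _) (cong sum (sym (List.map-∘ D))))

  tallyFin-positive : ∀ {n} {f : Fin n → Bool} → tallyFin f ≢ 0 → ∃[ j ] T (f j)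
  tallyFin-positive {zero}  ≢0 = contradiction refl ≢0
  tallyFin-positive {suc n} {f} ≢0 with f zero in eq
  ... | true  = zero , subst T (sym eq) tt
  ... | false with tallyFin-positive ≢0
  ...   | j , fj = suc j , fj

  tallyFin-zero : ∀ {n} {f : Fin n → Bool} j → tallyFin f ≡ 0 → ¬ T (f j)
  tallyFin-zero {suc n} {f} j eq fj with f zero in eq₀
  tallyFin-zero {suc n} {f} zero    eq fj | false = subst T eq₀ fj
  tallyFin-zero {suc n} {f} (suc j) eq fj | false = tallyFin-zero j eq fj

  &-⇔ : ∀ {h n} (φ ψ : Formula h n) {ρ} → T (⟦ φ & ψ ⟧ es ρ) ⇔ (T (⟦ φ ⟧ es ρ) × T (⟦ ψ ⟧ es ρ))
  &-⇔ φ ψ {ρ} = Bool.T-∧ {⟦ φ ⟧ es ρ} {⟦ ψ ⟧ es ρ}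

  exists-⇔ : ∀ {h n o} {φ : Formula h (suc (suc (suc n)))} {ρ} → number (lookup ρ o) ≡ 1 →
    T (⟦ exists o φ ⟧ es ρ) ⇔ (∃[ t ] t ∈ D × ∃[ j ] T (⟦ φ ⟧ es (bind ρ (E t j))))
  exists-⇔ {o = o} {φ} {ρ} eq = mk⇔ to from
    where
    f : Entry → Bool
    f e = ⟦ φ ⟧ es (bind ρ e)
    none : Entry → Bool
    none (k , _ , _) = not (does (k ≟ʷ k))
    tally-none : ∀ es′ → tally none es′ ≡ 0
    tally-none []                = refl
    tally-none ((k , _ , _) ∷ es′) with k ≟ʷ k
    ... | yes _  = tally-none es′
    ... | no k≢k = contradiction refl k≢k
    value≡ : ⟦ exists o φ ⟧ es ρ ≡ not (1 * tally f es ≤ᵇ 0)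
    value≡ = cong₂ (λ a b → not (a * tally f es ≤ᵇ b)) eq
      (trans (cong (number (lookup ρ o) *_) (tally-none es)) (*-zeroʳ (number (lookup ρ o))))
    to : T (⟦ exists o φ ⟧ es ρ) → _
    to h with sum-positive D (λ z → subst (λ a → T (not (1 * a ≤ᵇ 0))) (trans (tally-es f) z) (subst T value≡ h))
    ... | t , t∈ , ≢0 with tallyFin-positive ≢0
    ...   | j , fj = t , t∈ , j , fj
    from : (∃[ t ] t ∈ D × ∃[ j ] T (f (E t j))) → T (⟦ exists o φ ⟧ es ρ)
    from (t , t∈ , j , fj) = subst T (sym value≡) (positive (tally f es) refl)
      where
      positive : ∀ a → tally f es ≡ a → T (not (1 * a ≤ᵇ 0))
      positive zero    z = contradiction fj (tallyFin-zero {f = λ i → f (E t i)} j (sum-zero {xs = D} t∈ (trans (sym (tally-es f)) z)))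
      positive (suc a) _ = tt

  module _ (den num k : Str) where

    private
      ρ : Store 6
      ρ = constants den num k

    -- The formula compares with the cell at hand, `Varied` any two tuples: of two tuples that
    -- differ in column j, one differs from t. Hence the answer is the same for all rows, and the
    -- count of varied cells is a product.
    varied-⇔ : ∀ {t j h} → t ∈ D → T (⟦ varied {h} ⟧ es (bind ρ (E t j))) ⇔ Varied j
    varied-⇔ {t} {j} {h} t∈ = mk⇔ to from
      where
      φ : Formula h 12
      φ = 1F ≐ 4F & ~ (2F ≐ 5F)
      exists⇔ = exists-⇔ {o = 4F} {φ} {bind ρ (E t j)} refl
      to : T (⟦ varied {h} ⟧ es (bind ρ (E t j))) → Varied j
      to h with Equivalence.to exists⇔ h
      ... | u , u∈ , i , fi with Equivalence.to Bool.T-∧ fi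
      ...   | col≡ , val≢ with column-injective {i = i} {j} (does⁻ (column [] i ≟ʷ column [] j) col≡)
      ...     | refl = lose t∈ (lose u∈ λ eq → does⁻ (¬? (cell u j ≟ʷ cell t j)) val≢ (sym eq))
      from : Varied j → T (⟦ varied {h} ⟧ es (bind ρ (E t j)))
      from h with find h
      ... | u , u∈ , h′ with find h′
      ...   | v , v∈ , u≢v = Equivalence.from exists⇔ pick
        where
        witness : ∀ {w} → w ∈ D → cell w j ≢ cell t j → ∃[ u ] u ∈ D × ∃[ i ] T (⟦ φ ⟧ es (bind (bind ρ (E t j)) (E u i)))
        witness {w} w∈ ≢t = w , w∈ , j , Equivalence.from Bool.T-∧
          (does⁺ (column [] j ≟ʷ column [] j) refl , does⁺ (¬? (cell w j ≟ʷ cell t j)) ≢t)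
        pick : ∃[ u ] u ∈ D × ∃[ i ] T (⟦ φ ⟧ es (bind (bind ρ (E t j)) (E u i)))
        pick with cell u j ≟ʷ cell t j
        ... | yes u≡t = witness v∈ (λ v≡t → u≢v (trans u≡t (sym v≡t)))
        ... | no u≢t  = witness u∈ u≢t

    tally-varied : ∀ {h} → tally (λ e → ⟦ varied {h} ⟧ es (bind ρ e)) es ≡ length D * length variedColumns
    tally-varied {h} = begin
      tally f es                                                ≡⟨ tally-es f ⟩
      sum (List.map (λ t → tallyFin (f ∘ E t)) D)               ≡⟨ sum-cong D (λ t∈ → tallyFin-cong λ j →
                                                                     T-ext (mk⇔ (λ x → does⁺ (varied? j) (Equivalence.to (varied-⇔ {h = h} t∈) x))
                                                                                (λ x → Equivalence.from (varied-⇔ {h = h} t∈) (does⁻ (varied? j) x)))) ⟩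
      sum (List.map (λ _ → tallyFin (does ∘ varied?)) D)        ≡⟨ sum-const _ D ⟩
      length D * tallyFin (does ∘ varied?)                      ≡⟨ cong (length D *_) (tallyFin-filter varied? id) ⟩
      length D * length variedColumns                           ∎
      where
      open ≡-Reasoning
      f : Entry → Bool
      f e = ⟦ varied {h} ⟧ es (bind ρ e)

    -- The number of columns is a successor, so a first column exists and each row contributes
    -- exactly 1.
    tally-leftmost : ∀ {h} → tally (λ e → ⟦ leftmost {h} ⟧ es (bind ρ e)) es ≡ length D * 1
    tally-leftmost {h} = begin
      tally f es                                                ≡⟨ tally-es f ⟩
      sum (List.map (λ t → tallyFin (f ∘ E t)) D)               ≡⟨ sum-cong D (λ {t} _ → trans (tallyFin-cong {suc m} first) (tallyFin-single {suc m} zero true)) ⟩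
      sum (List.map (λ _ → 1) D)                                ≡⟨ sum-const 1 D ⟩
      length D * 1                                              ∎
      where
      open ≡-Reasoning
      f : Entry → Bool
      f e = ⟦ leftmost {h} ⟧ es (bind ρ e)
      first : ∀ j → does (column [] j ≟ʷ []) ≡ does (j Fin.≟ zero) ∧ true
      first j = trans (does-⇔ (mk⇔ (column-injective {i = j} {zero}) (cong (column []))) (column [] j ≟ʷ column {suc m} [] zero) (j Fin.≟ zero))
                      (sym (Bool.∧-identityʳ _))

    Confident : Set
    Confident = ∃₂ λ t u → t ∈ D × u ∈ D × ∃[ j ] number num * length (Class j t) ≤ number den * length (Deviating j t u)

    module _ {t u : X} (t∈ : t ∈ D) (j : Fin (suc m)) where

      key-⇔ : ∀ {z} → z ∈ D → ∀ i → key (row z) i ≡ key (row t) j ⇔ (i ≡ j × AgreeOff j z t)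
      key-⇔ {z} z∈ i = mk⇔ to from
        where
        to : key (row z) i ≡ key (row t) j → i ≡ j × AgreeOff j z t
        to eq with key-injective (row z) (row t) i j (clean z∈) (clean t∈) eq
        ... | refl , agree = refl , agree
        from : i ≡ j × AgreeOff j z t → key (row z) i ≡ key (row t) j
        from (refl , agree) = key-cong (row z) (row t) i agree

      private
        σ = bind (bind ρ (E t j)) (E u j)

        -- The factor `does (i Fin.≟ j)` leaves one cell of each row, so that counting cells amounts
        -- to counting tuples with their multiplicity.
        select : ∀ f {P : X → Set} (P? : ∀ z → Dec (P z)) →
                 (∀ {z} → z ∈ D → ∀ i → f (E z i) ≡ does (i Fin.≟ j) ∧ does (P? z)) →
                 tally f es ≡ length (filter P? D)
        select f P? eq = begin
          tally f es                                          ≡⟨ tally-es f ⟩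
          sum (List.map (λ z → tallyFin (f ∘ E z)) D)         ≡⟨ sum-cong D (λ {z} z∈ → trans (tallyFin-cong (eq z∈)) (tallyFin-single j (does (P? z)))) ⟩
          sum (List.map (λ z → if does (P? z) then 1 else 0) D) ≡⟨ sum-filter P? D ⟩
          length (filter P? D)                                ∎
          where open ≡-Reasoning

      tally-class : ∀ {h} → tally (λ e → ⟦ sameKey {h} ⟧ es (bind σ e)) es ≡ length (Class j t)
      tally-class {h} = select (λ e → ⟦ sameKey {h} ⟧ es (bind σ e)) (λ z → agreeOff? j z t) λ {z} z∈ i →
        does-⇔ (key-⇔ z∈ i) (key (row z) i ≟ʷ key (row t) j) (i Fin.≟ j ×-dec agreeOff? j z t)

      tally-deviating : ∀ {h} → tally (λ e → ⟦ deviant {h} ⟧ es (bind σ e)) es ≡ length (Deviating j t u)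
      tally-deviating {h} = select (λ e → ⟦ deviant {h} ⟧ es (bind σ e))
        (λ z → agreeOff? j z t ×-dec ¬? (cell z j ≟ʷ cell u j)) λ {z} z∈ i →
        does-⇔ (deviant-⇔ z∈ i) ((key (row z) i ≟ʷ key (row t) j) ×-dec ¬? (cell z i ≟ʷ cell u j))
          (i Fin.≟ j ×-dec (agreeOff? j z t ×-dec ¬? (cell z j ≟ʷ cell u j)))
        where
        deviant-⇔ : ∀ {z} → z ∈ D → ∀ i → (key (row z) i ≡ key (row t) j × cell z i ≢ cell u j) ⇔
                                           (i ≡ j × AgreeOff j z t × cell z j ≢ cell u j)
        deviant-⇔ z∈ i = mk⇔
          (λ { (eq , ≢u) → case Equivalence.to (key-⇔ z∈ i) eq of λ { (refl , agree) → refl , agree , ≢u } })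
          (λ { (refl , agree , ≢u) → Equivalence.from (key-⇔ z∈ i) (refl , agree) , ≢u })

      most-⇔ : ∀ {h} → T (⟦ ratio {h} ⟧ es σ) ⇔
               number num * length (Class j t) ≤ number den * length (Deviating j t u)
      most-⇔ {h} = mk⇔
        (λ x → subst₂ (λ a b → number num * a ≤ number den * b) (tally-class {h}) (tally-deviating {h}) (≤ᵇ⇒≤ _ _ x))
        (λ x → ≤⇒≤ᵇ (subst₂ (λ a b → number num * a ≤ number den * b) (sym (tally-class {h})) (sym (tally-deviating {h})) x))

    private
      pair : ∀ {h t u i j} → t ∈ D → u ∈ D → i ≡ j →
             T (⟦ ratio {h} ⟧ es (bind (bind ρ (E t j)) (E u i))) → Confident
      pair {h} {t} {u} {j = j} t∈ u∈ refl x = t , u , t∈ , u∈ , j , Equivalence.to (most-⇔ t∈ j {h}) x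

    confident-⇔ : ∀ {h} → T (⟦ confident {h} ⟧ es ρ) ⇔ Confident
    confident-⇔ {h} = mk⇔ to from
      where
      outer : T (⟦ confident {h} ⟧ es ρ) ⇔ (∃[ t ] t ∈ D × ∃[ j ] T (⟦ exists 4F (sameColumn & ratio {h}) ⟧ es (bind ρ (E t j))))
      outer = exists-⇔ {o = 1F} {exists 4F (sameColumn & ratio {h})} {ρ} refl
      inner : ∀ t j → T (⟦ exists 4F (sameColumn & ratio {h}) ⟧ es (bind ρ (E t j))) ⇔
                      (∃[ u ] u ∈ D × ∃[ i ] T (⟦ sameColumn & ratio {h} ⟧ es (bind (bind ρ (E t j)) (E u i))))
      inner t j = exists-⇔ {o = 4F} {sameColumn & ratio {h}} {bind ρ (E t j)} refl
      both : ∀ t j u i → T (⟦ sameColumn & ratio {h} ⟧ es (bind (bind ρ (E t j)) (E u i))) ⇔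
             (T (⟦ sameColumn {suc h} ⟧ es (bind (bind ρ (E t j)) (E u i))) × T (⟦ ratio {h} ⟧ es (bind (bind ρ (E t j)) (E u i))))
      both t j u i = &-⇔ (sameColumn {suc h}) (ratio {h}) {bind (bind ρ (E t j)) (E u i)}
      to : T (⟦ confident {h} ⟧ es ρ) → Confident
      to x = on-outer (Equivalence.to outer x)
        where
        on-both : ∀ {t j u i} → t ∈ D → u ∈ D →
          T (⟦ sameColumn {suc h} ⟧ es (bind (bind ρ (E t j)) (E u i))) × T (⟦ ratio {h} ⟧ es (bind (bind ρ (E t j)) (E u i))) → Confident
        on-both {j = j} {i = i} t∈ u∈ (c , r) = pair {h} t∈ u∈ (column-injective {i = i} {j} (does⁻ (column [] i ≟ʷ column [] j) c)) r
        on-inner : ∀ {t j} → t ∈ D →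
          ∃[ u ] u ∈ D × ∃[ i ] T (⟦ sameColumn & ratio {h} ⟧ es (bind (bind ρ (E t j)) (E u i))) → Confident
        on-inner {t} {j} t∈ (u , u∈ , i , x) = on-both t∈ u∈ (Equivalence.to (both t j u i) x)
        on-outer : ∃[ t ] t ∈ D × ∃[ j ] T (⟦ exists 4F (sameColumn & ratio {h}) ⟧ es (bind ρ (E t j))) → Confident
        on-outer (t , t∈ , j , x) = on-inner t∈ (Equivalence.to (inner t j) x)
      from : Confident → T (⟦ confident {h} ⟧ es ρ)
      from (t , u , t∈ , u∈ , j , bound) = Equivalence.from outer (t , t∈ , j ,
        Equivalence.from (inner t j) (u , u∈ , j , Equivalence.from (both t j u j)
          (does⁺ (column [] j ≟ʷ column [] j) refl , Equivalence.from (most-⇔ t∈ j {h}) bound)))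

    Criterion : Set
    Criterion = 2 ≤ length variedColumns × number k ≤ length variedColumns × Confident

    private
      scaled : ∀ {x a J} → x ∈ D → a * (length D * 1) ≤ 1 * (length D * J) ⇔ a ≤ J
      scaled {a = a} {J} x∈ = mk⇔
        (λ h → *-cancelˡ-≤ (length D) {{nonempty x∈}} (≤-trans (≤-reflexive (regroup (length D) a)) (≤-trans h (≤-reflexive (*-identityˡ _)))))
        (λ h → ≤-trans (≤-reflexive (sym (regroup (length D) a))) (≤-trans (*-monoʳ-≤ (length D) h) (≤-reflexive (sym (*-identityˡ _)))))
        where
        regroup : ∀ n a → n * a ≡ a * (n * 1)
        regroup = solve-∀
        nonempty : ∀ {x} {xs : List X} → x ∈ xs → NonZero (length xs)
        nonempty (here _)  = _
        nonempty (there _) = _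

      most-columns : ∀ {x h} (i : Fin 6) → x ∈ D →
        T (⟦ most {d = suc h} i 1F varied leftmost ⟧ es ρ) ⇔ number (lookup ρ i) ≤ length variedColumns
      most-columns {h = h} i x∈ = mk⇔
        (λ z → Equivalence.to (scaled x∈) (subst₂ (λ a b → number (lookup ρ i) * a ≤ 1 * b)
                 (tally-leftmost {suc h}) (tally-varied {h}) (≤ᵇ⇒≤ _ _ z)))
        (λ z → ≤⇒≤ᵇ (subst₂ (λ a b → number (lookup ρ i) * a ≤ 1 * b)
                 (sym (tally-leftmost {suc h})) (sym (tally-varied {h})) (Equivalence.from (scaled x∈) z)))

    -- On an empty database both column conditions would hold as 0 ≤ 0. It is the tuple provided by
    -- `Confident` that makes `length D` positive, so that it can be cancelled in them.
    sentence-⇔ : T (⟦ sentence ⟧ es ρ) ⇔ Criterion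
    sentence-⇔ = mk⇔ to from
      where
      columnsOf : Fin 6 → Formula 3 6
      columnsOf i = most i 1F varied leftmost
      first : T (⟦ sentence ⟧ es ρ) ⇔ (T (⟦ columnsOf 0F ⟧ es ρ) × T (⟦ columnsOf 4F & confident ⟧ es ρ))
      first = &-⇔ (columnsOf 0F) (columnsOf 4F & confident) {ρ}
      second : T (⟦ columnsOf 4F & confident ⟧ es ρ) ⇔ (T (⟦ columnsOf 4F ⟧ es ρ) × T (⟦ confident {0} ⟧ es ρ))
      second = &-⇔ (columnsOf 4F) confident {ρ}
      to : T (⟦ sentence ⟧ es ρ) → Criterion
      to x = on-first (Equivalence.to first x)
        where
        on-second : T (⟦ columnsOf 0F ⟧ es ρ) → T (⟦ columnsOf 4F ⟧ es ρ) → Confident → Criterion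
        on-second x₁ x₂ c@(t , _ , t∈ , _) =
          Equivalence.to (most-columns {h = 1} 0F t∈) x₁ , Equivalence.to (most-columns {h = 1} 4F t∈) x₂ , c
        on-first : T (⟦ columnsOf 0F ⟧ es ρ) × T (⟦ columnsOf 4F & confident ⟧ es ρ) → Criterion
        on-first (x₁ , x) = let y = Equivalence.to second x in
          on-second x₁ (proj₁ y) (Equivalence.to (confident-⇔ {0}) (proj₂ y))
      from : Criterion → T (⟦ sentence ⟧ es ρ)
      from (2≤ , k≤ , c@(t , _ , t∈ , _)) = Equivalence.from first (Equivalence.from (most-columns {h = 1} 0F t∈) 2≤ ,
        Equivalence.from second (Equivalence.from (most-columns {h = 1} 4F t∈) k≤ , Equivalence.from (confident-⇔ {0}) c))

-- Injectivity of the encoding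

module Encoding (U : Universe) where
  open Universe U
  open Mining U
  open Decider U using (Str; NoComma; NoSemicolon; GoodRow; number; encodeCells; encodeRows)
  open Keys U using (NoNull; Clean; split-unique)

  word-avoids : ∀ {a} → (∀ b → bit b ≢ a) → ∀ w → All (_≢ a) (encodeWord w)
  word-avoids h []      = []
  word-avoids h (b ∷ w) = h b ∷ word-avoids h w

  integer-avoids : ∀ {a} → (∀ b → bit b ≢ a) → minus ≢ a → ∀ z → All (_≢ a) (encodeℤ z)
  integer-avoids h h′ (ℤ.+ n)    = word-avoids h (proj₁ (toDigits 2 n))
  integer-avoids h h′ -[1+ n ] = h′ ∷ word-avoids h (proj₁ (toDigits 2 (suc n)))

  value-avoids : ∀ {a} → (∀ b → bit b ≢ a) → minus ≢ a → slash ≢ a → ∀ κ v → All (_≢ a) (encodeValue κ v)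
  value-avoids h h′ h″ categorical v = word-avoids h v
  value-avoids h h′ h″ numeric     q = All.++⁺ (integer-avoids h h′ (↥ q)) (h″ ∷ word-avoids h (proj₁ (toDigits 2 (↧ₙ q))))

  cell-avoids : ∀ {a} → (∀ b → bit b ≢ a) → minus ≢ a → slash ≢ a → null ≢ a →
                ∀ {A} (c : Cell A) → All (_≢ a) (encodeCell c)
  cell-avoids h h′ h″ h‴ nothing          = h‴ ∷ []
  cell-avoids h h′ h″ h‴ {A} (just (v , _)) = value-avoids h h′ h″ (kind A) v

  encodeWord-injective : ∀ {v w} → encodeWord v ≡ encodeWord w → v ≡ w
  encodeWord-injective = List.map-injective λ { refl → refl }

  encodeℕ-injective : ∀ {m n} → encodeℕ m ≡ encodeℕ n → m ≡ n
  encodeℕ-injective {m} {n} eq = trans (sym (proj₂ (toDigits 2 m)))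
    (trans (cong (fromDigits {2}) (encodeWord-injective eq)) (proj₂ (toDigits 2 n)))

  word≢minus : ∀ w {xs} → encodeWord w ≢ minus ∷ xs
  word≢minus []      ()
  word≢minus (_ ∷ _) ()

  encodeℤ-injective : ∀ {y z} → encodeℤ y ≡ encodeℤ z → y ≡ z
  encodeℤ-injective {ℤ.+ m}      {ℤ.+ n}      eq = cong ℤ.+_ (encodeℕ-injective eq)
  encodeℤ-injective {ℤ.+ m}      { -[1+ n ]} eq = contradiction eq (word≢minus (proj₁ (toDigits 2 m)))
  encodeℤ-injective { -[1+ m ]} {ℤ.+ n}      eq = contradiction (sym eq) (word≢minus (proj₁ (toDigits 2 n)))
  encodeℤ-injective { -[1+ m ]} { -[1+ n ]} eq = cong -[1+_] (suc-injective (encodeℕ-injective (List.∷-injectiveʳ eq)))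

  encodeValue-injective : ∀ κ {v w} → encodeValue κ v ≡ encodeValue κ w → v ≡ w
  encodeValue-injective categorical eq = encodeWord-injective eq
  encodeValue-injective numeric {p@(mkℚ _ _ _)} {q@(mkℚ _ _ _)} eq
    with split-unique (integer-avoids (λ _ ()) (λ ()) (↥ p)) (integer-avoids (λ _ ()) (λ ()) (↥ q)) eq
  ... | eq₁ , eq₂ = ℚ.mkℚ-cong (encodeℤ-injective eq₁) (suc-injective (encodeℕ-injective eq₂))

  valueOf : ∀ {A} → Cell A → Maybe (Value (kind A))
  valueOf = Maybe.map proj₁

  value≢null : ∀ κ v → encodeValue κ v ≢ [ null ]
  value≢null κ v eq = All.head (subst NoNull eq (value-avoids (λ _ ()) (λ ()) (λ ()) κ v)) refl

  -- Only the values can be recovered: the code contains no proof of membership in the domain, and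
  -- one value may have several such proofs.
  encodeCell-injective : ∀ {A} (c d : Cell A) → encodeCell c ≡ encodeCell d → valueOf c ≡ valueOf d
  encodeCell-injective nothing        nothing        eq = refl
  encodeCell-injective {A} nothing    (just (w , _)) eq = contradiction (sym eq) (value≢null (kind A) w)
  encodeCell-injective {A} (just (v , _)) nothing    eq = contradiction eq (value≢null (kind A) v)
  encodeCell-injective {A} (just (v , _)) (just (w , _)) eq = cong just (encodeValue-injective (kind A) eq)

  number-encodeℕ : ∀ n → number (encodeℕ n) ≡ n
  number-encodeℕ n = trans (number-word (proj₁ (toDigits 2 n))) (proj₂ (toDigits 2 n))
    where
    number-word : ∀ ds → number (encodeWord ds) ≡ fromDigits ds
    number-word []        = refl
    number-word (0F ∷ ds) = trans (cong (2 *_) (number-word ds)) (*-comm 2 (fromDigits ds))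
    number-word (1F ∷ ds) = cong suc (trans (cong (2 *_) (number-word ds)) (*-comm 2 (fromDigits ds)))

  row : ∀ {I} → Tuple I → Vec Str (length I)
  row []      = []
  row (c ∷ t) = encodeCell c ∷ row t

  lookup-row : ∀ {I A} (t : Tuple I) (A∈ : A ∈ I) → lookup (row t) (Any.index A∈) ≡ encodeCell (All.lookup t A∈)
  lookup-row (c ∷ t) (here refl) = refl
  lookup-row (c ∷ t) (there A∈)  = lookup-row t A∈

  good-row : ∀ {I} (t : Tuple I) → GoodRow (Vec.toList (row t))
  good-row []      = []
  good-row (c ∷ t) = (cell-avoids (λ _ ()) (λ ()) (λ ()) (λ ()) c , cell-avoids (λ _ ()) (λ ()) (λ ()) (λ ()) c) ∷ good-row t

  Full : ∀ {I} → Tuple I → Set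
  Full {I} t = ∣ t ∣ₜ ≡ length I

  ∣∣ₜ-≤ : ∀ {I} (t : Tuple I) → ∣ t ∣ₜ ≤ length I
  ∣∣ₜ-≤ []            = z≤n
  ∣∣ₜ-≤ (nothing ∷ t) = m≤n⇒m≤1+n (∣∣ₜ-≤ t)
  ∣∣ₜ-≤ (just _ ∷ t)  = s≤s (∣∣ₜ-≤ t)

  full-lookup : ∀ {I A} (t : Tuple I) → Full t → (A∈ : A ∈ I) → ∃[ v ] All.lookup t A∈ ≡ just v
  full-lookup (nothing ∷ t) full A∈ = contradiction (≤-reflexive (sym full)) (<⇒≱ (s≤s (∣∣ₜ-≤ t)))
  full-lookup (just v ∷ t)  full (here refl) = v , refl
  full-lookup (just v ∷ t)  full (there A∈)  = full-lookup t (suc-injective full) A∈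

  full-clean : ∀ {I} (t : Tuple I) → Full t → ∀ l → Clean (lookup (row t) l)
  full-clean (nothing ∷ t) full l = contradiction (≤-reflexive (sym full)) (<⇒≱ (s≤s (∣∣ₜ-≤ t)))
  full-clean {A ∷ I} (just (v , _) ∷ t) full zero =
    value-avoids (λ _ ()) (λ ()) (λ ()) (kind A) v , value-avoids (λ _ ()) (λ ()) (λ ()) (kind A) v
  full-clean (just v ∷ t)  full (suc l) = full-clean t (suc-injective full) l

  encodeTuple≡ : ∀ {I} (t : Tuple I) xs → encodeTuple t ++ xs ≡ encodeCells (Vec.toList (row t)) ++ semicolon ∷ xs
  encodeTuple≡ []      xs = refl
  encodeTuple≡ (c ∷ t) xs = begin
    (encodeCell c ++ comma ∷ encodeTuple t) ++ xs      ≡⟨ List.++-assoc (encodeCell c) _ xs ⟩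
    encodeCell c ++ comma ∷ (encodeTuple t ++ xs)      ≡⟨ cong (λ ys → encodeCell c ++ comma ∷ ys) (encodeTuple≡ t xs) ⟩
    encodeCell c ++ comma ∷ (encodeCells (Vec.toList (row t)) ++ semicolon ∷ xs) ≡⟨ List.++-assoc (encodeCell c) _ _ ⟨
    (encodeCell c ++ comma ∷ encodeCells (Vec.toList (row t))) ++ semicolon ∷ xs ∎
    where open ≡-Reasoning

  rowsOf : ∀ {I} → Database I → List (List Str)
  rowsOf T = List.map Vec.toList (List.map row T)

  encodeDatabase≡ : ∀ {I} (T : Database I) → concatMap encodeTuple T ≡ encodeRows (rowsOf T)
  encodeDatabase≡ []      = refl
  encodeDatabase≡ (t ∷ T) = trans (cong (encodeTuple t ++_) (encodeDatabase≡ T)) (encodeTuple≡ t _)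

  good-rows : ∀ {I} (T : Database I) → All GoodRow (rowsOf T)
  good-rows []      = []
  good-rows (t ∷ T) = good-row t ∷ good-rows T

  attributeWord : List Identifier → Str
  attributeWord []      = []
  attributeWord (A ∷ I) = encodeWord A ++ comma ∷ attributeWord I

  encodeAttributes≡ : ∀ I xs → encodeAttributes I ++ xs ≡ attributeWord I ++ semicolon ∷ xs
  encodeAttributes≡ []      xs = refl
  encodeAttributes≡ (A ∷ I) xs = begin
    (encodeWord A ++ comma ∷ encodeAttributes I) ++ xs  ≡⟨ List.++-assoc (encodeWord A) _ xs ⟩
    encodeWord A ++ comma ∷ (encodeAttributes I ++ xs)  ≡⟨ cong (λ ys → encodeWord A ++ comma ∷ ys) (encodeAttributes≡ I xs) ⟩
    encodeWord A ++ comma ∷ (attributeWord I ++ semicolon ∷ xs) ≡⟨ List.++-assoc (encodeWord A) _ _ ⟨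
    (encodeWord A ++ comma ∷ attributeWord I) ++ semicolon ∷ xs ∎
    where open ≡-Reasoning

  attributeWord-NoSemicolon : ∀ I → NoSemicolon (attributeWord I)
  attributeWord-NoSemicolon []      = []
  attributeWord-NoSemicolon (A ∷ I) = All.++⁺ (word-avoids (λ _ ()) A) ((λ ()) ∷ attributeWord-NoSemicolon I)

  encodeInput≡ : ∀ x → let open Input x renaming (T to D) in
    encodeInput x ≡ Sentence.wordOf U (encodeℕ k) (encodeℤ (↥ s)) (encodeℕ (↧ₙ s)) (attributeWord I) (rowsOf D)
  encodeInput≡ x = cong (λ ys → encodeℕ k ++ semicolon ∷ ys)
    (trans (List.++-assoc (encodeℤ (↥ s)) _ _)
      (cong (λ ys → encodeℤ (↥ s) ++ slash ∷ (encodeℕ (↧ₙ s) ++ semicolon ∷ ys))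
        (trans (cong (encodeAttributes I ++_) (encodeDatabase≡ D)) (encodeAttributes≡ I _))))
    where open Input x renaming (T to D)

  -- ratio a 0 = 0ℚ, which is excluded by 0ℚ < s.

  ratio-⇔ : ∀ {s p} → ↥ s ≡ ℤ.+ p → ∀ a n → s ℚ.≤ ratio a (suc n) ⇔ p * suc n ≤ ↧ₙ s * a
  ratio-⇔ {s@(mkℚ _ q-1 _)} {p} refl a n = mk⇔ to from
    where
    r = mkℚᵘ (ℤ.+ a) n
    to : s ℚ.≤ ratio a (suc n) → p * suc n ≤ suc q-1 * a
    to h with ℚᵘ.≤-respʳ-≃ (ℚ.toℚᵘ-fromℚᵘ r) (ℚ.toℚᵘ-mono-≤ h)
    ... | *≤* le = ≤-trans (ℤ.drop‿+≤+ (subst₂ ℤ._≤_ (sym (ℤ.pos-* p (suc n))) (sym (ℤ.pos-* a (suc q-1))) le))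
                           (≤-reflexive (*-comm a (suc q-1)))
    from : p * suc n ≤ suc q-1 * a → s ℚ.≤ ratio a (suc n)
    from h = ℚ.toℚᵘ-cancel-≤ (ℚᵘ.≤-respʳ-≃ (ℚᵘ.≃-sym (ℚ.toℚᵘ-fromℚᵘ r))
      (*≤* (subst₂ ℤ._≤_ (ℤ.pos-* p (suc n)) (ℤ.pos-* a (suc q-1)) (ℤ.+≤+ (≤-trans h (≤-reflexive (*-comm (suc q-1) a)))))))

-- Averaging over the classes of an equivalence relation

module Counting {X : Set} where

  infix 9 #_

  #_ : {P : X → Set} → (∀ x → Dec (P x)) → List X → ℕ
  (# P?) xs = length (filter P? xs)

  #-mono : {P Q : X → Set} (P? : ∀ x → Dec (P x)) (Q? : ∀ x → Dec (Q x)) → ∀ xs →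
           (∀ {x} → x ∈ xs → P x → Q x) → (# P?) xs ≤ (# Q?) xs
  #-mono P? Q? []       h = z≤n
  #-mono P? Q? (x ∷ xs) h with P? x | Q? x
  ... | yes _ | yes _ = s≤s (#-mono P? Q? xs (h ∘ there))
  ... | yes p | no ¬q = contradiction (h (here refl) p) ¬q
  ... | no _  | yes _ = m≤n⇒m≤1+n (#-mono P? Q? xs (h ∘ there))
  ... | no _  | no _  = #-mono P? Q? xs (h ∘ there)

  #-filter : {P Q : X → Set} (P? : ∀ x → Dec (P x)) (Q? : ∀ x → Dec (Q x)) → ∀ xs →
             (# P?) (filter Q? xs) ≡ (# (λ x → Q? x ×-dec P? x)) xs
  #-filter P? Q? []       = refl
  #-filter P? Q? (x ∷ xs) with Q? x
  ... | no _  = #-filter P? Q? xs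
  ... | yes _ with P? x
  ...   | yes _ = cong suc (#-filter P? Q? xs)
  ...   | no _  = #-filter P? Q? xs

  #-split : {P Q : X → Set} (P? : ∀ x → Dec (P x)) (Q? : ∀ x → Dec (Q x)) → ∀ xs →
            (# P?) xs ≡ (# P?) (filter Q? xs) + (# P?) (filter (¬? ∘ Q?) xs)
  #-split P? Q? []       = refl
  #-split P? Q? (x ∷ xs) with P? x in eq | Q? x
  ... | yes _ | yes _ rewrite eq = cong suc (#-split P? Q? xs)
  ... | yes _ | no _  rewrite eq = trans (cong suc (#-split P? Q? xs)) (sym (+-suc _ _))
  ... | no _  | yes _ rewrite eq = #-split P? Q? xs
  ... | no _  | no _  rewrite eq = #-split P? Q? xs

  -- If P holds on average in xs at the rate p / q, then it does so in one of
  -- the classes of the equivalence relation _∼_: otherwise remove a class and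
  -- go on with the rest.

  module Average (p q : ℕ) {_∼_ : X → X → Set} (_∼?_ : ∀ x y → Dec (x ∼ y))
    (∼-sym : ∀ {x y} → x ∼ y → y ∼ x) (∼-trans : ∀ {x y z} → x ∼ y → y ∼ z → x ∼ z)
    {P : X → Set} (P? : ∀ x → Dec (P x)) where

    Dense : List X → X → Set
    Dense xs x = p * (# (_∼? x)) xs ≤ q * (# (λ z → (z ∼? x) ×-dec P? z)) xs

    dense-class : (∀ {x} → x ∼ x) → ∀ xs → 0 < length xs → p * length xs ≤ q * (# P?) xs → ∃[ x ] x ∈ xs × Dense xs x
    dense-class ∼-refl xs = go xs (<-wellFounded (length xs))
      where
      go : ∀ xs → Acc _<_ (length xs) → 0 < length xs → p * length xs ≤ q * (# P?) xs → ∃[ x ] x ∈ xs × Dense xs x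
      go xs@(x ∷ xs′) (acc rec) _ h with p * (# (_∼? x)) xs ≤? q * (# (λ z → (z ∼? x) ×-dec P? z)) xs
      ... | yes dense = x , here refl , dense
      ... | no sparse = found
        where
        rest = filter (λ z → ¬? (z ∼? x)) xs
        total : length xs ≡ (# (_∼? x)) xs + length rest
        total = trans (cong length (sym (List.filter-all (λ _ → yes tt) (All.universal (λ _ → tt) xs))))
          (trans (#-split (λ _ → yes tt) (_∼? x) xs)
            (cong₂ (λ ys zs → length ys + length zs)
              (List.filter-all (λ _ → yes tt) (All.universal (λ _ → tt) (filter (_∼? x) xs)))
              (List.filter-all (λ _ → yes tt) (All.universal (λ _ → tt) rest))))
        rest-dense : p * length rest < q * (# P?) rest
        rest-dense = +-cancelˡ-< (p * (# (_∼? x)) xs) _ _ (begin-strict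
          p * (# (_∼? x)) xs + p * length rest    ≡⟨ *-distribˡ-+ p ((# (_∼? x)) xs) (length rest) ⟨
          p * ((# (_∼? x)) xs + length rest)      ≡⟨ cong (p *_) total ⟨
          p * length xs                           ≤⟨ h ⟩
          q * (# P?) xs                           ≡⟨ cong (q *_) (trans (#-split P? (_∼? x) xs) (cong (_+ (# P?) rest) (#-filter P? (_∼? x) xs))) ⟩
          q * ((# (λ z → (z ∼? x) ×-dec P? z)) xs + (# P?) rest) ≡⟨ *-distribˡ-+ q ((# (λ z → (z ∼? x) ×-dec P? z)) xs) ((# P?) rest) ⟩
          q * (# (λ z → (z ∼? x) ×-dec P? z)) xs + q * (# P?) rest <⟨ +-monoˡ-< (q * (# P?) rest) (≰⇒> sparse) ⟩
          p * (# (_∼? x)) xs + q * (# P?) rest    ∎)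
          where open ≤-Reasoning
        -- The removed class is strictly below the rate, so the rest is strictly above it; were it
        -- empty, this would read 0 < 0.
        rest-nonempty : 0 < length rest
        rest-nonempty with rest | rest-dense
        ... | []    | lt = contradiction (≤-reflexive (*-zeroʳ q)) (<⇒≱ (≤-<-trans z≤n lt))
        ... | _ ∷ _ | _  = s≤s z≤n
        rest-smaller : length rest < length xs
        rest-smaller = List.filter-notAll (λ z → ¬? (z ∼? x)) xs (here (λ ≁ → ≁ ∼-refl))
        found : ∃[ y ] y ∈ xs × Dense xs y
        found with go rest (rec rest-smaller) rest-nonempty (<⇒≤ rest-dense)
        ... | y , y∈ , dense = y , proj₁ y∈′ , ≤-trans (*-monoʳ-≤ p class-≤) (≤-trans dense (*-monoʳ-≤ q dev-≤))
          where
          y∈′ : y ∈ xs × ¬ (y ∼ x)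
          y∈′ = ∈-filter⁻ (λ z → ¬? (z ∼? x)) y∈
          -- Removing the class of x takes nothing from the class of y: a common element would make
          -- y equivalent to x.
          class-≤ : (# (_∼? y)) xs ≤ (# (_∼? y)) rest
          class-≤ = ≤-trans
            (#-mono (_∼? y) (λ z → ¬? (z ∼? x) ×-dec (z ∼? y)) xs
              (λ _ z∼y → (λ z∼x → proj₂ y∈′ (∼-trans (∼-sym z∼y) z∼x)) , z∼y))
            (≤-reflexive (sym (#-filter (_∼? y) (λ z → ¬? (z ∼? x)) xs)))
          dev-≤ : (# (λ z → (z ∼? y) ×-dec P? z)) rest ≤ (# (λ z → (z ∼? y) ×-dec P? z)) xs
          dev-≤ = ≤-trans (≤-reflexive (#-filter (λ z → (z ∼? y) ×-dec P? z) (λ z → ¬? (z ∼? x)) xs))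
            (#-mono (λ z → ¬? (z ∼? x) ×-dec ((z ∼? y) ×-dec P? z)) (λ z → (z ∼? y) ×-dec P? z) xs (λ _ → proj₂))

unique-length : ∀ {n} {xs ys : List (Fin n)} → Unique xs → (∀ {x} → x ∈ xs → x ∈ ys) → length xs ≤ length ys
unique-length [] sub = z≤n
unique-length {xs = x ∷ xs} {ys} (x∉ ∷ xs!) sub = ≤-trans
  (s≤s (unique-length xs! λ {y} y∈ → ∈-filter⁺ other? (sub (there y∈)) (λ y≡x → All.lookup x∉ y∈ (sym y≡x))))
  (List.filter-notAll other? ys (Any.map (λ x≡y y≢x → y≢x (sym x≡y)) (sub (here refl))))
  where
  other? : ∀ y → Dec (y ≢ x)
  other? y = ¬? (y Fin.≟ x)

member-of : ∀ {X : Set} {xs : List X} → 0 < length xs → ∃[ x ] x ∈ xs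
member-of {xs = x ∷ _} _ = x , here refl

-- The criterion and the existence of a rule

module Rules (U : Universe) (A₀ : Identifier) (I₀ : List Identifier) (I-unique : Unique (A₀ ∷ I₀))
  (D : Mining.Database U (A₀ ∷ I₀)) (full : Mining.WithoutNulls U D) where
  open Universe U
  open Mining U hiding (head; body)
  open Decider U using (Str; number)
  open Encoding U
  open Counting

  private
    I : List Identifier
    I = A₀ ∷ I₀

    clean : ∀ {t} → t ∈ D → ∀ l → Keys.Clean U (lookup (row t) l)
    clean {t} t∈ = full-clean t (All.lookup full t∈)

  open Meaning U row D clean

  position : AtomicOn I → Fin (length I)
  position a = Any.index (member a)

  attribute-position : ∀ a → attribute a ≡ List.lookup I (position a)
  attribute-position a = Any.lookup-index (member a)

  positions-attribute : ∀ {a b} → position a ≡ position b → attribute a ≡ attribute b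
  positions-attribute {a} {b} eq = trans (attribute-position a) (trans (cong (List.lookup I) eq) (sym (attribute-position b)))

  any-value : ∀ {A} {P : Value (kind A) → Set} (c d : Cell A) → valueOf c ≡ valueOf d →
              MaybeAny.Any (P ∘ proj₁) c → MaybeAny.Any (P ∘ proj₁) d
  any-value (just _) (just _) refl (MaybeAny.just p) = MaybeAny.just p

  -- The code of a cell determines its value, and satisfaction depends on the value alone. Through
  -- this, equality of table entries controls arbitrary conditions, intervals included.
  ⊨-cong : ∀ a (t u : Tuple I) → cell t (position a) ≡ cell u (position a) → t ⊨ a → u ⊨ a
  ⊨-cong a t u eq = any-value (All.lookup t (member a)) (All.lookup u (member a))
    (encodeCell-injective (All.lookup t (member a)) (All.lookup u (member a)) (trans (sym (lookup-row t (member a))) (trans eq (lookup-row u (member a)))))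

  agree-refl : ∀ {j t} → AgreeOff j t t
  agree-refl l _ = refl

  agree-sym : ∀ {j t u} → AgreeOff j t u → AgreeOff j u t
  agree-sym h l l≢ = sym (h l l≢)

  agree-trans : ∀ {j t u v} → AgreeOff j t u → AgreeOff j u v → AgreeOff j t v
  agree-trans h h′ l l≢ = trans (h l l≢) (h′ l l≢)

  satisfies? : (as : List (AtomicOn I)) (t : Tuple I) → Dec (All (t ⊨_) as)
  satisfies? as t = All.all? (t ⊨?_) as

  differ-varied : ∀ {j t u} → t ∈ D → u ∈ D → cell t j ≢ cell u j → j ∈ variedColumns
  differ-varied {j} t∈ u∈ ≢ = ∈-filter⁺ varied? (∈-allFin j) (lose t∈ (lose u∈ ≢))

  module Soundness {s : ℚ} {p : ℕ} (↥s≡p : ↥ s ≡ ℤ.+ p) (0<s : 0ℚ ℚ.< s) (0<p : 0 < p) {kS numS denS : Str}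
    (num≡ : number numS ≡ p) (den≡ : number denS ≡ ↧ₙ s)
    (R : Rule I) (nontrivial : ¬ Trivial R D) (k≤ : number kS ≤ ruleSize R) (s≤ : s ℚ.≤ cnf R D) where

    private
      B H C : List (AtomicOn I)
      B = atoms (Rule.body R)
      H = atoms (Rule.head R)
      C = conjunction R

      ratio-bound : ∀ a n → s ℚ.≤ ratio a n → 0 < n × p * n ≤ ↧ₙ s * a
      ratio-bound a zero    h = contradiction (ℚ.<-≤-trans 0<s h) (ℚ.<-irrefl refl)
      ratio-bound a (suc n) h = s≤s z≤n , Equivalence.to (ratio-⇔ {s} ↥s≡p a n) h

      0<body : 0 < length (select B D)
      0<body = proj₁ (ratio-bound (length (select C D)) (length (select B D)) s≤)

      bound : p * length (select B D) ≤ ↧ₙ s * length (select C D)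
      bound = proj₂ (ratio-bound (length (select C D)) (length (select B D)) s≤)

      positive-factor : ∀ q a → 0 < q * a → 0 < a
      positive-factor q zero    lt = contradiction (≤-reflexive (*-zeroʳ q)) (<⇒≱ lt)
      positive-factor q (suc a) lt = s≤s z≤n

      supported : ∃[ t ] t ∈ select C D
      supported = member-of (positive-factor (↧ₙ s) _ (<-≤-trans (*-mono-≤ 0<p 0<body) bound))

      supported∈ : proj₁ supported ∈ D × All (proj₁ supported ⊨_) C
      supported∈ = ∈-filter⁻ (satisfies? C) {xs = D} (proj₂ supported)

      failing : ∀ {a} → a ∈ C → ∃[ t ] t ∈ D × ¬ t ⊨ a
      failing {a} a∈ with All.all? (_⊨? a) D
      ... | yes all = contradiction (lose a∈ (↭-reflexive (List.filter-all (satisfies? [ a ]) (All.map (_∷ []) all)))) nontrivial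
      ... | no ¬all with find (All.¬All⇒Any¬ (_⊨? a) D ¬all)
      ...   | t , t∈ , fails = t , t∈ , fails

      -- As s and the number of tuples satisfying the body are positive, some tuple satisfies the
      -- whole rule, in particular `a`; as the rule is not trivial, another tuple refutes `a`. The
      -- two must differ at its attribute.
      varied-atom : ∀ {a} → a ∈ C → position a ∈ variedColumns
      varied-atom {a} a∈ with failing a∈
      ... | t , t∈ , fails = differ-varied (proj₁ supported∈) t∈
        λ eq → fails (⊨-cong a (proj₁ supported) t eq (All.lookup (proj₂ supported∈) a∈))

      attributes-unique : Unique (List.map attribute C)
      attributes-unique = subst Unique (sym (List.map-++ attribute B H))
        (Unique.++⁺ (distinct (Rule.body R)) (distinct (Rule.head R)) (disjoint R))

      positions-unique : Unique (List.map position C)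
      positions-unique = AllPairs.map⁺ (AllPairs.map (λ {a} {b} ≢ eq → ≢ (positions-attribute {a} {b} eq)) (AllPairs.map⁻ attributes-unique))

      size≤ : ruleSize R ≤ length variedColumns
      size≤ = ≤-trans (≤-reflexive (trans (sym (List.length-++ B)) (sym (List.length-map position C))))
        (unique-length positions-unique λ l∈ → case ∈-map⁻ position l∈ of λ { (a , a∈ , refl) → varied-atom a∈ })

      nonempty-size : (c : Condition I) → [] ⊂ attributes c → 0 < size c
      nonempty-size c (_ , ⊈) with atoms c
      ... | []    = ⊥-elim (⊈ id)
      ... | _ ∷ _ = s≤s z≤n

      head-atom : ∃[ h ] h ∈ H
      head-atom = member-of (nonempty-size (Rule.head R) (head-nonempty R))

      h = proj₁ head-atom
      h∈C : h ∈ C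
      h∈C = Any.++⁺ʳ B (proj₂ head-atom)
      j = position h
      u = proj₁ (failing h∈C)
      u∈ = proj₁ (proj₂ (failing h∈C))
      u⊭h = proj₂ (proj₂ (failing h∈C))

      other? : ∀ z → Dec (cell z j ≢ cell u j)
      other? z = ¬? (cell z j ≟ʷ cell u j)

      open Average p (↧ₙ s) (agreeOff? j) (λ {x} {y} → agree-sym {j} {x} {y}) (λ {x} {y} {z} → agree-trans {j} {x} {y} {z}) other?

      -- The remaining head conditions are dropped: a tuple satisfying the rule satisfies the body
      -- and, since `u` refutes `h`, has another value than `u` in column `j`.
      dense : p * length (select B D) ≤ ↧ₙ s * (# other?) (select B D)
      dense = ≤-trans bound (*-monoʳ-≤ (↧ₙ s) (≤-trans
        (#-mono (satisfies? C) (λ z → satisfies? B z ×-dec other? z) D λ {z} _ sat →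
          All.++⁻ˡ B sat , λ eq → u⊭h (⊨-cong h z u eq (All.lookup sat h∈C)))
        (≤-reflexive (sym (#-filter other? (satisfies? B) D)))))

      class : ∃[ t ] t ∈ select B D × Dense (select B D) t
      class = dense-class (λ {x} → agree-refl {j} {x}) (select B D) 0<body dense

      t = proj₁ class
      t∈ : t ∈ D × All (t ⊨_) B
      t∈ = ∈-filter⁻ (satisfies? B) {xs = D} (proj₁ (proj₂ class))

      -- Body and head are disjoint, so no body condition concerns the attribute of `h`. Therefore
      -- the class of `t` in the whole database consists of tuples that satisfy the body, and the
      -- rate found among these is the rate in `D`.
      body-agrees : ∀ z → AgreeOff j z t → All (z ⊨_) B
      body-agrees z agree = All.tabulate λ {b} b∈ → ⊨-cong b t z
        (sym (agree (position b) λ eq → disjoint R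
          (subst (_∈ attributes (Rule.body R)) (positions-attribute {b} {h} eq) (∈-map⁺ attribute b∈) ,
           ∈-map⁺ attribute (proj₂ head-atom))))
        (All.lookup (proj₂ t∈) b∈)

      confidence : p * length (Class j t) ≤ ↧ₙ s * length (Deviating j t u)
      confidence = begin
        p * length (Class j t)                   ≤⟨ *-monoʳ-≤ p (#-mono (λ z → agreeOff? j z t) (λ z → satisfies? B z ×-dec agreeOff? j z t) D
                                                      (λ {z} _ agree → body-agrees z agree , agree)) ⟩
        p * (# (λ z → satisfies? B z ×-dec agreeOff? j z t)) D ≡⟨ cong (p *_) (#-filter (λ z → agreeOff? j z t) (satisfies? B) D) ⟨
        p * (# (λ z → agreeOff? j z t)) (select B D) ≤⟨ proj₂ (proj₂ class) ⟩
        ↧ₙ s * (# (λ z → agreeOff? j z t ×-dec other? z)) (select B D) ≡⟨ cong (↧ₙ s *_) (#-filter (λ z → agreeOff? j z t ×-dec other? z) (satisfies? B) D) ⟩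
        ↧ₙ s * (# (λ z → satisfies? B z ×-dec (agreeOff? j z t ×-dec other? z))) D
          ≤⟨ *-monoʳ-≤ (↧ₙ s) (#-mono (λ z → satisfies? B z ×-dec (agreeOff? j z t ×-dec other? z)) (λ z → agreeOff? j z t ×-dec other? z) D (λ _ → proj₂)) ⟩
        ↧ₙ s * length (Deviating j t u)          ∎
        where open ≤-Reasoning

    sound : Criterion denS numS kS
    sound = ≤-trans (+-mono-≤ (nonempty-size (Rule.body R) (body-nonempty R)) (nonempty-size (Rule.head R) (head-nonempty R))) size≤ ,
      ≤-trans k≤ size≤ ,
      t , u , proj₁ t∈ , u∈ , j ,
      subst₂ (λ a b → a * length (Class j t) ≤ b * length (Deviating j t u)) (sym num≡) (sym den≡) confidence

  lookup-injective : ∀ {X : Set} {xs : List X} → Unique xs → ∀ i l → List.lookup xs i ≡ List.lookup xs l → i ≡ l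
  lookup-injective (_ ∷ _)   zero    zero    eq = refl
  lookup-injective (x∉ ∷ _)  zero    (suc l) eq = contradiction eq (All.lookup x∉ (∈-lookup l))
  lookup-injective (x∉ ∷ _)  (suc i) zero    eq = contradiction (sym eq) (All.lookup x∉ (∈-lookup i))
  lookup-injective (_ ∷ xs!) (suc i) (suc l) eq = cong suc (lookup-injective xs! i l eq)

  index-∈-lookup : ∀ {X : Set} (xs : List X) l → Any.index (∈-lookup {xs = xs} l) ≡ l
  index-∈-lookup (x ∷ xs) zero    = refl
  index-∈-lookup (x ∷ xs) (suc l) = cong suc (index-∈-lookup xs l)

  cell-lookup : ∀ (t : Tuple I) l → encodeCell (All.lookup t (∈-lookup {xs = I} l)) ≡ cell t l
  cell-lookup t l = trans (sym (lookup-row t (∈-lookup {xs = I} l))) (cong (cell t) (index-∈-lookup I l))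

  equalAtom differAtom : ∀ κ {E : Value κ → Set} v → E v → Atomic κ E
  equalAtom categorical v e = equal v e
  equalAtom numeric     v _ = inside v v ℚ.≤-refl
  differAtom categorical v e = notEqual v e
  differAtom numeric     v _ = outside v v ℚ.≤-refl

  equalAtom-⇔ : ∀ κ {E : Value κ → Set} v (e : E v) w → Fulfils κ {E} (equalAtom κ {E} v e) w ⇔ w ≡ v
  equalAtom-⇔ categorical v e w = mk⇔ id id
  equalAtom-⇔ numeric     v e w = mk⇔ (λ { (v≤w , w≤v) → ℚ.≤-antisym w≤v v≤w }) (λ { refl → ℚ.≤-refl , ℚ.≤-refl })

  differAtom-⇔ : ∀ κ {E : Value κ → Set} v (e : E v) w → Fulfils κ {E} (differAtom κ {E} v e) w ⇔ w ≢ v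
  differAtom-⇔ categorical v e w = mk⇔ id id
  differAtom-⇔ numeric     v e w = mk⇔
    (λ { out refl → out (ℚ.≤-refl , ℚ.≤-refl) }) (λ { ≢ (v≤w , w≤v) → ≢ (ℚ.≤-antisym w≤v v≤w) })

  module _ {t : Tuple I} (t∈ : t ∈ D) (l : Fin (length I)) where

    private
      found : ∃[ v ] All.lookup t (∈-lookup {xs = I} l) ≡ just v
      found = full-lookup t (All.lookup full t∈) (∈-lookup l)
      A = List.lookup I l
      v = proj₁ (proj₁ found)
      v∈dom = proj₂ (proj₁ found)

    equalAt differAt : AtomicOn I
    equalAt  = record { attribute = A ; member = ∈-lookup l ; atomic = equalAtom (kind A) v v∈dom }
    differAt = record { attribute = A ; member = ∈-lookup l ; atomic = differAtom (kind A) v v∈dom }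

    private
      code≡ : encodeValue (kind A) v ≡ cell t l
      code≡ = trans (cong encodeCell (sym (proj₂ found))) (cell-lookup t l)

    ⊨-equalAt⁻ : ∀ z → z ⊨ equalAt → cell z l ≡ cell t l
    ⊨-equalAt⁻ z sat = trans (sym (cell-lookup z l)) (trans (go (All.lookup z (∈-lookup l)) sat) code≡)
      where
      go : (c : Cell A) → MaybeAny.Any (Fulfils (kind A) (equalAtom (kind A) {dom A} v v∈dom) ∘ proj₁) c → encodeCell c ≡ encodeValue (kind A) v
      go (just (w , _)) (MaybeAny.just sat) = cong (encodeValue (kind A)) (Equivalence.to (equalAtom-⇔ (kind A) {dom A} v v∈dom w) sat)

    ⊨-equalAt⁺ : ∀ z → cell z l ≡ cell t l → z ⊨ equalAt
    ⊨-equalAt⁺ z eq = go (All.lookup z (∈-lookup l))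
      (encodeCell-injective (All.lookup z (∈-lookup l)) (just (v , v∈dom)) (trans (cell-lookup z l) (trans eq (sym code≡))))
      where
      go : (c : Cell A) → valueOf c ≡ just v → MaybeAny.Any (Fulfils (kind A) (equalAtom (kind A) {dom A} v v∈dom) ∘ proj₁) c
      go (just (w , _)) refl = MaybeAny.just (Equivalence.from (equalAtom-⇔ (kind A) {dom A} v v∈dom w) refl)

    -- This is where nulls would do harm: a null is different from v, yet it satisfies no condition.
    ⊨-differAt : ∀ {z} → z ∈ D → cell z l ≢ cell t l → z ⊨ differAt
    ⊨-differAt {z} z∈ ≢ with full-lookup z (All.lookup full z∈) (∈-lookup {xs = I} l)
    ... | (w , w∈dom) , eq = subst (MaybeAny.Any (Fulfils (kind A) (differAtom (kind A) {dom A} v v∈dom) ∘ proj₁)) (sym eq)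
      (MaybeAny.just (Equivalence.from (differAtom-⇔ (kind A) {dom A} v v∈dom w)
        λ w≡v → ≢ (trans (sym (cell-lookup z l)) (trans (cong encodeCell eq) (trans (cong (encodeValue (kind A)) w≡v) code≡)))))

    ⊭-differAt : ¬ t ⊨ differAt
    ⊭-differAt sat with subst (MaybeAny.Any (Fulfils (kind A) (differAtom (kind A) {dom A} v v∈dom) ∘ proj₁)) (proj₂ found) sat
    ... | MaybeAny.just fulfils = Equivalence.to (differAtom-⇔ (kind A) {dom A} v v∈dom v) fulfils refl

  module Completeness {s : ℚ} {p : ℕ} (↥s≡p : ↥ s ≡ ℤ.+ p) {k : ℕ}
    (2≤ : 2 ≤ length variedColumns) (k≤ : k ≤ length variedColumns)
    {t u : Tuple I} (t∈ : t ∈ D) (u∈ : u ∈ D) (j : Fin (length I))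
    (bound : p * length (Class j t) ≤ ↧ₙ s * length (Deviating j t u)) where

    private
      others : List (Fin (length I))
      others = filter (λ l → ¬? (l Fin.≟ j)) variedColumns

      others∈ : ∀ {l} → l ∈ others → l ∈ variedColumns × l ≢ j
      others∈ = ∈-filter⁻ (λ l → ¬? (l Fin.≟ j)) {xs = variedColumns}

      varied-unique : Unique variedColumns
      varied-unique = Unique.filter⁺ varied? (Unique.allFin⁺ (length I))

      -- Whether or not `j` is itself among the varied columns, the single head condition makes up
      -- for its removal from the body.
      others-length : length variedColumns ≤ suc (length others)
      others-length = unique-length {ys = j ∷ others} varied-unique λ {l} l∈ → case l Fin.≟ j of λ
        { (yes l≡j) → here l≡j ; (no l≢j) → there (∈-filter⁺ (λ l → ¬? (l Fin.≟ j)) l∈ l≢j) }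

      some-other : ∃[ l ] l ∈ others
      some-other = member-of (≤-pred (≤-trans 2≤ others-length))

      bodyAtoms : List (AtomicOn I)
      bodyAtoms = List.map (equalAt t∈) others

      body-attributes : List.map attribute bodyAtoms ≡ List.map (List.lookup I) others
      body-attributes = sym (List.map-∘ others)

      body-attribute : ∀ {A} → A ∈ List.map attribute bodyAtoms → ∃[ l ] l ∈ others × A ≡ List.lookup I l
      body-attribute A∈ = ∈-map⁻ (List.lookup I) (subst (_ ∈_) body-attributes A∈)

      A∉body : ¬ List.lookup I j ∈ List.map attribute bodyAtoms
      A∉body A∈ = let l , l∈ , eq = body-attribute A∈ in
        proj₂ (others∈ l∈) (sym (lookup-injective I-unique j l eq))

      body′ head′ : Condition I
      body′ = record
        { atoms    = bodyAtoms
        ; distinct = subst Unique (sym body-attributes) (Unique.map⁺ (λ {i} {l} → lookup-injective I-unique i l)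
                       (Unique.filter⁺ (λ l → ¬? (l Fin.≟ j)) varied-unique))
        }
      head′ = record { atoms = [ differAt u∈ j ] ; distinct = [] ∷ [] }

      nonempty⊄ : ∀ {xs : List Identifier} {x} → x ∈ xs → [] ⊂ xs
      nonempty⊄ x∈ = (λ ()) , λ ⊆ → case ⊆ x∈ of λ ()

      in-body : List.lookup I (proj₁ some-other) ∈ List.map attribute bodyAtoms
      in-body = subst (List.lookup I (proj₁ some-other) ∈_) (sym body-attributes) (∈-map⁺ (List.lookup I) (proj₂ some-other))

    rule : Rule I
    rule = record
      { body          = body′
      ; head          = head′
      ; body-nonempty = nonempty⊄ in-body
      ; body-proper   = (λ A∈ → let l , _ , eq = body-attribute A∈ in subst (_∈ I) (sym eq) (∈-lookup l)) ,
                        λ ⊆ → A∉body (⊆ (∈-lookup j))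
      ; head-nonempty = nonempty⊄ (here refl)
      ; head-proper   = (λ { (here refl) → ∈-lookup j }) ,
                        λ ⊆ → case ⊆ (∈-lookup (proj₁ some-other)) of λ
                          { (here eq) → proj₂ (others∈ (proj₂ some-other)) (lookup-injective I-unique (proj₁ some-other) j eq) }
      ; disjoint      = λ { (A∈ , here refl) → A∉body A∈ }
      }

    private
      -- The head condition is refuted by `u`, which supplied its value. For a body condition on a
      -- varied column take two tuples that differ there: they cannot both have the value of `t`.
      fails : ∀ {a} → a ∈ conjunction rule → ∃[ z ] z ∈ D × ¬ z ⊨ a
      fails a∈ with Any.++⁻ bodyAtoms a∈
      ... | inj₂ (here refl) = u , u∈ , ⊭-differAt u∈ j
      ... | inj₁ a∈body with ∈-map⁻ (equalAt t∈) a∈body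
      ...   | l , l∈ , refl with find (proj₂ (∈-filter⁻ varied? {xs = allFin (length I)} (proj₁ (others∈ l∈))))
      ...     | y , y∈ , h with find h
      ...       | z , z∈ , y≢z with cell y l ≟ʷ cell t l
      ...         | no y≢t  = y , y∈ , λ sat → y≢t (⊨-equalAt⁻ t∈ l y sat)
      ...         | yes y≡t = z , z∈ , λ sat → y≢z (trans y≡t (sym (⊨-equalAt⁻ t∈ l z sat)))

    rule-nontrivial : ¬ Trivial rule D
    rule-nontrivial trivial with find trivial
    ... | a , a∈ , select↭ with fails a∈
    ...   | z , z∈ , z⊭a = <-irrefl (↭-length select↭)
      (List.filter-notAll (satisfies? [ a ]) D (lose z∈ λ { (z⊨a ∷ []) → z⊭a z⊨a }))

    rule-size : k ≤ ruleSize rule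
    rule-size = begin
      k                                 ≤⟨ k≤ ⟩
      length variedColumns              ≤⟨ others-length ⟩
      suc (length others)               ≡⟨ cong suc (List.length-map (equalAt t∈) others) ⟨
      suc (length bodyAtoms)            ≡⟨ +-comm 1 (length bodyAtoms) ⟩
      length bodyAtoms + 1              ∎
      where open ≤-Reasoning

    private
      agree-body : ∀ z → AgreeOff j z t → All (z ⊨_) bodyAtoms
      agree-body z agree = All.map⁺ (All.tabulate λ {l} l∈ → ⊨-equalAt⁺ t∈ l z (agree l (proj₂ (others∈ l∈))))

      -- The body says nothing about constant columns, but no tuples differ there: a column other
      -- than `j` in which `z` and `t` differ is varied and so carries a body condition.
      body-agree : ∀ {z} → z ∈ D → All (z ⊨_) bodyAtoms → AgreeOff j z t
      body-agree {z} z∈ sat l l≢j = decidable-stable (cell z l ≟ʷ cell t l) λ z≢t →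
        z≢t (⊨-equalAt⁻ t∈ l z (All.lookup (All.map⁻ sat) (∈-filter⁺ (λ l → ¬? (l Fin.≟ j)) (differ-varied z∈ t∈ z≢t) l≢j)))

      selected : List (AtomicOn I) → ℕ
      selected as = length (select as D)

      body≤ : selected bodyAtoms ≤ length (Class j t)
      body≤ = #-mono (satisfies? bodyAtoms) (λ z → agreeOff? j z t) D body-agree

      conjunction≥ : length (Deviating j t u) ≤ selected (conjunction rule)
      conjunction≥ = #-mono (λ z → agreeOff? j z t ×-dec ¬? (cell z j ≟ʷ cell u j)) (satisfies? (conjunction rule)) D
        λ {z} z∈ (agree , ≢u) → All.++⁺ (agree-body z agree) (⊨-differAt u∈ j z∈ ≢u ∷ [])

      0<body : 0 < selected bodyAtoms
      0<body = List.filter-some (satisfies? bodyAtoms) (lose t∈ (agree-body t (agree-refl {j} {t})))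

      ratio-≥ : ∀ a n → 0 < n → p * n ≤ ↧ₙ s * a → s ℚ.≤ ratio a n
      ratio-≥ a (suc n) _ h = Equivalence.from (ratio-⇔ {s} ↥s≡p a n) h

    rule-confidence : s ℚ.≤ cnf rule D
    rule-confidence = ratio-≥ (selected (conjunction rule)) (selected bodyAtoms) 0<body
      (≤-trans (*-monoʳ-≤ p body≤) (≤-trans bound (*-monoʳ-≤ (↧ₙ s) conjunction≥)))

-- Membership in P

positive-numerator : ∀ {s} → 0ℚ ℚ.< s → ∃[ p ] ↥ s ≡ ℤ.+ p × 0 < p
positive-numerator {mkℚ (ℤ.+ zero) q c} 0<s    = contradiction 0<s (ℚ.<-irrefl (sym (ℚ.↥p≡0⇒p≡0 (mkℚ (ℤ.+ zero) q c) refl)))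
positive-numerator {mkℚ (ℤ.+ suc p) q c} 0<s   = suc p , refl , s≤s z≤n
positive-numerator {mkℚ -[1+ p ] q c} 0<s    = contradiction 0<s (ℚ.<-asym (ℚ.negative⁻¹ (mkℚ -[1+ p ] q c)))

reflects-⇔ : ∀ {P : Set} {b} → T b ⇔ P → Reflects P b
reflects-⇔ {b = true}  e = ofʸ (Equivalence.to e tt)
reflects-⇔ {b = false} e = ofⁿ (Equivalence.from e)

module Correctness (U : Universe) (x : Mining.Input U) where
  open Mining U hiding (head; body)
  open Input x renaming (T to D)
  open Decider U
  open Sentence U
  open Encoding U

  decision : Bool
  decision = ⟦ sentence ⟧ (table (rowsOf D) []) (constants (encodeℕ (↧ₙ s)) (encodeℤ (↥ s)) (encodeℕ k))

  decision-⇔ : T decision ⇔ HasRule cnf x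
  decision-⇔ = go I D I-unique withoutNulls k≤∣I∣
    where
    go : ∀ I (D : Database I) → Unique I → WithoutNulls D → k ≤ length I →
      T (⟦ sentence ⟧ (table (rowsOf D) []) (constants (encodeℕ (↧ₙ s)) (encodeℤ (↥ s)) (encodeℕ k))) ⇔
      (Σ[ R ∈ Rule I ] ¬ Trivial R D × k ≤ ruleSize R × s ℚ.≤ cnf R D)
    -- `Rules` and `Meaning` presuppose a first column, which 1 ≤ k ≤ |I| guarantees.
    go []       D I-unique full k≤0 = contradiction (≤-trans 1≤k k≤0) λ ()
    go (A₀ ∷ I₀) D I-unique full _  = mk⇔ (to ∘ Equivalence.to meaning) (Equivalence.from meaning ∘ from)
      where
      open Rules U A₀ I₀ I-unique D full
      module M = Meaning U row D (λ {t} t∈ → full-clean t (All.lookup full t∈))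
      numerator = positive-numerator 0<s
      p = proj₁ numerator
      ↥s≡p = proj₁ (proj₂ numerator)
      0<p = proj₂ (proj₂ numerator)
      num≡ : number (encodeℤ (↥ s)) ≡ p
      num≡ = trans (cong (λ z → number (encodeℤ z)) ↥s≡p) (number-encodeℕ p)
      meaning : T (⟦ sentence ⟧ (table (rowsOf D) []) (constants (encodeℕ (↧ₙ s)) (encodeℤ (↥ s)) (encodeℕ k))) ⇔
                M.Criterion (encodeℕ (↧ₙ s)) (encodeℤ (↥ s)) (encodeℕ k)
      meaning = M.sentence-⇔ (encodeℕ (↧ₙ s)) (encodeℤ (↥ s)) (encodeℕ k)
      to : M.Criterion (encodeℕ (↧ₙ s)) (encodeℤ (↥ s)) (encodeℕ k) →
           Σ[ R ∈ Rule (A₀ ∷ I₀) ] ¬ Trivial R D × k ≤ ruleSize R × s ℚ.≤ cnf R D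
      to (2≤ , k≤ , t , u , t∈ , u∈ , j , bound) = C.rule , C.rule-nontrivial , C.rule-size , C.rule-confidence
        where
        module C = Completeness {s} ↥s≡p 2≤ (≤-trans (≤-reflexive (sym (number-encodeℕ k))) k≤) t∈ u∈ j
          (subst₂ (λ a b → a * length (M.Class j t) ≤ b * length (M.Deviating j t u)) num≡ (number-encodeℕ (↧ₙ s)) bound)
      from : (Σ[ R ∈ Rule (A₀ ∷ I₀) ] ¬ Trivial R D × k ≤ ruleSize R × s ℚ.≤ cnf R D) →
             M.Criterion (encodeℕ (↧ₙ s)) (encodeℤ (↥ s)) (encodeℕ k)
      from (R , nontrivial , k≤ , s≤) = Soundness.sound {s} ↥s≡p 0<s 0<p {encodeℕ k} {encodeℤ (↥ s)} {encodeℕ (↧ₙ s)} num≡ (number-encodeℕ (↧ₙ s))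
        R nontrivial (≤-trans (≤-reflexive (number-encodeℕ k)) k≤) s≤

module _ (U : Universe) where
  open Mining U using (Input; HasRule; cnf; problem; encodeInput; encodeℕ; encodeℤ)
  open Decider U
  open Sentence U
  open Time U
  open Encoding U

  decisionOf : Formula 3 6 → Input → Bool
  decisionOf φ x = ⟦ φ ⟧ (table (rowsOf D) []) (constants (encodeℕ (↧ₙ s)) (encodeℤ (↥ s)) (encodeℕ k))
    where open Input x renaming (T to D)

  decider-correct : ∀ φ {c e} → (∀ m → suc (decideCost φ m) ≤ c * m ^ e + c) → ∀ x →
    HaltsWithin (decider φ) (c * length (encodeInput x) ^ e + c) (encodeInput x) (decisionOf φ x)
  decider-correct φ {c} {e} bound x =
    subst (λ w → HaltsWithin (decider φ) (c * length w ^ e + c) w (decisionOf φ x)) (sym (encodeInput≡ x))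
      (decider-halts φ
        (word-avoids (λ _ ()) (proj₁ (toDigits 2 k)))
        (integer-avoids (λ _ ()) (λ ()) (↥ s))
        (word-avoids (λ _ ()) (proj₁ (toDigits 2 (↧ₙ s))))
        (attributeWord-NoSemicolon I) (good-rows D)
        (bound (length (wordOf (encodeℕ k) (encodeℤ (↥ s)) (encodeℕ (↧ₙ s)) (attributeWord I) (rowsOf D)))))
    where open Input x renaming (T to D)

  -- The degree and the constant of the running time depend on the formula only, so one machine and
  -- one polynomial serve all inputs.
  definable-InP : ∀ φ → (∀ x → T (decisionOf φ x) ⇔ HasRule cnf x) →
                  (∃₂ λ c e → ∀ m → suc (decideCost φ m) ≤ c * m ^ e + c) → InP (problem cnf)
  definable-InP φ correct (c , e , bound) = decider φ , c , e , λ x →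
    decisionOf φ x , decider-correct φ {c} {e} bound x , reflects-⇔ (correct x)

theorem3p3 : (U : Universe) → InP (Mining.problem U (Mining.cnf U))
theorem3p3 U = definable-InP U (Sentence.sentence U) (Correctness.decision-⇔ U) (Time.decideCost-bound U (Sentence.sentence U))
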